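{- Let $S_7=\{(3,-1,-1,-2),(4,-1,0,-3),(4,0,0,-6),(4,1,0,-9)\}$. If $(t_1,t_2,t_3,t_4)\in S_7$, then for all integers $n\geq 0$, $$a_{1^{t_1}2^{t_2}3^{t_3}4^{t_4}}(2n)>0,\qquad a_{1^{t_1}2^{t_2}3^{t_3}4^{t_4}}(4n+1)<0,\qquad a_{1^{t_1}2^{t_2}3^{t_3}4^{t_4}}(4n+3)>0.$$
   Context: For $|q|<1$ (or as formal power series in $q$) let $f_j:=(q^j;q^j)_\infty=\prod_{k\ge 1}(1-q^{jk})$ for each positive integer $j$. For a positive integer $m$ and integers $t_1,\dots,t_m$ (possibly zero or negative), the integers $a_{1^{t_1}2^{t_2}\cdots m^{t_m}}(n)$, $n\ge 0$, are defined by $\sum_{n=0}^\infty a_{1^{t_1}2^{t_2}\cdots m^{t_m}}(n)q^n=f_1^{t_1}f_2^{t_2}\cdots f_m^{t_m}$. -}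

module Defs where

open import Data.Bool.Base using (if_then_else_)
open import Data.Fin.Base using (Fin; zero; suc; toℕ)
open import Data.Integer.Base using (ℤ; +_; -[1+_]; 0ℤ; 1ℤ; _+_; _-_; -_; _*_)
open import Data.Integer.Properties
  using (+-0-monoid; *-identityˡ; +-inverseʳ; +-comm)
open import Data.List.Base as List using (List)
open import Data.Nat.Base as ℕ using (ℕ; zero; suc; _∸_; _≡ᵇ_; NonZero)
open import Data.Vec.Base using (Vec; []; _∷_; lookup)
open import Relation.Binary.PropositionalEquality
  using (_≡_; refl; sym; trans; cong; cong₂; module ≡-Reasoning)

open import Algebra.Properties.Monoid.Sum +-0-monoid using (sum⁺-syntax; sum-cong-≗)

-- Formal power series in q over ℤ, given by their coefficients.
Series : Set
Series = ℕ → ℤ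

infixl 7 _⊛_
infixr 8 _^_ _^ⁿ_

q^_ : ℕ → Series
(q^ m) n = if n ≡ᵇ m then 1ℤ else 0ℤ

one : Series
one = q^ 0

1-q^_ : ℕ → Series
(1-q^ m) n = one n - (q^ m) n

_⊛_ : Series → Series → Series
(f ⊛ g) n = ∑[ i ≤ n ] (f (toℕ i) * g (n ∸ toℕ i))

-- The coefficients of 1/f in the order n, n-1, …, 0, obtained by solving
-- f ⊛ g = one for g degree by degree.  This is meaningful only when f has
-- constant term 1; see ⊛-inv.
invRev : Series → (n : ℕ) → Vec ℤ (suc n)
invRev f zero    = 1ℤ ∷ []
invRev f (suc n) = - ∑[ i ≤ n ] (f (suc (toℕ i)) * lookup (invRev f n) i) ∷ invRev f n

inv : Series → Series
inv f n = lookup (invRev f n) zero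

_^ⁿ_ : Series → ℕ → Series
f ^ⁿ zero  = one
f ^ⁿ suc k = f ⊛ (f ^ⁿ k)

_^_ : Series → ℤ → Series
f ^ (+ k)    = f ^ⁿ k
f ^ -[1+ k ] = inv f ^ⁿ suc k

-- ∏ (1 - q^(j k)) over 1 ≤ k ≤ N
partialProduct : ℕ → ℕ → Series
partialProduct j zero    = one
partialProduct j (suc N) = partialProduct j N ⊛ (1-q^ (j ℕ.* suc N))

-- f_j = (q^j; q^j)_∞.  As j ≥ 1, the factors with k > n do not affect the
-- coefficient of q^n, so that coefficient is the one of the n-th partial product.
f[_] : (j : ℕ) .{{_ : NonZero j}} → Series
f[ j ] n = partialProduct j n n

-- f_s^(t₁) f_(s+1)^(t₂) ⋯ f_(s+m-1)^(tₘ) for s ≥ 1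
etaProductFrom : (s : ℕ) .{{_ : NonZero s}} {m : ℕ} → Vec ℤ m → Series
etaProductFrom s []       = one
etaProductFrom s (t ∷ ts) = f[ s ] ^ t ⊛ etaProductFrom (suc s) ts

-- The coefficient of q^n in f_1^(t₁) f_2^(t₂) ⋯ f_m^(tₘ).
a : {m : ℕ} → Vec ℤ m → ℕ → ℤ
a ts = etaProductFrom 1 ts

S₇ : List (Vec ℤ 4)
S₇ = (+ 3 ∷ - + 1 ∷ - + 1 ∷ - + 2 ∷ [])
  List.∷ (+ 4 ∷ - + 1 ∷ + 0 ∷ - + 3 ∷ [])
  List.∷ (+ 4 ∷ + 0 ∷ + 0 ∷ - + 6 ∷ [])
  List.∷ (+ 4 ∷ + 1 ∷ + 0 ∷ - + 9 ∷ [])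
  List.∷ List.[]

lookup-invRev : ∀ f n (i : Fin (suc n)) → lookup (invRev f n) i ≡ inv f (n ∸ toℕ i)
lookup-invRev f n       zero    = refl
lookup-invRev f (suc n) (suc i) = lookup-invRev f n i

⊛-inv : ∀ f → f 0 ≡ 1ℤ → ∀ n → (f ⊛ inv f) n ≡ one n
⊛-inv f f₀≡1 zero    rewrite f₀≡1 = refl
⊛-inv f f₀≡1 (suc n) = begin
  f 0 * (- s) + ∑[ i ≤ n ] (f (suc (toℕ i)) * inv f (n ∸ toℕ i))
    ≡⟨ cong₂ _+_ (trans (cong (_* (- s)) f₀≡1) (*-identityˡ (- s)))
         (sum-cong-≗ λ i → cong (f (suc (toℕ i)) *_) (sym (lookup-invRev f n i))) ⟩
  - s + s
    ≡⟨ trans (+-comm (- s) s) (+-inverseʳ s) ⟩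
  0ℤ ∎
  where
  open ≡-Reasoning
  s : ℤ
  s = ∑[ i ≤ n ] (f (suc (toℕ i)) * lookup (invRev f n) i)

f[]-constantTerm : ∀ j .{{_ : NonZero j}} → f[ j ] 0 ≡ 1ℤ
f[]-constantTerm j = refl

{-# OPTIONS --safe #-}
module Submission where

-- Write f(a,b) = Σ a^(n(n+1)/2) b^(n(n-1)/2).  By the triple product identity the
-- theta functions f(±q^i, ±q^j) used here are eta quotients, and rotating the
-- lattice ℤ² by 45° gives the 2-dissection of a product f(a,b) f(c,d) with ab = cd.
-- This yields
--   f₁⁴/f₂² = f₄¹⁰/(f₂⁴f₈⁴) - 4q f₈⁴/f₄²,
--   f₁³/f₃  = f₄³/f₁₂ - 3q f₂²f₁₂³/(f₄f₆²),
-- the odd part of the second one being read off from the 2-dissections of f₃³/f₁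
-- and f₁²f₃².  Multiplied by a quotient of f₂ and f₄, they become 2-dissections
-- α(q²) - cq β(q²) of the four eta products.  All coefficients of α(q) and of
-- β(-q) are positive: both are products of reciprocals 1/f_j, symbols (-q^i; q^j)_∞
-- and theta functions with nonnegative coefficients.

open import Defs
open import Algebra.Bundles using (CommutativeRing)
open import Algebra.Solver.Ring.AlmostCommutativeRing
  using (fromCommutativeRing; _-Raw-AlmostCommutative⟶_)
import Algebra.Solver.Ring
open import Data.Fin.Base using (Fin; zero; suc; toℕ)
open import Data.Fin.Patterns
open import Data.Fin.Properties using (toℕ<n)
open import Data.Integer.Base as ℤ using (ℤ; +_; -[1+_]; 0ℤ; 1ℤ; -1ℤ; ∣_∣; _<_; _>_)
import Data.Integer.Properties as ℤ
open import Data.Integer.Tactic.RingSolver using () renaming (solve-∀ to ℤ-solve)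
open import Data.List.Membership.Propositional using (_∈_)
open import Data.List.Relation.Unary.Any using (here; there)
open import Data.Maybe.Base using (Maybe; just; nothing)
open import Data.Nat.Base as ℕ using (ℕ; zero; suc; _∸_; z≤n; s≤s; NonZero)
open import Data.Nat.Induction using (<-rec)
import Data.Nat.Properties as ℕ
open import Data.Nat.Tactic.RingSolver using () renaming (solve-∀ to ℕ-solve)
open import Data.Product.Base using (_×_; _,_)
open import Data.Sum.Base using (inj₁; inj₂)
open import Data.Vec.Base using (Vec; []; _∷_; zipWith; map; replicate; lookup; _[_]≔_)
open import Data.Vec.Relation.Unary.All using (All; []; _∷_)
open import Level using (0ℓ)
open import Relation.Binary.Bundles using (Setoid)
open import Relation.Binary.PropositionalEquality as ≡ using (_≡_; cong; cong₂; module ≡-Reasoning)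
import Relation.Binary.Reasoning.Setoid as SetoidReasoning
open import Relation.Nullary using (yes; no)
open import Algebra.Properties.AbelianGroup ℤ.+-0-abelianGroup using (∙-cancelʳ)
open import Algebra.Properties.Monoid.Sum ℤ.+-0-monoid using (sum-cong-≗)

-- The detour for the odd part of f₁³/f₃ has this reason. Up to a factor in q², f₁³/f₃ is a product
-- U³V of theta functions, and the addition formula presents each half of its dissection as a sum of
-- two theta products. In the even half these share a factor PQ, and what remains is R², again by
-- the addition formula. The odd half, -(ΦP³ + ΨQ³), offers no such factorisation. Multiplied by
-- f₃³/f₁, both of whose parts are eta quotients, it enters the odd part of f₁²f₃² linearly; UV
-- squared gives that odd part a second time, so one division isolates the unknown. Infinite sums
-- and products are read off from finite truncations. Identities between them are therefore proved
-- modulo q^K for every K, where each rearrangement is finite. Nonnegative factors alone do not give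
-- strict positivity. It comes from a factor that reaches every exponent: (-q; q)_∞, or a theta
-- function combined with 1/f₂ or 1/f₄, which are positive on a whole residue class.

infix  4 _≈_ _≈[_]_
infixl 7 _·_
infixl 6 _⊕_
infix  8 ⊖_

-- The ring of formal power series

record _≈_ (f g : Series) : Set where
  constructor pointwise
  field at : ∀ n → f n ≡ g n
open _≈_

-- Congruence modulo q^K. Limits appear only in this form: `≈[]⇒≈` recovers equality from the
-- congruences for all K.
record _≈[_]_ (f : Series) (K : ℕ) (g : Series) : Set where
  constructor below
  field at< : ∀ n → n ℕ.< K → f n ≡ g n
open _≈[_]_

tail : Series → Series
tail f n = f (suc n)

constant : ℤ → Series
constant c zero    = c
constant c (suc n) = 0ℤ

-- The operations are opaque because the arguments of a transparent one cannot
-- be inferred: unification η-expands series and compares coefficients.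
opaque
  _·_ : Series → Series → Series
  _·_ = _⊛_

opaque
  _⊕_ : Series → Series → Series
  (f ⊕ g) n = f n ℤ.+ g n

opaque
  ⊖_ : Series → Series
  (⊖ f) n = ℤ.- f n

opaque
  const : ℤ → Series
  const = constant

opaque
  q↑_ : ℕ → Series
  q↑_ = q^_

𝟘 𝟙 : Series
𝟘 = const 0ℤ
𝟙 = const 1ℤ

≈-refl : ∀ {f} → f ≈ f
≈-refl = pointwise λ _ → ≡.refl

≈-sym : ∀ {f g} → f ≈ g → g ≈ f
≈-sym e = pointwise λ n → ≡.sym (e .at n)

≈-trans : ∀ {f g h} → f ≈ g → g ≈ h → f ≈ h
≈-trans e e′ = pointwise λ n → ≡.trans (e .at n) (e′ .at n)

opaque
  unfolding _·_ _⊕_ ⊖_ const q↑_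

  ·-zero : ∀ f g → (f · g) 0 ≡ f 0 ℤ.* g 0
  ·-zero f g = ℤ.+-identityʳ _

  -- The recursion behind the ring laws. Only the left factor passes to its tail, so the inductions
  -- below generalise over it.
  ·-suc : ∀ f g n → (f · g) (suc n) ≡ f 0 ℤ.* g (suc n) ℤ.+ (tail f · g) n
  ·-suc f g n = ≡.refl

  ·-def : ∀ f g → f ⊛ g ≈ f · g
  ·-def f g = ≈-refl

  ⊕-def : ∀ f g n → (f ⊕ g) n ≡ f n ℤ.+ g n
  ⊕-def f g n = ≡.refl

  const-zero : ∀ c → const c 0 ≡ c
  const-zero c = ≡.refl

  const-suc : ∀ c n → const c (suc n) ≡ 0ℤ
  const-suc c n = ≡.refl

  q↑-def : ∀ m → q^ m ≈ q↑ m
  q↑-def m = ≈-refl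

  ·-cong-below : ∀ {K f f′ g g′} → f ≈[ K ] f′ → g ≈[ K ] g′ → f · g ≈[ K ] f′ · g′
  ·-cong-below e e′ = below λ n n<K → sum-cong-≗ λ i → cong₂ ℤ._*_
    (e .at< (toℕ i) (ℕ.<-≤-trans (toℕ<n i) n<K))
    (e′ .at< (n ∸ toℕ i) (ℕ.≤-<-trans (ℕ.m∸n≤m n (toℕ i)) n<K))

  ⊕-cong-below : ∀ {K f f′ g g′} → f ≈[ K ] f′ → g ≈[ K ] g′ → f ⊕ g ≈[ K ] f′ ⊕ g′
  ⊕-cong-below e e′ = below λ n n<K → cong₂ ℤ._+_ (e .at< n n<K) (e′ .at< n n<K)

  ⊖-cong-below : ∀ {K f f′} → f ≈[ K ] f′ → ⊖ f ≈[ K ] ⊖ f′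
  ⊖-cong-below e = below λ n n<K → cong ℤ.-_ (e .at< n n<K)

≈⇒≈[] : ∀ {f g} K → f ≈ g → f ≈[ K ] g
≈⇒≈[] K e = below λ n _ → e .at n

≈[]⇒≈ : ∀ {f g} → (∀ K → f ≈[ K ] g) → f ≈ g
≈[]⇒≈ e = pointwise λ n → e (suc n) .at< n (ℕ.n<1+n n)

·-cong : ∀ {f f′ g g′} → f ≈ f′ → g ≈ g′ → f · g ≈ f′ · g′
·-cong e e′ = ≈[]⇒≈ λ K → ·-cong-below (≈⇒≈[] K e) (≈⇒≈[] K e′)

⊕-cong : ∀ {f f′ g g′} → f ≈ f′ → g ≈ g′ → f ⊕ g ≈ f′ ⊕ g′
⊕-cong e e′ = ≈[]⇒≈ λ K → ⊕-cong-below (≈⇒≈[] K e) (≈⇒≈[] K e′)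

⊖-cong : ∀ {f f′} → f ≈ f′ → ⊖ f ≈ ⊖ f′
⊖-cong e = ≈[]⇒≈ λ K → ⊖-cong-below (≈⇒≈[] K e)

opaque
  unfolding _·_ _⊕_ ⊖_ const q↑_

  ·-distribʳ : ∀ h f g → (f ⊕ g) · h ≈ (f · h) ⊕ (g · h)
  ·-distribʳ h f g = pointwise (go f g)
    where
    go : ∀ f g n → ((f ⊕ g) · h) n ≡ ((f · h) ⊕ (g · h)) n
    go f g zero = lemma (f 0) (g 0) (h 0)
      where
      lemma : ∀ a b c → (a ℤ.+ b) ℤ.* c ℤ.+ 0ℤ ≡ (a ℤ.* c ℤ.+ 0ℤ) ℤ.+ (b ℤ.* c ℤ.+ 0ℤ)
      lemma = ℤ-solve
    go f g (suc n) = ≡.trans (cong (ℤ._+_ ((f 0 ℤ.+ g 0) ℤ.* h (suc n))) (go (tail f) (tail g) n))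
      (lemma (f 0) (g 0) (h (suc n)) ((tail f · h) n) ((tail g · h) n))
      where
      lemma : ∀ a b c x y → (a ℤ.+ b) ℤ.* c ℤ.+ (x ℤ.+ y) ≡ (a ℤ.* c ℤ.+ x) ℤ.+ (b ℤ.* c ℤ.+ y)
      lemma = ℤ-solve

  -- The mirror image of `·-suc`; the two recursions together give commutativity.
  ·-sucʳ : ∀ f g n → (f · g) (suc n) ≡ (f · tail g) n ℤ.+ f (suc n) ℤ.* g 0
  ·-sucʳ f g zero = lemma (f 0 ℤ.* g 1) (f 1 ℤ.* g 0)
    where
    lemma : ∀ a b → a ℤ.+ (b ℤ.+ 0ℤ) ≡ (a ℤ.+ 0ℤ) ℤ.+ b
    lemma = ℤ-solve
  ·-sucʳ f g (suc n) = ≡.trans (cong (ℤ._+_ (f 0 ℤ.* g (suc (suc n)))) (·-sucʳ (tail f) g n))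
    (≡.sym (ℤ.+-assoc (f 0 ℤ.* g (suc (suc n))) _ _))

  ·-comm : ∀ f g → f · g ≈ g · f
  ·-comm f g = pointwise (go f g)
    where
    go : ∀ f g n → (f · g) n ≡ (g · f) n
    go f g zero = cong (ℤ._+ 0ℤ) (ℤ.*-comm (f 0) (g 0))
    go f g (suc n) = ≡.trans
      (cong₂ ℤ._+_ (ℤ.*-comm (f 0) (g (suc n))) (go (tail f) g n))
      (≡.trans (ℤ.+-comm (g (suc n) ℤ.* f 0) _) (≡.sym (·-sucʳ g f n)))

  scale-· : ∀ c f g n → ((λ k → c ℤ.* f k) · g) n ≡ c ℤ.* (f · g) n
  scale-· c f g zero = lemma c (f 0) (g 0)
    where
    lemma : ∀ a b c → a ℤ.* b ℤ.* c ℤ.+ 0ℤ ≡ a ℤ.* (b ℤ.* c ℤ.+ 0ℤ)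
    lemma = ℤ-solve
  scale-· c f g (suc n) = ≡.trans (cong (ℤ._+_ (c ℤ.* f 0 ℤ.* g (suc n))) (scale-· c (tail f) g n))
    (lemma c (f 0) (g (suc n)) _)
    where
    lemma : ∀ a b c d → a ℤ.* b ℤ.* c ℤ.+ a ℤ.* d ≡ a ℤ.* (b ℤ.* c ℤ.+ d)
    lemma = ℤ-solve

  ·-assoc : ∀ f g h → (f · g) · h ≈ f · (g · h)
  ·-assoc f g h = pointwise (go f)
    where
    go : ∀ f n → ((f · g) · h) n ≡ (f · (g · h)) n
    go f zero = lemma (f 0) (g 0) (h 0)
      where
      lemma : ∀ a b c → (a ℤ.* b ℤ.+ 0ℤ) ℤ.* c ℤ.+ 0ℤ ≡ a ℤ.* (b ℤ.* c ℤ.+ 0ℤ) ℤ.+ 0ℤ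
      lemma = ℤ-solve
    go f (suc n) = begin
      (f 0 ℤ.* g 0 ℤ.+ 0ℤ) ℤ.* h (suc n) ℤ.+ (((λ k → f 0 ℤ.* tail g k) ⊕ (tail f · g)) · h) n
        ≡⟨ cong (ℤ._+_ ((f 0 ℤ.* g 0 ℤ.+ 0ℤ) ℤ.* h (suc n)))
             (≡.trans (·-distribʳ h (λ k → f 0 ℤ.* tail g k) (tail f · g) .at n)
               (cong₂ ℤ._+_ (scale-· (f 0) (tail g) h n) (go (tail f) n))) ⟩
      (f 0 ℤ.* g 0 ℤ.+ 0ℤ) ℤ.* h (suc n) ℤ.+ (f 0 ℤ.* (tail g · h) n ℤ.+ (tail f · (g · h)) n)
        ≡⟨ lemma (f 0) (g 0) (h (suc n)) _ _ ⟩
      f 0 ℤ.* (g 0 ℤ.* h (suc n) ℤ.+ (tail g · h) n) ℤ.+ (tail f · (g · h)) n ∎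
      where
      open ≡-Reasoning
      lemma : ∀ a b c x y → (a ℤ.* b ℤ.+ 0ℤ) ℤ.* c ℤ.+ (a ℤ.* x ℤ.+ y) ≡ a ℤ.* (b ℤ.* c ℤ.+ x) ℤ.+ y
      lemma = ℤ-solve

  const-· : ∀ c f n → (const c · f) n ≡ c ℤ.* f n
  const-· c f zero    = ℤ.+-identityʳ _
  const-· c f (suc n) = ≡.trans (cong (ℤ._+_ (c ℤ.* f (suc n))) (0-· n)) (ℤ.+-identityʳ _)
    where
    0-· : ∀ n → ((λ _ → 0ℤ) · f) n ≡ 0ℤ
    0-· zero    = ≡.refl
    0-· (suc n) = ≡.trans (ℤ.+-identityˡ _) (0-· n)

  ·-identityˡ : ∀ f → 𝟙 · f ≈ f
  ·-identityˡ f = pointwise λ n → ≡.trans (const-· 1ℤ f n) (ℤ.*-identityˡ (f n))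

  ⊕-assoc : ∀ f g h → (f ⊕ g) ⊕ h ≈ f ⊕ (g ⊕ h)
  ⊕-assoc f g h = pointwise λ n → ℤ.+-assoc (f n) (g n) (h n)

  ⊕-comm : ∀ f g → f ⊕ g ≈ g ⊕ f
  ⊕-comm f g = pointwise λ n → ℤ.+-comm (f n) (g n)

  ⊕-identityˡ : ∀ f → 𝟘 ⊕ f ≈ f
  ⊕-identityˡ f = pointwise λ { zero → ℤ.+-identityˡ _ ; (suc n) → ℤ.+-identityˡ _ }

  ⊕-inverseˡ : ∀ f → ⊖ f ⊕ f ≈ 𝟘
  ⊕-inverseˡ f = pointwise λ { zero → ℤ.+-inverseˡ (f 0) ; (suc n) → ℤ.+-inverseˡ (f (suc n)) }

  const-+ : ∀ c d → const (c ℤ.+ d) ≈ const c ⊕ const d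
  const-+ c d = pointwise λ { zero → ≡.refl ; (suc n) → ≡.refl }

  const-* : ∀ c d → const (c ℤ.* d) ≈ const c · const d
  const-* c d = pointwise λ n → ≡.trans (lemma n) (≡.sym (const-· c (const d) n))
    where
    lemma : ∀ n → const (c ℤ.* d) n ≡ c ℤ.* const d n
    lemma zero    = ≡.refl
    lemma (suc n) = ≡.sym (ℤ.*-zeroʳ c)

  const-neg : ∀ c → const (ℤ.- c) ≈ ⊖ const c
  const-neg c = pointwise λ { zero → ≡.refl ; (suc n) → ≡.refl }

seriesRing : CommutativeRing 0ℓ 0ℓ
seriesRing = record
  { Carrier = Series
  ; _≈_ = _≈_
  ; _+_ = _⊕_
  ; _*_ = _·_
  ; -_  = ⊖_
  ; 0#  = 𝟘
  ; 1#  = 𝟙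
  ; isCommutativeRing = record
    { isRing = record
      { +-isAbelianGroup = record
        { isGroup = record
          { isMonoid = record
            { isSemigroup = record
              { isMagma = record
                { isEquivalence = record { refl = ≈-refl ; sym = ≈-sym ; trans = ≈-trans }
                ; ∙-cong = ⊕-cong }
              ; assoc = ⊕-assoc }
            ; identity = ⊕-identityˡ , λ f → ≈-trans (⊕-comm f 𝟘) (⊕-identityˡ f) }
          ; inverse = ⊕-inverseˡ , λ f → ≈-trans (⊕-comm f (⊖ f)) (⊕-inverseˡ f)
          ; ⁻¹-cong = ⊖-cong }
        ; comm = ⊕-comm }
      ; *-cong = ·-cong
      ; *-assoc = ·-assoc
      ; *-identity = ·-identityˡ , λ f → ≈-trans (·-comm f 𝟙) (·-identityˡ f)
      ; distrib = (λ f g h → ≈-trans (·-comm f (g ⊕ h))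
                    (≈-trans (·-distribʳ f g h) (⊕-cong (·-comm g f) (·-comm h f))))
                , ·-distribʳ }
    ; *-comm = ·-comm } }

private
  -- Integers serve as coefficients of the ring solver, so that it also does numerical arithmetic
  -- such as 2 · 2 = 4 on constant series.
  constMorphism : CommutativeRing.rawRing ℤ.+-*-commutativeRing
    -Raw-AlmostCommutative⟶ fromCommutativeRing seriesRing
  constMorphism = record
    { ⟦_⟧ = const
    ; +-homo = const-+
    ; *-homo = const-*
    ; -‿homo = const-neg
    ; 0-homo = ≈-refl
    ; 1-homo = ≈-refl }

  const≟ : ∀ c d → Maybe (const c ≈ const d)
  const≟ c d with c ℤ.≟ d
  ... | yes ≡.refl = just ≈-refl
  ... | no _       = nothing

module SeriesSolver = Algebra.Solver.Ring
  (CommutativeRing.rawRing ℤ.+-*-commutativeRing) (fromCommutativeRing seriesRing)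
  constMorphism const≟

open SeriesSolver using (solve; _:=_; _:+_; _:*_; con)

open CommutativeRing seriesRing using ()
  renaming (*-identityˡ to ·-idˡ; *-identityʳ to ·-idʳ; zeroʳ to ·-zeroʳ; setoid
    to seriesSetoid; +-identityʳ to ⊕-idʳ)

module ≈-Reasoning = SetoidReasoning seriesSetoid

below-refl : ∀ {K f} → f ≈[ K ] f
below-refl = below λ _ _ → ≡.refl

below-sym : ∀ {K f g} → f ≈[ K ] g → g ≈[ K ] f
below-sym e = below λ n n<K → ≡.sym (e .at< n n<K)

below-trans : ∀ {K f g h} → f ≈[ K ] g → g ≈[ K ] h → f ≈[ K ] h
below-trans e e′ = below λ n n<K → ≡.trans (e .at< n n<K) (e′ .at< n n<K)

below-weaken : ∀ {K L f g} → K ℕ.≤ L → f ≈[ L ] g → f ≈[ K ] g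
below-weaken K≤L e = below λ n n<K → e .at< n (ℕ.<-≤-trans n<K K≤L)

belowSetoid : ℕ → Setoid 0ℓ 0ℓ
belowSetoid K = record
  { Carrier = Series
  ; _≈_ = _≈[ K ]_
  ; isEquivalence = record { refl = below-refl ; sym = below-sym ; trans = below-trans } }

module ≈[]-Reasoning (K : ℕ) = SetoidReasoning (belowSetoid K)

≡⇒≈ : ∀ {f g : Series} → f ≡ g → f ≈ g
≡⇒≈ ≡.refl = ≈-refl

·-congˡ : ∀ {f g h} → g ≈ h → f · g ≈ f · h
·-congˡ = ·-cong ≈-refl

·-congʳ : ∀ {f g h} → g ≈ h → g · f ≈ h · f
·-congʳ e = ·-cong e ≈-refl

one≈𝟙 : one ≈ 𝟙
one≈𝟙 = pointwise λ
  { zero → ≡.sym (const-zero 1ℤ) ; (suc n) → ≡.sym (const-suc 1ℤ n) }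

q↑0 : q↑ 0 ≈ 𝟙
q↑0 = ≈-trans (≈-sym (q↑-def 0)) one≈𝟙

opaque
  unfolding q↑_

  q↑-·-zero : ∀ m f → (q↑ suc m · f) 0 ≡ 0ℤ
  q↑-·-zero m f = ≡.trans (·-zero _ f) (ℤ.*-zeroˡ (f 0))

  q↑-·-suc : ∀ m f n → (q↑ suc m · f) (suc n) ≡ (q↑ m · f) n
  q↑-·-suc m f n = ≡.trans (·-suc _ f n)
    (≡.trans (cong (λ x → x ℤ.+ (q↑ m · f) n) (ℤ.*-zeroˡ (f (suc n)))) (ℤ.+-identityˡ _))

  q↑-suc-zero : ∀ m → (q↑ suc m) 0 ≡ 0ℤ
  q↑-suc-zero m = ≡.refl

  q↑-suc-suc : ∀ m n → (q↑ suc m) (suc n) ≡ (q↑ m) n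
  q↑-suc-suc m n = ≡.refl

q↑-+ : ∀ a b → q↑ a · q↑ b ≈ q↑ (a ℕ.+ b)
q↑-+ zero    b = ≈-trans (·-congʳ q↑0) (·-idˡ _)
q↑-+ (suc a) b = pointwise λ
  { zero → ≡.trans (q↑-·-zero a _) (≡.sym (q↑-suc-zero (a ℕ.+ b)))
  ; (suc n) → ≡.trans (q↑-·-suc a _ n)
      (≡.trans (q↑-+ a b .at n) (≡.sym (q↑-suc-suc (a ℕ.+ b) n))) }

q↑-cong : ∀ {a b} → a ≡ b → q↑ a ≈ q↑ b
q↑-cong ≡.refl = ≈-refl

𝟘-coeff : ∀ n → 𝟘 n ≡ 0ℤ
𝟘-coeff zero    = const-zero 0ℤ
𝟘-coeff (suc n) = const-suc 0ℤ n

q↑-high : ∀ {K m} → K ℕ.≤ m → q↑ m ≈[ K ] 𝟘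
q↑-high {K} {m} K≤m = below λ n n<K → ≡.trans (go m n (ℕ.<-≤-trans n<K K≤m)) (≡.sym (𝟘-coeff n))
  where
  go : ∀ m n → n ℕ.< m → (q↑ m) n ≡ 0ℤ
  go (suc m) zero    _         = q↑-suc-zero m
  go (suc m) (suc n) (s≤s n<m) = ≡.trans (q↑-suc-suc m n) (go m n n<m)

-- Finite and infinite products

prod : (ℕ → Series) → ℕ → Series
prod F zero    = 𝟙
prod F (suc n) = prod F n · F n

-- More than q-adic convergence of ∏ F, but true of all products below; the rate
-- is what makes the coefficient of q^n in ∏ F the one of prod F (suc n).
Convergent : (ℕ → Series) → Set
Convergent F = ∀ k → F k ≈[ k ] 𝟙

opaque
  ∏ : (ℕ → Series) → Series
  ∏ F n = prod F (suc n) n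

prod-cong : ∀ {F G} → (∀ k → F k ≈ G k) → ∀ n → prod F n ≈ prod G n
prod-cong e zero    = ≈-refl
prod-cong e (suc n) = ·-cong (prod-cong e n) (e n)

prod-· : ∀ F G n → prod F n · prod G n ≈ prod (λ k → F k · G k) n
prod-· F G zero    = ·-idˡ 𝟙
prod-· F G (suc n) = ≈-trans
  (solve 4 (λ a b c d → (a :* b) :* (c :* d) := (a :* c) :* (b :* d)) ≈-refl
    (prod F n) (F n) (prod G n) (G n))
  (·-congʳ (prod-· F G n))

prod-+ : ∀ F m n → prod F (m ℕ.+ n) ≈ prod F m · prod (λ k → F (m ℕ.+ k)) n
prod-+ F m zero    rewrite ℕ.+-identityʳ m = ≈-sym (·-idʳ _)
prod-+ F m (suc n) rewrite ℕ.+-suc m n = ≈-trans (·-congʳ (prod-+ F m n)) (·-assoc _ _ _)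

prod-* : ∀ F r n → prod F (n ℕ.* r) ≈ prod (λ k → prod (λ j → F (k ℕ.* r ℕ.+ j)) r) n
prod-* F r zero    = ≈-refl
prod-* F r (suc n) = ≈-trans (≡⇒≈ (cong (prod F) (ℕ.+-comm r (n ℕ.* r))))
  (≈-trans (prod-+ F (n ℕ.* r) r) (·-congʳ (prod-* F r n)))

prod-stable : ∀ {F} → Convergent F → ∀ K d → prod F (d ℕ.+ K) ≈[ K ] prod F K
prod-stable         c K zero    = below-refl
prod-stable {F} c K (suc d) = below-trans
  (·-cong-below (prod-stable c K d) (below-weaken (ℕ.m≤n+m K d) (c (d ℕ.+ K))))
  (≈⇒≈[] K (·-idʳ _))

opaque
  unfolding ∏

  ∏-below : ∀ {F} → Convergent F → ∀ {K M} → K ℕ.≤ M → ∏ F ≈[ K ] prod F M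
  ∏-below {F} c {K} {M} K≤M = below λ n n<K → ≡.sym
    (≡.trans (cong (λ N → prod F N n) (≡.sym (ℕ.m∸n+n≡m (ℕ.≤-trans n<K K≤M))))
      (prod-stable c (suc n) (M ∸ suc n) .at< n (ℕ.n<1+n n)))

  ∏-cong : ∀ {F G} → (∀ k → F k ≈ G k) → ∏ F ≈ ∏ G
  ∏-cong e = pointwise λ n → prod-cong e (suc n) .at n

-- The K-th partial product needs to agree with f only modulo q^K; this is how regrouping,
-- multiplication and substitutions pass to infinite products.
∏-unique : ∀ {F f} → Convergent F → (∀ K → prod F K ≈[ K ] f) → ∏ F ≈ f
∏-unique c e = ≈[]⇒≈ λ K → below-trans (∏-below c ℕ.≤-refl) (e K)

Convergent-· : ∀ {F G} → Convergent F → Convergent G → Convergent (λ k → F k · G k)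
Convergent-· c d k = below-trans (·-cong-below (c k) (d k)) (≈⇒≈[] k (·-idˡ 𝟙))

∏-· : ∀ {F G} → Convergent F → Convergent G → ∏ F · ∏ G ≈ ∏ (λ k → F k · G k)
∏-· {F} {G} c d = ≈-sym (∏-unique (Convergent-· c d) λ K → below-sym (below-trans
  (·-cong-below (∏-below c (ℕ.≤-refl {K})) (∏-below d (ℕ.≤-refl {K}))) (≈⇒≈[] K (prod-· F G K))))

prod-𝟙-below : ∀ {F K} → (∀ j → F j ≈[ K ] 𝟙) → ∀ r → prod F r ≈[ K ] 𝟙
prod-𝟙-below e zero    = below-refl
prod-𝟙-below {K = K} e (suc r) = below-trans (·-cong-below (prod-𝟙-below e r) (e r))
  (≈⇒≈[] K (·-idˡ 𝟙))

-- The k-th block contains only factors of index at least k, so the blocks converge at the same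
-- rate. Blocks of two and three split a Pochhammer symbol into residue classes.
∏-regroup : ∀ {F} → Convergent F → ∀ r → ∏ F ≈ ∏ (λ k → prod (λ j → F (k ℕ.* suc r ℕ.+ j)) (suc r))
∏-regroup {F} c r = ≈-sym (∏-unique
  (λ k → prod-𝟙-below (λ j → below-weaken
      (ℕ.≤-trans (ℕ.m≤m*n k (suc r)) (ℕ.m≤m+n _ j)) (c (k ℕ.* suc r ℕ.+ j))) (suc r))
  λ K → below-sym (below-trans (∏-below c (ℕ.m≤m*n K (suc r))) (≈⇒≈[] K (prod-* F (suc r) K))))

-- The q-Pochhammer symbol (-εq^i; q^m)_∞

factor : ℤ → ℕ → Series
factor ε e = 𝟙 ⊕ const ε · q↑ e

poch : ℤ → ℕ → ℕ → Series
poch ε i m = ∏ (λ k → factor ε (i ℕ.+ k ℕ.* m))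

factor-below : ∀ ε {K e} → K ℕ.≤ e → factor ε e ≈[ K ] 𝟙
factor-below ε {K} K≤e = below-trans
  (⊕-cong-below below-refl (·-cong-below below-refl (q↑-high K≤e)))
  (≈⇒≈[] K (≈-trans (⊕-cong ≈-refl (·-zeroʳ _)) (⊕-idʳ _)))

poch-convergent : ∀ ε i m .{{_ : NonZero m}} → Convergent (λ k → factor ε (i ℕ.+ k ℕ.* m))
poch-convergent ε i m k = factor-below ε (ℕ.≤-trans (ℕ.m≤m*n k m) (ℕ.m≤n+m (k ℕ.* m) i))

factor-cong : ∀ ε {e e′} → e ≡ e′ → factor ε e ≈ factor ε e′
factor-cong ε ≡.refl = ≈-refl

poch-split₂ : ∀ ε i m .{{_ : NonZero m}} →
  poch ε i m ≈ poch ε i (m ℕ.+ m) · poch ε (i ℕ.+ m) (m ℕ.+ m)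
poch-split₂ ε i m@(suc _) = ≈-trans (∏-regroup (poch-convergent ε i m) 1) (≈-trans
  (∏-cong λ k → ≈-trans (·-congʳ (·-idˡ _)) (·-cong
    (factor-cong ε (lemma₀ i m k)) (factor-cong ε (lemma₁ i m k))))
  (≈-sym (∏-· (poch-convergent ε i (m ℕ.+ m)) (poch-convergent ε (i ℕ.+ m) (m ℕ.+ m)))))
  where
  lemma₀ : ∀ i m k → i ℕ.+ (k ℕ.* 2 ℕ.+ 0) ℕ.* m ≡ i ℕ.+ k ℕ.* (m ℕ.+ m)
  lemma₀ = ℕ-solve
  lemma₁ : ∀ i m k → i ℕ.+ (k ℕ.* 2 ℕ.+ 1) ℕ.* m ≡ i ℕ.+ m ℕ.+ k ℕ.* (m ℕ.+ m)
  lemma₁ = ℕ-solve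

poch-split₃ : ∀ ε i m .{{_ : NonZero m}} → poch ε i m ≈
  poch ε i (m ℕ.+ m ℕ.+ m) · poch ε (i ℕ.+ m) (m ℕ.+ m ℕ.+ m) · poch ε (i ℕ.+ m ℕ.+ m)
    (m ℕ.+ m ℕ.+ m)
poch-split₃ ε i m@(suc _) = ≈-trans (∏-regroup (poch-convergent ε i m) 2) (≈-trans
  (∏-cong λ k → ·-cong (≈-trans (·-congʳ (·-idˡ _)) (·-cong
    (factor-cong ε (lemma₀ i m k)) (factor-cong ε (lemma₁ i m k)))) (factor-cong ε (lemma₂ i m k)))
  (≈-sym (≈-trans (·-congʳ (∏-· (conv i) (conv (i ℕ.+ m))))
    (∏-· (Convergent-· (conv i) (conv (i ℕ.+ m))) (conv (i ℕ.+ m ℕ.+ m))))))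
  where
  conv : ∀ i → Convergent (λ k → factor ε (i ℕ.+ k ℕ.* (m ℕ.+ m ℕ.+ m)))
  conv i = poch-convergent ε i (m ℕ.+ m ℕ.+ m)
  lemma₀ : ∀ i m k → i ℕ.+ (k ℕ.* 3 ℕ.+ 0) ℕ.* m ≡ i ℕ.+ k ℕ.* (m ℕ.+ m ℕ.+ m)
  lemma₀ = ℕ-solve
  lemma₁ : ∀ i m k → i ℕ.+ (k ℕ.* 3 ℕ.+ 1) ℕ.* m ≡ i ℕ.+ m ℕ.+ k ℕ.* (m ℕ.+ m ℕ.+ m)
  lemma₁ = ℕ-solve
  lemma₂ : ∀ i m k → i ℕ.+ (k ℕ.* 3 ℕ.+ 2) ℕ.* m ≡ i ℕ.+ m ℕ.+ m ℕ.+ k ℕ.* (m ℕ.+ m ℕ.+ m)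
  lemma₂ = ℕ-solve

poch-conjugate : ∀ i m .{{_ : NonZero m}} → poch 1ℤ i m · poch -1ℤ i m ≈ poch -1ℤ (i ℕ.+ i)
  (m ℕ.+ m)
poch-conjugate i m = ≈-trans (∏-· (poch-convergent 1ℤ i m) (poch-convergent -1ℤ i m))
  (∏-cong λ k → ≈-trans
    (solve 1 (λ x → (con 1ℤ :+ con 1ℤ :* x) :* (con 1ℤ :+ con -1ℤ :* x) := con 1ℤ :+ con -1ℤ :*
      (x :* x)) ≈-refl
      (q↑ (i ℕ.+ k ℕ.* m)))
    (⊕-cong ≈-refl (·-congˡ (≈-trans (q↑-+ e⟨ k ⟩ e⟨ k ⟩) (q↑-cong (lemma i m k))))))
  where
  e⟨_⟩ : ℕ → ℕ
  e⟨ k ⟩ = i ℕ.+ k ℕ.* m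
  lemma : ∀ i m k → i ℕ.+ k ℕ.* m ℕ.+ (i ℕ.+ k ℕ.* m) ≡ i ℕ.+ i ℕ.+ k ℕ.* (m ℕ.+ m)
  lemma = ℕ-solve

1-q^-factor : ∀ e → 1-q^ e ≈ factor -1ℤ e
1-q^-factor e = pointwise λ n → ≡.trans
  (cong₂ (λ x y → x ℤ.+ ℤ.- y) (one≈𝟙 .at n) (q↑-def e .at n))
  (≡.trans (cong (ℤ._+_ (𝟙 n)) (≡.trans (≡.sym (ℤ.-1*i≡-i _)) (≡.sym (const-· -1ℤ (q↑ e) n))))
    (≡.sym (⊕-def 𝟙 _ n)))

⊛⇒· : ∀ {f g f′ g′} → f ≈ f′ → g ≈ g′ → f ⊛ g ≈ f′ · g′
⊛⇒· {f} {g} e e′ = ≈-trans (·-def f g) (·-cong e e′)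

partialProduct-prod : ∀ j N → partialProduct j N ≈ prod (λ k → factor -1ℤ (j ℕ.+ k ℕ.* j)) N
partialProduct-prod j zero    = one≈𝟙
partialProduct-prod j (suc N) = ⊛⇒· (partialProduct-prod j N)
  (≈-trans (1-q^-factor (j ℕ.* suc N)) (factor-cong -1ℤ (ℕ.*-comm j (suc N))))

f[]-poch : ∀ j .{{_ : NonZero j}} → f[ j ] ≈ poch -1ℤ j j
f[]-poch j = pointwise λ n → ≡.trans (partialProduct-prod j n .at n)
  (≡.sym (≡.trans (∏-below (poch-convergent -1ℤ j j) (ℕ.≤-refl {suc n}) .at< n (ℕ.n<1+n n))
    (last n .at< n (ℕ.n<1+n n))))
  where
  F : ℕ → Series
  F k = factor -1ℤ (j ℕ.+ k ℕ.* j)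
  -- `f[ j ]` uses n factors for the coefficient of q^n and `∏` uses n + 1. The extra factor has
  -- exponent j + nj ≥ n + 1 and does not affect that coefficient.
  last : ∀ n → prod F (suc n) ≈[ suc n ] prod F n
  last n = below-trans (·-cong-below below-refl
      (factor-below -1ℤ (ℕ.+-mono-≤ (ℕ.>-nonZero⁻¹ j) (ℕ.m≤m*n n j))))
    (≈⇒≈[] (suc n) (·-idʳ _))

-- Invertible series and their integer powers

-- Constant term 1, rather than ±1, because this is what `inv` presupposes.
IsUnit : Series → Set
IsUnit f = f 0 ≡ 1ℤ

·-inv : ∀ {f} → IsUnit f → f · inv f ≈ 𝟙
·-inv {f} u = ≈-trans (≈-sym (·-def f (inv f))) (≈-trans (pointwise (⊛-inv f u)) one≈𝟙)

unit-cancelˡ : ∀ {K c f g} → IsUnit c → c · f ≈[ K ] c · g → f ≈[ K ] g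
unit-cancelˡ {K} {c} {f} {g} u e = below-trans (below-sym (≈⇒≈[] K (collapse f)))
  (below-trans (·-cong-below (below-refl {f = inv c}) e) (≈⇒≈[] K (collapse g)))
  where
  collapse : ∀ h → inv c · (c · h) ≈ h
  collapse h = ≈-trans (solve 3 (λ a b h → b :* (a :* h) := (a :* b) :* h) ≈-refl c (inv c) h)
    (≈-trans (·-congʳ (·-inv u)) (·-idˡ h))

unit-cancel : ∀ {c f g} → IsUnit c → c · f ≈ c · g → f ≈ g
unit-cancel u e = ≈[]⇒≈ λ K → unit-cancelˡ u (≈⇒≈[] K e)

IsUnit-· : ∀ {f g} → IsUnit f → IsUnit g → IsUnit (f · g)
IsUnit-· {f} {g} u v = ≡.trans (·-zero f g) (cong₂ ℤ._*_ u v)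

IsUnit-𝟙 : IsUnit 𝟙
IsUnit-𝟙 = const-zero 1ℤ

IsUnit-≈ : ∀ {f g} → f ≈ g → IsUnit f → IsUnit g
IsUnit-≈ e u = ≡.trans (≡.sym (e .at 0)) u

opaque
  _**_ : Series → ℤ → Series
  _**_ = _^_

infixr 8 _**_

opaque
  unfolding _**_

  **-def : ∀ f t → f ^ t ≈ f ** t
  **-def f t = ≈-refl

  **-zero : ∀ f → f ** 0ℤ ≈ 𝟙
  **-zero f = one≈𝟙

  **-one : ∀ f → f ** 1ℤ ≈ f
  **-one f = ≈-trans (⊛⇒· ≈-refl one≈𝟙) (·-idʳ f)

  -- One recursion valid at positive and negative exponents alike; with it the power laws never
  -- mention `inv` again.
  **-suc : ∀ {f} → IsUnit f → ∀ t → f ** ℤ.suc t ≈ f · f ** t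
  **-suc {f} u (+ n)          = ·-def f (f ^ⁿ n)
  **-suc {f} u -[1+ zero ]    = ≈-sym (≈-trans (·-congˡ (⊛⇒· ≈-refl one≈𝟙))
    (≈-trans (·-congˡ (·-idʳ _)) (≈-trans (·-inv u) (≈-sym one≈𝟙))))
  **-suc {f} u -[1+ suc n ]   = ≈-sym (≈-trans (·-congˡ (·-def (inv f) (inv f ^ⁿ suc n)))
    (≈-trans (≈-sym (·-assoc f (inv f) _)) (≈-trans (·-congʳ (·-inv u)) (·-idˡ _))))

-- A negative exponent is raised by one after multiplying both sides by f. The helper `rec` splits
-- on n because `ℤ.suc -[1+ n ]` does not reduce before that.
**-+ : ∀ {f} → IsUnit f → ∀ s t → f ** s · f ** t ≈ f ** (s ℤ.+ t)
**-+ {f} u (+ zero) t = ≈-trans (·-congʳ (**-zero f))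
  (≈-trans (·-idˡ _) (≡⇒≈ (cong (f **_) (≡.sym (ℤ.+-identityˡ t)))))
**-+ {f} u (+ suc n) t = ≈-trans (·-congʳ (**-suc u (+ n)))
  (≈-trans (·-assoc f _ _) (≈-trans (·-congˡ (**-+ u (+ n) t))
    (≈-trans (≈-sym (**-suc u (+ n ℤ.+ t))) (≡⇒≈ (cong (f **_) (≡.sym (ℤ.+-assoc 1ℤ (+ n) t)))))))
**-+ {f} u -[1+ n ] t = unit-cancel u (≈-trans
  (≈-sym (·-assoc f _ _)) (≈-trans (·-congʳ (≈-sym (**-suc u -[1+ n ])))
    (≈-trans (rec n) (≈-trans (≡⇒≈ (cong (f **_) (ℤ.+-assoc 1ℤ -[1+ n ] t)))
      (**-suc u (-[1+ n ] ℤ.+ t))))))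
  where
  rec : ∀ n → f ** ℤ.suc -[1+ n ] · f ** t ≈ f ** (ℤ.suc -[1+ n ] ℤ.+ t)
  rec zero    = **-+ u (+ zero) t
  rec (suc n) = **-+ u -[1+ n ] t

**-cong : ∀ {f g} → IsUnit f → f ≈ g → ∀ t → f ** t ≈ g ** t
**-cong {f} {g} u e (+ zero)  = ≈-trans (**-zero f) (≈-sym (**-zero g))
**-cong {f} {g} u e (+ suc n) = ≈-trans (**-suc u (+ n))
  (≈-trans (·-cong e (**-cong u e (+ n))) (≈-sym (**-suc (IsUnit-≈ e u) (+ n))))
**-cong {f} {g} u e -[1+ n ] = unit-cancel u (≈-trans (≈-sym (**-suc u -[1+ n ]))
  (≈-trans (rec n) (≈-trans (**-suc (IsUnit-≈ e u) -[1+ n ]) (·-congʳ (≈-sym e)))))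
  where
  rec : ∀ n → f ** ℤ.suc -[1+ n ] ≈ g ** ℤ.suc -[1+ n ]
  rec zero    = **-cong u e (+ zero)
  rec (suc n) = **-cong u e -[1+ n ]

IsUnit-** : ∀ {f} → IsUnit f → ∀ t → IsUnit (f ** t)
IsUnit-** {f} u (+ zero)  = IsUnit-≈ (≈-sym (**-zero f)) IsUnit-𝟙
IsUnit-** {f} u (+ suc n) = IsUnit-≈ (≈-sym (**-suc u (+ n))) (IsUnit-· u (IsUnit-** u (+ n)))
IsUnit-** {f} u -[1+ n ]  = ≡.trans (≡.sym (ℤ.*-identityˡ _))
  (≡.trans (cong (λ x → x ℤ.* (f ** -[1+ n ]) 0) (≡.sym u))
  (≡.trans (≡.sym (·-zero f _)) (≡.trans (≡.sym (**-suc u -[1+ n ] .at 0)) (rec n))))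
  where
  rec : ∀ n → IsUnit (f ** ℤ.suc -[1+ n ])
  rec zero    = IsUnit-** u (+ zero)
  rec (suc n) = IsUnit-** u -[1+ n ]

-- Meant for the substitutions q ↦ q² and q ↦ -q. Compatibility of H with inverses follows from
-- multiplicativity by cancelling H f.
**-hom : ∀ (H : Series → Series) → (∀ {f g} → f ≈ g → H f ≈ H g) →
  (∀ f g → H (f · g) ≈ H f · H g) → H 𝟙 ≈ 𝟙 →
  ∀ {f} → IsUnit f → IsUnit (H f) → ∀ t → H (f ** t) ≈ H f ** t
**-hom H H-cong H-· H-𝟙 {f} u v (+ zero) =
  ≈-trans (H-cong (**-zero f)) (≈-trans H-𝟙 (≈-sym (**-zero (H f))))
**-hom H H-cong H-· H-𝟙 {f} u v (+ suc n) = ≈-trans (H-cong (**-suc u (+ n)))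
  (≈-trans (H-· f _) (≈-trans (·-congˡ (**-hom H H-cong H-· H-𝟙 u v (+ n)))
    (≈-sym (**-suc v (+ n)))))
**-hom H H-cong H-· H-𝟙 {f} u v -[1+ n ] = unit-cancel v (≈-trans (≈-sym (H-· f _))
  (≈-trans (H-cong (≈-sym (**-suc u -[1+ n ]))) (≈-trans (rec n) (**-suc v -[1+ n ]))))
  where
  rec : ∀ n → H (f ** ℤ.suc -[1+ n ]) ≈ H f ** ℤ.suc -[1+ n ]
  rec zero    = **-hom H H-cong H-· H-𝟙 u v (+ zero)
  rec (suc n) = **-hom H H-cong H-· H-𝟙 u v -[1+ n ]

monomial : ∀ {k} → Vec Series k → Vec ℤ k → Series
monomial []       []       = 𝟙
monomial (f ∷ fs) (t ∷ ts) = f ** t · monomial fs ts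

monomial-· : ∀ {k} {fs : Vec Series k} → All IsUnit fs → ∀ s t →
  monomial fs s · monomial fs t ≈ monomial fs (zipWith ℤ._+_ s t)
monomial-· []       []      []      = ·-idˡ 𝟙
monomial-· (u ∷ us) (x ∷ s) (y ∷ t) = ≈-trans
  (solve 4 (λ a b c d → (a :* b) :* (c :* d) := (a :* c) :* (b :* d)) ≈-refl _ _ _ _)
  (·-cong (**-+ u x y) (monomial-· us s t))

-- The substitutions q ↦ q² and q ↦ -q

opaque
  q↦q² : Series → Series
  q↦q² f zero          = f 0
  q↦q² f (suc zero)    = 0ℤ
  q↦q² f (suc (suc n)) = q↦q² (tail f) n

  q↦-q : Series → Series
  q↦-q f zero    = f 0
  q↦-q f (suc n) = ℤ.- q↦-q (tail f) n

infix 9 _²q _-q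
_²q _-q : Series → Series
_²q = q↦q²
_-q = q↦-q

private
  2+n<K : ∀ {n K} → suc (suc n) ℕ.< suc K → n ℕ.< K
  2+n<K (s≤s p) = ℕ.<-trans (ℕ.n<1+n _) p

tail-below : ∀ {K f g} → f ≈[ suc K ] g → tail f ≈[ K ] tail g
tail-below e = below λ n n<K → e .at< (suc n) (s≤s n<K)

opaque
  unfolding q↦q² q↦-q

  ²q-below : ∀ K {f g} → f ≈[ K ] g → f ²q ≈[ K ] g ²q
  ²q-below K e = below (go K e)
    where
    go : ∀ K {f g} → f ≈[ K ] g → ∀ n → n ℕ.< K → (f ²q) n ≡ (g ²q) n
    go (suc K) e zero          p = e .at< 0 p
    go (suc K) e (suc zero)    p = ≡.refl
    go (suc K) e (suc (suc n)) p = go K (tail-below e) n (2+n<K p)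

  -q-below : ∀ K {f g} → f ≈[ K ] g → f -q ≈[ K ] g -q
  -q-below K e = below (go K e)
    where
    go : ∀ K {f g} → f ≈[ K ] g → ∀ n → n ℕ.< K → (f -q) n ≡ (g -q) n
    go (suc K) e zero    p       = e .at< 0 p
    go (suc K) e (suc n) (s≤s p) = cong ℤ.-_ (go K (tail-below e) n p)

  ²q-even : ∀ f n → (f ²q) (2 ℕ.* n) ≡ f n
  ²q-even f zero = ≡.refl
  ²q-even f (suc n) rewrite ℕ.+-suc n (n ℕ.+ 0) = ²q-even (tail f) n

  ²q-odd : ∀ f n → (f ²q) (suc (2 ℕ.* n)) ≡ 0ℤ
  ²q-odd f zero = ≡.refl
  ²q-odd f (suc n) rewrite ℕ.+-suc n (n ℕ.+ 0) = ²q-odd (tail f) n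

  -q-even : ∀ f n → (f -q) (2 ℕ.* n) ≡ f (2 ℕ.* n)
  -q-even f zero = ≡.refl
  -q-even f (suc n) rewrite ℕ.+-suc n (n ℕ.+ 0) =
    ≡.trans (ℤ.neg-involutive _) (-q-even (tail (tail f)) n)

  -q-odd : ∀ f n → (f -q) (suc (2 ℕ.* n)) ≡ ℤ.- f (suc (2 ℕ.* n))
  -q-odd f n = cong ℤ.-_ (-q-even (tail f) n)

  ²q-zero : ∀ f → (f ²q) 0 ≡ f 0
  ²q-zero f = ≡.refl

  -q-zero : ∀ f → (f -q) 0 ≡ f 0
  -q-zero f = ≡.refl

opaque
  unfolding q↦q² q↦-q _⊕_ _·_ const q↑_

  ²q-⊕ : ∀ f g → (f ⊕ g) ²q ≈ f ²q ⊕ g ²q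
  ²q-⊕ f g = pointwise (go f g)
    where
    go : ∀ f g n → ((f ⊕ g) ²q) n ≡ (f ²q ⊕ g ²q) n
    go f g zero          = ≡.refl
    go f g (suc zero)    = ≡.refl
    go f g (suc (suc n)) = go (tail f) (tail g) n

  -q-⊕ : ∀ f g → (f ⊕ g) -q ≈ f -q ⊕ g -q
  -q-⊕ f g = pointwise (go f g)
    where
    go : ∀ f g n → ((f ⊕ g) -q) n ≡ (f -q ⊕ g -q) n
    go f g zero    = ≡.refl
    go f g (suc n) = ≡.trans (cong ℤ.-_ (go (tail f) (tail g) n))
      (ℤ.neg-distrib-+ ((tail f -q) n) ((tail g -q) n))

  ²q-const : ∀ c → (const c) ²q ≈ const c
  ²q-const c = pointwise λ { zero → ≡.refl ; (suc zero) → ≡.refl ; (suc (suc n)) → go n }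
    where
    go : ∀ n → ((λ _ → 0ℤ) ²q) n ≡ 0ℤ
    go zero          = ≡.refl
    go (suc zero)    = ≡.refl
    go (suc (suc n)) = go n

  -q-const : ∀ c → (const c) -q ≈ const c
  -q-const c = pointwise λ { zero → ≡.refl ; (suc n) → cong ℤ.-_ (go n) }
    where
    go : ∀ n → ((λ _ → 0ℤ) -q) n ≡ 0ℤ
    go zero    = ≡.refl
    go (suc n) = cong ℤ.-_ (go n)

  ²q-scale : ∀ c f n → ((λ k → c ℤ.* f k) ²q) n ≡ c ℤ.* (f ²q) n
  ²q-scale c f zero          = ≡.refl
  ²q-scale c f (suc zero)    = ≡.sym (ℤ.*-zeroʳ c)
  ²q-scale c f (suc (suc n)) = ²q-scale c (tail f) n

  -q-scale : ∀ c f n → ((λ k → c ℤ.* f k) -q) n ≡ c ℤ.* (f -q) n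
  -q-scale c f zero    = ≡.refl
  -q-scale c f (suc n) = ≡.trans (cong ℤ.-_ (-q-scale c (tail f) n)) (ℤ.neg-distribʳ-* c _)

  ²q-· : ∀ f g → (f · g) ²q ≈ f ²q · g ²q
  ²q-· f g = pointwise (go f)
    where
    go : ∀ f n → ((f · g) ²q) n ≡ (f ²q · g ²q) n
    go f zero = ≡.refl
    go f (suc zero) = lemma (f 0) (g 0)
      where
      lemma : ∀ a b → 0ℤ ≡ a ℤ.* 0ℤ ℤ.+ (0ℤ ℤ.* b ℤ.+ 0ℤ)
      lemma = ℤ-solve
    go f (suc (suc n)) = ≡.trans (²q-⊕ (λ k → f 0 ℤ.* tail g k) (tail f · g) .at n)
      (≡.trans (cong₂ ℤ._+_ (²q-scale (f 0) (tail g) n) (go (tail f) n))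
        (lemma (f 0) ((tail g ²q) n) ((g ²q) (suc n)) _))
      where
      lemma : ∀ a b c d → a ℤ.* b ℤ.+ d ≡ a ℤ.* b ℤ.+ (0ℤ ℤ.* c ℤ.+ d)
      lemma = ℤ-solve

  -q-· : ∀ f g → (f · g) -q ≈ f -q · g -q
  -q-· f g = pointwise (go f)
    where
    neg-· : ∀ f h n → ((λ k → ℤ.- f k) · h) n ≡ ℤ.- (f · h) n
    neg-· f h zero = lemma (f 0) (h 0)
      where
      lemma : ∀ a b → (ℤ.- a) ℤ.* b ℤ.+ 0ℤ ≡ ℤ.- (a ℤ.* b ℤ.+ 0ℤ)
      lemma = ℤ-solve
    neg-· f h (suc n) = ≡.trans (cong (λ x → (ℤ.- f 0) ℤ.* h (suc n) ℤ.+ x) (neg-· (tail f) h n))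
      (lemma (f 0) (h (suc n)) _)
      where
      lemma : ∀ a b c → (ℤ.- a) ℤ.* b ℤ.+ ℤ.- c ≡ ℤ.- (a ℤ.* b ℤ.+ c)
      lemma = ℤ-solve
    go : ∀ f n → ((f · g) -q) n ≡ (f -q · g -q) n
    go f zero = ≡.refl
    go f (suc n) = ≡.trans (cong ℤ.-_ (-q-⊕ (λ k → f 0 ℤ.* tail g k) (tail f · g) .at n))
      (≡.trans (cong (λ x → ℤ.- x) (cong₂ ℤ._+_ (-q-scale (f 0) (tail g) n) (go (tail f) n)))
        (≡.trans (lemma (f 0) _ _)
          (cong (ℤ._+_ (f 0 ℤ.* ℤ.- (tail g -q) n)) (≡.sym (neg-· (tail f -q) (g -q) n)))))
      where
      lemma : ∀ a b c → ℤ.- (a ℤ.* b ℤ.+ c) ≡ a ℤ.* (ℤ.- b) ℤ.+ ℤ.- c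
      lemma = ℤ-solve

  ²q-q↑ : ∀ e → (q↑ e) ²q ≈ q↑ (e ℕ.+ e)
  ²q-q↑ zero = ≈-trans (≈-trans (pointwise λ n → go n) (²q-const 1ℤ)) (≈-sym q↑0)
    where
    go : ∀ n → ((q↑ 0) ²q) n ≡ ((const 1ℤ) ²q) n
    go n = ²q-below (suc n) (≈⇒≈[] (suc n) q↑0) .at< n (ℕ.n<1+n n)
  ²q-q↑ (suc e) = pointwise (go e)
    where
    go : ∀ e n → ((q↑ suc e) ²q) n ≡ (q↑ (suc e ℕ.+ suc e)) n
    go e zero          = ≡.refl
    go e (suc zero)    rewrite ℕ.+-suc e e = ≡.refl
    go e (suc (suc n)) rewrite ℕ.+-suc e e = ²q-q↑ e .at n

²q-cong : ∀ {f g} → f ≈ g → f ²q ≈ g ²q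
²q-cong e = ≈[]⇒≈ λ K → ²q-below K (≈⇒≈[] K e)

-q-cong : ∀ {f g} → f ≈ g → f -q ≈ g -q
-q-cong e = ≈[]⇒≈ λ K → -q-below K (≈⇒≈[] K e)

opaque
  unfolding q↦-q _·_ const q↑_

  -q-q↑ : ∀ e → (q↑ e) -q ≈ const (-1ℤ ℤ.^ e) · q↑ e
  -q-q↑ e = pointwise λ n → ≡.trans (go e n) (≡.sym (const-· (-1ℤ ℤ.^ e) (q↑ e) n))
    where
    go : ∀ e n → ((q↑ e) -q) n ≡ -1ℤ ℤ.^ e ℤ.* (q↑ e) n
    go zero n = ≡.trans (-q-cong q↑0 .at n)
      (≡.trans (-q-const 1ℤ .at n) (≡.trans (≡.sym (q↑0 .at n)) (≡.sym (ℤ.*-identityˡ _))))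
    go (suc e) zero    = ≡.sym (ℤ.*-zeroʳ (-1ℤ ℤ.^ suc e))
    go (suc e) (suc n) = ≡.trans (cong ℤ.-_ (go e n)) (lemma (-1ℤ ℤ.^ e) ((q↑ e) n))
      where
      lemma : ∀ a b → ℤ.- (a ℤ.* b) ≡ -1ℤ ℤ.* a ℤ.* b
      lemma = ℤ-solve

∏-hom : ∀ (H : Series → Series) → (∀ K {f g} → f ≈[ K ] g → H f ≈[ K ] H g) →
  (∀ f g → H (f · g) ≈ H f · H g) → H 𝟙 ≈ 𝟙 →
  ∀ {F} → Convergent F → H (∏ F) ≈ ∏ (λ k → H (F k))
∏-hom H H-below H-· H-𝟙 {F} c = ≈-sym (∏-unique
  (λ k → below-trans (H-below k (c k)) (≈⇒≈[] k H-𝟙))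
  (λ K → below-trans (≈⇒≈[] K (prod-hom K)) (H-below K (below-sym (∏-below c ℕ.≤-refl)))))
  where
  H-cong : ∀ {f g} → f ≈ g → H f ≈ H g
  H-cong e = ≈[]⇒≈ λ K → H-below K (≈⇒≈[] K e)
  prod-hom : ∀ n → prod (λ k → H (F k)) n ≈ H (prod F n)
  prod-hom zero    = ≈-sym H-𝟙
  prod-hom (suc n) = ≈-trans (·-congʳ (prod-hom n)) (≈-sym (H-· _ _))

factor-²q : ∀ ε e → (factor ε e) ²q ≈ factor ε (e ℕ.+ e)
factor-²q ε e = ≈-trans (²q-⊕ 𝟙 _) (⊕-cong (²q-const 1ℤ)
  (≈-trans (²q-· _ _) (·-cong (²q-const ε) (²q-q↑ e))))

poch-²q : ∀ ε i m .{{_ : NonZero m}} → (poch ε i m) ²q ≈ poch ε (i ℕ.+ i) (m ℕ.+ m)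
poch-²q ε i m = ≈-trans (∏-hom _²q ²q-below ²q-· (²q-const 1ℤ) (poch-convergent ε i m))
  (∏-cong λ k → ≈-trans (factor-²q ε _) (factor-cong ε (lemma i m k)))
  where
  lemma : ∀ i m k → i ℕ.+ k ℕ.* m ℕ.+ (i ℕ.+ k ℕ.* m) ≡ i ℕ.+ i ℕ.+ k ℕ.* (m ℕ.+ m)
  lemma = ℕ-solve

-1^-even : ∀ n → -1ℤ ℤ.^ (n ℕ.+ n) ≡ 1ℤ
-1^-even zero = ≡.refl
-1^-even (suc n) rewrite ℕ.+-suc n n | -1^-even n = ≡.refl

-- The modulus is written `m ℕ.+ m` to make it even: all exponents then have the parity of i, and
-- every factor receives the same sign (-1)^i.
poch-neg : ∀ ε i m .{{_ : NonZero m}} →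
  (poch ε i (m ℕ.+ m)) -q ≈ poch (ε ℤ.* -1ℤ ℤ.^ i) i (m ℕ.+ m)
poch-neg ε i m@(suc _) = ≈-trans
  (∏-hom _-q -q-below -q-· (-q-const 1ℤ) (poch-convergent ε i (m ℕ.+ m)))
  (∏-cong λ k → ≈-trans (-q-⊕ 𝟙 _) (⊕-cong (-q-const 1ℤ)
    (≈-trans (-q-· _ _) (≈-trans (·-cong (-q-const ε) (-q-q↑ (i ℕ.+ k ℕ.* (m ℕ.+ m))))
      (≈-trans (≈-sym (·-assoc _ _ _)) (·-congʳ
        (≈-trans (≈-sym (const-* ε _)) (≡⇒≈ (cong (λ x → const (ε ℤ.* x)) (sign k))))))))))
  where
  double : ∀ k m → k ℕ.* (m ℕ.+ m) ≡ k ℕ.* m ℕ.+ k ℕ.* m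
  double = ℕ-solve
  sign : ∀ k → -1ℤ ℤ.^ (i ℕ.+ k ℕ.* (m ℕ.+ m)) ≡ -1ℤ ℤ.^ i
  sign k = ≡.trans (ℤ.^-distribˡ-+-* -1ℤ i _) (≡.trans (cong (λ x → -1ℤ ℤ.^ i ℤ.* x)
    (≡.trans (cong (-1ℤ ℤ.^_) (double k m)) (-1^-even (k ℕ.* m)))) (ℤ.*-identityʳ _))

E : ℕ → Series
E d = poch -1ℤ d d

-- The factors of `poch ε d d` at the odd multiples of d.
O : ℤ → ℕ → Series
O ε d = poch ε d (d ℕ.+ d)

E-split : ∀ d .{{_ : NonZero d}} → E d ≈ O -1ℤ d · E (d ℕ.+ d)
E-split d = poch-split₂ -1ℤ d d

O-conjugate : ∀ d .{{_ : NonZero d}} → O 1ℤ d · O -1ℤ d ≈ O -1ℤ (d ℕ.+ d)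
O-conjugate d@(suc _) = poch-conjugate d (d ℕ.+ d)

E-plus : ∀ d .{{_ : NonZero d}} → poch 1ℤ d d · E d ≈ E (d ℕ.+ d)
E-plus d = poch-conjugate d d

-- Eta products, with exponent vectors in the order f₁, f₂, f₃, f₄, f₆, f₈, f₁₂, f₂₄

Exponents : Set
Exponents = Vec ℤ 8

basis : Vec Series 8
basis = E 1 ∷ E 2 ∷ E 3 ∷ E 4 ∷ E 6 ∷ E 8 ∷ E 12 ∷ E 24 ∷ []

opaque
  -- Eta quotients are handled through their exponent vectors, so that multiplying and dividing
  -- concrete ones is a computation with integers.
  η : Exponents → Series
  η = monomial basis

  η-def : ∀ v → η v ≈ monomial basis v
  η-def v = ≈-refl

single : ∀ {n} → Fin n → Vec ℤ n
single i = replicate _ 0ℤ [ i ]≔ 1ℤ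

f₁ f₂ f₃ f₄ f₆ f₁₂ : Exponents
f₁  = single 0F
f₂  = single 1F
f₃  = single 2F
f₄  = single 3F
f₆  = single 4F
f₁₂ = single 6F

infixl 7 _∙_ _÷_
infixl 8 _^^_

_∙_ _÷_ : Exponents → Exponents → Exponents
_∙_ = zipWith ℤ._+_
_÷_ = zipWith ℤ._-_

_^^_ : Exponents → ℕ → Exponents
v ^^ k = map (+ k ℤ.*_) v

E-unit : ∀ d .{{_ : NonZero d}} → IsUnit (E d)
E-unit d = IsUnit-≈ (f[]-poch d) (f[]-constantTerm d)

basis-units : All IsUnit basis
basis-units = E-unit 1 ∷ E-unit 2 ∷ E-unit 3 ∷ E-unit 4 ∷ E-unit 6 ∷ E-unit 8 ∷ E-unit 12 ∷ E-unit
  24 ∷ []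

opaque
  unfolding η

  η-· : ∀ v w → η v · η w ≈ η (v ∙ w)
  η-· = monomial-· basis-units

monomial-unit : ∀ {k} {fs : Vec Series k} → All IsUnit fs → ∀ t → IsUnit (monomial fs t)
monomial-unit []       []      = IsUnit-𝟙
monomial-unit (u ∷ us) (x ∷ t) = IsUnit-· (IsUnit-** u x) (monomial-unit us t)

η-unit : ∀ v → IsUnit (η v)
η-unit v = IsUnit-≈ (≈-sym (η-def v)) (monomial-unit basis-units v)

-- Division in exponent form. For closed vectors `w ∙ v` computes, so that the hypothesis is an
-- identity between X times one known eta product and another.
η-quotient : ∀ v w {X} → X · η v ≈ η (w ∙ v) → X ≈ η w
η-quotient v w {X} e = unit-cancel (η-unit v)
  (≈-trans (·-comm (η v) X) (≈-trans e (≈-trans (≈-sym (η-· w v)) (·-comm (η w) (η v)))))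

monomial-zero : ∀ {k} (fs : Vec Series k) → monomial fs (replicate k 0ℤ) ≈ 𝟙
monomial-zero []       = ≈-refl
monomial-zero (f ∷ fs) = ≈-trans (·-cong (**-zero f) (monomial-zero fs)) (·-idˡ 𝟙)

monomial-single : ∀ {k} (fs : Vec Series k) i → monomial fs (single i) ≈ lookup fs i
monomial-single (f ∷ fs) zero    = ≈-trans (·-cong (**-one f) (monomial-zero fs)) (·-idʳ f)
monomial-single (f ∷ fs) (suc i) = ≈-trans (·-cong (**-zero f) (monomial-single fs i)) (·-idˡ _)

η-single : ∀ i → lookup basis i ≈ η (single i)
η-single i = ≈-sym (≈-trans (η-def _) (monomial-single basis i))

𝟙-η : 𝟙 ≈ η (replicate 8 0ℤ)
𝟙-η = ≈-sym (≈-trans (η-def _) (monomial-zero basis))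

a-η : ∀ {t₁ t₂ t₃ t₄} →
  a (t₁ ∷ t₂ ∷ t₃ ∷ t₄ ∷ []) ≈ η (t₁ ∷ t₂ ∷ t₃ ∷ t₄ ∷ 0ℤ ∷ 0ℤ ∷ 0ℤ ∷ 0ℤ ∷ [])
a-η {t₁} {t₂} {t₃} {t₄} = ≈-trans
  (⊛⇒· (power 1 t₁) (⊛⇒· (power 2 t₂) (⊛⇒· (power 3 t₃) (⊛⇒· (power 4 t₄)
  (≈-trans one≈𝟙 (≈-sym (monomial-zero (E 6 ∷ E 8 ∷ E 12 ∷ E 24 ∷ [])))))))) (≈-sym (η-def _))
  where
  power : ∀ j .{{_ : NonZero j}} t → f[ j ] ^ t ≈ E j ** t
  power j t = ≈-trans (**-def f[ j ] t) (**-cong (f[]-constantTerm j) (f[]-poch j) t)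

O₋-η₁ : O -1ℤ 1 ≈ η (f₁ ÷ f₂)
O₋-η₁ = η-quotient f₂ (f₁ ÷ f₂)
  (≈-trans (·-congˡ (≈-sym (η-single 1F))) (≈-trans (≈-sym (E-split 1)) (η-single 0F)))

O₋-η₂ : O -1ℤ 2 ≈ η (f₂ ÷ f₄)
O₋-η₂ = η-quotient f₄ (f₂ ÷ f₄)
  (≈-trans (·-congˡ (≈-sym (η-single 3F))) (≈-trans (≈-sym (E-split 2)) (η-single 1F)))

O₋-η₃ : O -1ℤ 3 ≈ η (f₃ ÷ f₆)
O₋-η₃ = η-quotient f₆ (f₃ ÷ f₆)
  (≈-trans (·-congˡ (≈-sym (η-single 4F))) (≈-trans (≈-sym (E-split 3)) (η-single 2F)))

O₋-η₆ : O -1ℤ 6 ≈ η (f₆ ÷ f₁₂)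
O₋-η₆ = η-quotient f₁₂ (f₆ ÷ f₁₂)
  (≈-trans (·-congˡ (≈-sym (η-single 6F))) (≈-trans (≈-sym (E-split 6)) (η-single 4F)))

O₊-η₁ : O 1ℤ 1 ≈ η (f₂ ^^ 2 ÷ (f₁ ∙ f₄))
O₊-η₁ = η-quotient (f₁ ÷ f₂) (f₂ ^^ 2 ÷ (f₁ ∙ f₄))
  (≈-trans (·-congˡ (≈-sym O₋-η₁)) (≈-trans (O-conjugate 1) O₋-η₂))

O₊-η₃ : O 1ℤ 3 ≈ η (f₆ ^^ 2 ÷ (f₃ ∙ f₁₂))
O₊-η₃ = η-quotient (f₃ ÷ f₆) (f₆ ^^ 2 ÷ (f₃ ∙ f₁₂))
  (≈-trans (·-congˡ (≈-sym O₋-η₃)) (≈-trans (O-conjugate 3) O₋-η₆))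

²q-** : ∀ {f g} → IsUnit f → f ²q ≈ g → ∀ t → (f ** t) ²q ≈ g ** t
²q-** {f} u e t = ≈-trans (**-hom _²q ²q-cong ²q-· (²q-const 1ℤ) u v t) (**-cong v e t)
  where v = ≡.trans (²q-zero f) u

-- Each exponent moves from f_d to f_2d. Those of f₈ and f₂₄ are 0 in the argument because f₁₆ and
-- f₄₈ lie outside the basis.
η-²q : ∀ {a b c d e g} → (η (a ∷ b ∷ c ∷ d ∷ e ∷ 0ℤ ∷ g ∷ 0ℤ ∷ [])) ²q ≈
  η (0ℤ ∷ a ∷ 0ℤ ∷ b ∷ c ∷ d ∷ e ∷ g ∷ [])
η-²q {a} {b} {c} {d} {e} {g} = ≈-trans (²q-cong (η-def _))
  (≈-trans (step 1 a (step 2 b (step 3 c (step 4 d (step 6 e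
    (skip (step 12 g (skip (²q-const 1ℤ)))))))))
  (≈-trans (solve 6 (λ a b c d e g → a :*
    (b :* (c :* (d :* (e :* (con 1ℤ :* (g :* (con 1ℤ :* con 1ℤ)))))))
      := con 1ℤ :* (a :* (con 1ℤ :* (b :* (c :* (d :* (e :* (g :* con 1ℤ)))))))) ≈-refl _ _ _ _ _ _)
    (≈-trans (·-cong (≈-sym (**-zero (E 1))) (·-congˡ (·-congʳ (≈-sym (**-zero (E 3))))))
      (≈-sym (η-def _)))))
  where
  step : ∀ d .{{_ : NonZero d}} t {X Y} → X ²q ≈ Y → (E d ** t · X) ²q ≈ E (d ℕ.+ d) ** t · Y
  step d t e = ≈-trans (²q-· _ _) (·-cong (²q-** (E-unit d) (poch-²q -1ℤ d d) t) e)
  skip : ∀ {f X Y} → X ²q ≈ Y → (f ** 0ℤ · X) ²q ≈ 𝟙 · Y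
  skip {f} e = ≈-trans (²q-· _ _) (·-cong (≈-trans (²q-cong (**-zero f)) (²q-const 1ℤ)) e)

-- Only the factors with odd exponents feel q ↦ -q: (q; q²)_∞ becomes (-q; q²)_∞, while f₂ is fixed.
E-neg₁ : (E 1) -q ≈ η (f₂ ^^ 3 ÷ (f₁ ∙ f₄))
E-neg₁ = ≈-trans (-q-cong (E-split 1)) (≈-trans (-q-· _ _) (≈-trans
  (·-cong (≈-trans (poch-neg -1ℤ 1 1) O₊-η₁) (≈-trans (poch-neg -1ℤ 2 1) (η-single 1F)))
    (η-· _ f₂)))

E-neg₃ : (E 3) -q ≈ η (f₆ ^^ 3 ÷ (f₃ ∙ f₁₂))
E-neg₃ = ≈-trans (-q-cong (E-split 3)) (≈-trans (-q-· _ _) (≈-trans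
  (·-cong (≈-trans (poch-neg -1ℤ 3 3) O₊-η₃) (≈-trans (poch-neg -1ℤ 6 3) (η-single 4F)))
    (η-· _ f₆)))

-- Triangular numbers n(n+1)/2, n ∈ ℤ

triangle : ℕ → ℕ
triangle zero    = 0
triangle (suc n) = suc n ℕ.+ triangle n

-- The second clause uses the symmetry of n(n+1)/2 under n ↦ -1 - n.
tri : ℤ → ℕ
tri (+ n)    = triangle n
tri -[1+ n ] = triangle n

tri-suc : ∀ n → + tri (ℤ.suc n) ≡ + tri n ℤ.+ ℤ.suc n
tri-suc (+ n) = ≡.trans (ℤ.pos-+ (suc n) (triangle n)) (ℤ.+-comm (+ suc n) (+ triangle n))
tri-suc -[1+ zero ]  = ≡.refl
tri-suc -[1+ suc n ] = ≡.sym (≡.trans (cong (λ x → x ℤ.+ -[1+ n ]) (ℤ.pos-+ (suc n) (triangle n)))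
  (lemma (+ suc n) (+ triangle n)))
  where
  lemma : ∀ x y → x ℤ.+ y ℤ.+ ℤ.- x ≡ y
  lemma = ℤ-solve

ℤ-induction : (P : ℤ → Set) → P 0ℤ → (∀ n → P n → P (ℤ.suc n)) → (∀ n → P (ℤ.suc n) → P n) → ∀ n → P
  n
ℤ-induction P z s p (+ zero)     = z
ℤ-induction P z s p (+ suc n)    = s (+ n) (ℤ-induction P z s p (+ n))
ℤ-induction P z s p -[1+ zero ]  = p -[1+ 0 ] z
ℤ-induction P z s p -[1+ suc n ] = p -[1+ suc n ] (ℤ-induction P z s p -[1+ n ])

-- Identities between theta exponents are proved after doubling: without the division by 2 they are
-- polynomial identities for the ring solver, and `double-injective` undoes the doubling.
tri-double : ∀ n → + tri n ℤ.+ + tri n ≡ n ℤ.* ℤ.suc n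
tri-double = ℤ-induction _ ≡.refl
  (λ n e → ≡.trans (cong₂ ℤ._+_ (tri-suc n) (tri-suc n)) (≡.trans (lemma₁ (+ tri n) n)
    (≡.trans (cong (λ x → x ℤ.+ + 2 ℤ.* ℤ.suc n) e) (lemma₂ n))))
  (λ n e → ∙-cancelʳ (+ 2 ℤ.* ℤ.suc n) _ _ (≡.trans (≡.sym (lemma₁ (+ tri n) n))
    (≡.trans (≡.sym (cong₂ ℤ._+_ (tri-suc n) (tri-suc n))) (≡.trans e (≡.sym (lemma₂ n))))))
  where
  lemma₁ : ∀ x n → x ℤ.+ (1ℤ ℤ.+ n) ℤ.+ (x ℤ.+ (1ℤ ℤ.+ n)) ≡ x ℤ.+ x ℤ.+ + 2 ℤ.* (1ℤ ℤ.+ n)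
  lemma₁ = ℤ-solve
  lemma₂ : ∀ n → n ℤ.* (1ℤ ℤ.+ n) ℤ.+ + 2 ℤ.* (1ℤ ℤ.+ n) ≡ (1ℤ ℤ.+ n) ℤ.* (1ℤ ℤ.+ (1ℤ ℤ.+ n))
  lemma₂ = ℤ-solve

double-injective : ∀ {x y} → x ℤ.+ x ≡ y ℤ.+ y → x ≡ y
double-injective {x} {y} e = ℤ.*-cancelˡ-≡ (+ 2) x y
  (≡.trans (lemma x) (≡.trans e (≡.sym (lemma y))))
  where
  lemma : ∀ x → + 2 ℤ.* x ≡ x ℤ.+ x
  lemma = ℤ-solve

-- i n(n+1)/2 + j n(n-1)/2
expo : ℕ → ℕ → ℤ → ℕ
expo i j n = i ℕ.* tri n ℕ.+ j ℕ.* tri (ℤ.- n)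

pos-expo : ∀ i j n → + expo i j n ≡ + i ℤ.* + tri n ℤ.+ + j ℤ.* + tri (ℤ.- n)
pos-expo i j n = ≡.trans (ℤ.pos-+ (i ℕ.* tri n) _)
  (cong₂ ℤ._+_ (ℤ.pos-* i (tri n)) (ℤ.pos-* j (tri (ℤ.- n))))

expo-double : ∀ i j n → + expo i j n ℤ.+ + expo i j n ≡ + i ℤ.* (n ℤ.* (1ℤ ℤ.+ n)) ℤ.+ + j ℤ.*
  (n ℤ.* (n ℤ.- 1ℤ))
expo-double i j n = ≡.trans (cong (λ x → x ℤ.+ x) (pos-expo i j n))
  (≡.trans (lemma₁ (+ i) (+ j) (+ tri n) (+ tri (ℤ.- n)))
  (≡.trans (cong₂ (λ x y → + i ℤ.* x ℤ.+ + j ℤ.* y) (tri-double n) (tri-double (ℤ.- n)))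
    (lemma₂ (+ i) (+ j) n)))
  where
  lemma₁ : ∀ i j x y → i ℤ.* x ℤ.+ j ℤ.* y ℤ.+ (i ℤ.* x ℤ.+ j ℤ.* y) ≡ i ℤ.* (x ℤ.+ x) ℤ.+ j ℤ.*
    (y ℤ.+ y)
  lemma₁ = ℤ-solve
  lemma₂ : ∀ i j n → i ℤ.* (n ℤ.* (1ℤ ℤ.+ n)) ℤ.+ j ℤ.* (ℤ.- n ℤ.* (1ℤ ℤ.+ ℤ.- n)) ≡ i ℤ.*
    (n ℤ.* (1ℤ ℤ.+ n)) ℤ.+ j ℤ.* (n ℤ.* (n ℤ.- 1ℤ))
  lemma₂ = ℤ-solve

n≤triangle : ∀ n → n ℕ.≤ triangle n
n≤triangle zero    = z≤n
n≤triangle (suc n) = ℕ.m≤m+n (suc n) _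

∣n∣≤1+tri : ∀ n → ∣ n ∣ ℕ.≤ suc (tri n)
∣n∣≤1+tri (+ n)    = ℕ.m≤n⇒m≤1+n (n≤triangle n)
∣n∣≤1+tri -[1+ n ] = s≤s (n≤triangle n)

-- One of i and j may be 0, as in f(1, q²), but the other still makes the exponent at least |n| - 1.
-- This is the convergence rate of all theta series here.
∣n∣≤1+expo : ∀ i j .{{_ : NonZero (i ℕ.+ j)}} n → ∣ n ∣ ℕ.≤ suc (expo i j n)
∣n∣≤1+expo (suc i) j n = ℕ.≤-trans (∣n∣≤1+tri n) (s≤s (ℕ.≤-trans (ℕ.m≤m+n (tri n) _) (ℕ.m≤m+n _ _)))
∣n∣≤1+expo zero (suc j) n = ℕ.≤-trans
  (≡.subst (ℕ._≤ suc (tri (ℤ.- n))) (ℤ.∣-i∣≡∣i∣ n) (∣n∣≤1+tri (ℤ.- n)))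
  (s≤s (ℕ.m≤m+n _ _))

-- Sums over [-L, L)

-- The range is half-open so that [-2L, 2L) splits by parity into two copies of [-L, L).
bisum : ℕ → (ℤ → Series) → Series
bisum zero    F = 𝟘
bisum (suc L) F = bisum L F ⊕ (F (+ L) ⊕ F -[1+ L ])

-- The k-th term of f(εq^i, εq^j), for ε = ±1
term : ℤ → ℕ → ℕ → ℤ → Series
term ε i j n = const (ε ℤ.^ ∣ n ∣) · q↑ expo i j n

opaque
  -- The cutoff n + 2 suffices for the coefficient of q^n: every omitted index k has |k| ≥ n + 2,
  -- and the exponent at k is at least |k| - 1.
  θ : ℤ → ℕ → ℕ → Series
  θ ε i j n = bisum (suc (suc n)) (term ε i j) n

term-high : ∀ ε i j .{{_ : NonZero (i ℕ.+ j)}} {K} n → K ℕ.< ∣ n ∣ → term ε i j n ≈[ K ] 𝟘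
term-high ε i j {K} n K<n = below-trans
  (·-cong-below below-refl (q↑-high (ℕ.≤-pred (ℕ.≤-trans K<n (∣n∣≤1+expo i j n)))))
  (≈⇒≈[] K (·-zeroʳ _))

bisum-stable : ∀ {K F} → (∀ n → K ℕ.< ∣ n ∣ → F n ≈[ K ] 𝟘) → ∀ d → bisum (d ℕ.+ suc K) F ≈[ K ]
  bisum (suc K) F
bisum-stable e zero = below-refl
bisum-stable {K} {F} e (suc d) = below-trans
  (⊕-cong-below (bisum-stable e d) (below-trans (⊕-cong-below
      (e (+ (d ℕ.+ suc K)) (ℕ.m≤n+m (suc K) d))
        (e -[1+ d ℕ.+ suc K ] (ℕ.m≤n⇒m≤1+n (ℕ.m≤n+m (suc K) d))))
    (≈⇒≈[] K (⊕-idʳ 𝟘))))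
  (≈⇒≈[] K (⊕-idʳ _))

opaque
  unfolding θ

  θ-below : ∀ ε i j .{{_ : NonZero (i ℕ.+ j)}} {K L} → K ℕ.< L → θ ε i j ≈[ K ] bisum L (term ε i j)
  θ-below ε i j {K} {L} K<L = below λ n n<K → ≡.sym (≡.trans
    (cong (λ N → bisum N (term ε i j) n) (≡.sym (ℕ.m∸n+n≡m (ℕ.≤-trans (s≤s n<K) K<L))))
    (bisum-stable (term-high ε i j) (L ∸ suc (suc n)) .at< n (ℕ.n<1+n n)))

Σ< : ℕ → (ℕ → Series) → Series
Σ< zero    F = 𝟘
Σ< (suc n) F = Σ< n F ⊕ F n

Σ<-cong : ∀ n {F G} → (∀ k → k ℕ.< n → F k ≈ G k) → Σ< n F ≈ Σ< n G
Σ<-cong zero    e = ≈-refl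
Σ<-cong (suc n) e = ⊕-cong (Σ<-cong n λ k k<n → e k (ℕ.m≤n⇒m≤1+n k<n)) (e n ℕ.≤-refl)

Σ<-cong-below : ∀ {K} n {F G} → (∀ k → k ℕ.< n → F k ≈[ K ] G k) → Σ< n F ≈[ K ] Σ< n G
Σ<-cong-below zero    e = below-refl
Σ<-cong-below (suc n) e = ⊕-cong-below (Σ<-cong-below n λ k k<n → e k (ℕ.m≤n⇒m≤1+n k<n))
  (e n ℕ.≤-refl)

Σ<-first : ∀ n F → Σ< (suc n) F ≈ F 0 ⊕ Σ< n (λ k → F (suc k))
Σ<-first zero    F = ⊕-comm 𝟘 (F 0)
Σ<-first (suc n) F = ≈-trans (⊕-cong (Σ<-first n F) ≈-refl) (⊕-assoc _ _ _)

Σ<-⊕ : ∀ n F G → Σ< n (λ k → F k ⊕ G k) ≈ Σ< n F ⊕ Σ< n G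
Σ<-⊕ zero    F G = ≈-sym (⊕-idʳ 𝟘)
Σ<-⊕ (suc n) F G = ≈-trans (⊕-cong (Σ<-⊕ n F G) ≈-refl)
  (solve 4 (λ a b c d → (a :+ b) :+ (c :+ d) := (a :+ c) :+ (b :+ d)) ≈-refl _ _ _ _)

Σ<-·ˡ : ∀ n c F → c · Σ< n F ≈ Σ< n (λ k → c · F k)
Σ<-·ˡ zero    c F = ·-zeroʳ c
Σ<-·ˡ (suc n) c F = ≈-trans
  (solve 3 (λ c a b → c :* (a :+ b) := c :* a :+ c :* b) ≈-refl c (Σ< n F) (F n))
  (⊕-cong (Σ<-·ˡ n c F) ≈-refl)

Σ<-reverse : ∀ n F → Σ< (suc n) F ≈ Σ< (suc n) (λ k → F (n ∸ k))
Σ<-reverse zero    F = ≈-refl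
Σ<-reverse (suc n) F = ≈-trans (⊕-comm _ _)
  (≈-trans (⊕-cong ≈-refl (Σ<-reverse n F)) (≈-sym (Σ<-first (suc n) (λ k → F (suc n ∸ k)))))

Σ<-bisum : ∀ N F → Σ< (N ℕ.+ N) (λ k → F (k ℤ.⊖ N)) ≈ bisum N F
Σ<-bisum zero    F = ≈-refl
Σ<-bisum (suc N) F rewrite ℕ.+-suc N N = ≈-trans (Σ<-first (suc (N ℕ.+ N)) _)
  (≈-trans (⊕-cong ≈-refl (⊕-cong
      (≈-trans (Σ<-cong (N ℕ.+ N) λ k _ → ≡⇒≈ (cong F (ℤ.[1+m]⊖[1+n]≡m⊖n k N))) (Σ<-bisum N F))
      (≡⇒≈ (cong F (≡.trans (ℤ.[1+m]⊖[1+n]≡m⊖n (N ℕ.+ N) N)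
        (≡.trans (ℤ.⊖-≥ (ℕ.m≤m+n N N)) (cong +_ (ℕ.m+n∸m≡n N N))))))))
    (solve 3 (λ a b c → a :+ (b :+ c) := b :+ (c :+ a)) ≈-refl _ _ _))

-- Gaussian binomial coefficients in base q^m

module GaussianBinomial (m : ℕ) .{{_ : NonZero m}} where

  -- A q-Pascal rule as definition avoids quotients. For k > X the truncated difference `X ∸ k` is
  -- harmless, since `gauss X k` vanishes.
  gauss : ℕ → ℕ → Series
  gauss X       zero    = 𝟙
  gauss zero    (suc k) = 𝟘
  gauss (suc X) (suc k) = gauss X (suc k) ⊕ q↑ ((X ∸ k) ℕ.* m) · gauss X k

  poch< : ℕ → Series
  poch< = prod (λ k → factor -1ℤ (m ℕ.+ k ℕ.* m))

  gauss-zero : ∀ {X k} → X ℕ.< k → gauss X k ≈ 𝟘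
  gauss-zero {zero}  {suc k} _         = ≈-refl
  gauss-zero {suc X} {suc k} (s≤s X<k) = ≈-trans
    (⊕-cong (gauss-zero (ℕ.m≤n⇒m≤1+n X<k)) (≈-trans (·-congˡ (gauss-zero X<k)) (·-zeroʳ _)))
      (⊕-idʳ 𝟘)

  gauss-top : ∀ X → gauss X X ≈ 𝟙
  gauss-top zero    = ≈-refl
  gauss-top (suc X) = ≈-trans (⊕-cong (gauss-zero (ℕ.n<1+n X)) (·-cong
    (≈-trans (q↑-cong (cong (ℕ._* m) (ℕ.n∸n≡0 X))) q↑0) (gauss-top X)))
    (solve 0 (con 0ℤ :+ con 1ℤ :* con 1ℤ := con 1ℤ) ≈-refl)

  -- With x = q^((i+1)m) and y = q^((j+1)m), the Pascal rule reduces the step to (1 - y) + y(1 - x)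
  -- = 1 - xy.
  gauss-poch : ∀ i j → gauss (i ℕ.+ j) i · (poch< i · poch< j) ≈ poch< (i ℕ.+ j)
  gauss-poch zero    j       = solve 1 (λ x → con 1ℤ :* (con 1ℤ :* x) := x) ≈-refl _
  gauss-poch (suc i) zero rewrite ℕ.+-identityʳ i = ≈-trans (·-congʳ (gauss-top (suc i)))
    (solve 1 (λ x → con 1ℤ :* (x :* con 1ℤ) := x) ≈-refl _)
  gauss-poch (suc i) (suc j) = begin
    (gauss (i ℕ.+ suc j) (suc i) ⊕ q↑ ((i ℕ.+ suc j ∸ i) ℕ.* m) · gauss (i ℕ.+ suc j) i)
        · (poch< i · factor -1ℤ (m ℕ.+ i ℕ.* m) · (poch< j · factor -1ℤ (m ℕ.+ j ℕ.* m)))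
      ≈⟨ ·-congʳ (⊕-cong (≡⇒≈ (cong (λ X → gauss X (suc i)) (ℕ.+-suc i j)))
           (·-congʳ (q↑-cong (cong (ℕ._* m) (ℕ.m+n∸m≡n i (suc j)))))) ⟩
    (gauss (suc i ℕ.+ j) (suc i) ⊕ q↑ (suc j ℕ.* m) · gauss (i ℕ.+ suc j) i)
        · (poch< i · (𝟙 ⊕ const -1ℤ · q↑ (suc i ℕ.* m)) ·
          (poch< j · (𝟙 ⊕ const -1ℤ · q↑ (suc j ℕ.* m))))
      ≈⟨ solve 6 (λ g h pi pj x y → (g :+ y :* h) :*
        (pi :* (con 1ℤ :+ con -1ℤ :* x) :* (pj :* (con 1ℤ :+ con -1ℤ :* y)))
           := (con 1ℤ :+ con -1ℤ :* y) :* (g :* (pi :* (con 1ℤ :+ con -1ℤ :* x) :* pj))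
              :+ y :* (con 1ℤ :+ con -1ℤ :* x) :* (h :* (pi :* (pj :* (con 1ℤ :+ con -1ℤ :* y)))))
           ≈-refl _ _ (poch< i) (poch< j) (q↑ (suc i ℕ.* m)) (q↑ (suc j ℕ.* m)) ⟩
    (𝟙 ⊕ const -1ℤ · q↑ (suc j ℕ.* m)) · (gauss (suc i ℕ.+ j) (suc i) · (poch< (suc i) · poch< j))
      ⊕ q↑ (suc j ℕ.* m) · (𝟙 ⊕ const -1ℤ · q↑ (suc i ℕ.* m)) ·
        (gauss (i ℕ.+ suc j) i · (poch< i · poch< (suc j)))
      ≈⟨ ⊕-cong (·-congˡ (gauss-poch (suc i) j))
          (·-congˡ (≈-trans (gauss-poch i (suc j)) (≡⇒≈ (cong poch< (ℕ.+-suc i j))))) ⟩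
    (𝟙 ⊕ const -1ℤ · q↑ (suc j ℕ.* m)) · poch< (suc i ℕ.+ j)
      ⊕ q↑ (suc j ℕ.* m) · (𝟙 ⊕ const -1ℤ · q↑ (suc i ℕ.* m)) · poch< (suc i ℕ.+ j)
      ≈⟨ solve 3 (λ p x y → (con 1ℤ :+ con -1ℤ :* y) :* p :+ y :* (con 1ℤ :+ con -1ℤ :* x) :* p
           := p :* (con 1ℤ :+ con -1ℤ :* (x :* y))) ≈-refl (poch< (suc i ℕ.+ j)) (q↑ (suc i ℕ.* m))
             (q↑ (suc j ℕ.* m)) ⟩
    poch< (suc i ℕ.+ j) · (𝟙 ⊕ const -1ℤ · (q↑ (suc i ℕ.* m) · q↑ (suc j ℕ.* m)))
      ≈⟨ ·-congˡ (⊕-cong ≈-refl (·-congˡ (≈-trans (q↑-+ _ _) (q↑-cong (lemma i j m))))) ⟩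
    poch< (suc i ℕ.+ j) · factor -1ℤ (m ℕ.+ suc (i ℕ.+ j) ℕ.* m)
      ≈⟨ ≡⇒≈ (cong poch< (≡.sym (ℕ.+-suc (suc i) j))) ⟩
    poch< (suc i ℕ.+ suc j) ∎
    where
    open ≈-Reasoning
    lemma : ∀ i j m → suc i ℕ.* m ℕ.+ suc j ℕ.* m ≡ m ℕ.+ suc (i ℕ.+ j) ℕ.* m
    lemma = ℕ-solve

  poch<-unit : ∀ k → IsUnit (poch< k)
  poch<-unit zero    = IsUnit-𝟙
  poch<-unit (suc k) = IsUnit-· (poch<-unit k) (≡.trans
    (factor-below -1ℤ {1} (ℕ.≤-trans (ℕ.>-nonZero⁻¹ m) (ℕ.m≤m+n m (k ℕ.* m))) .at< 0 (s≤s z≤n))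
      IsUnit-𝟙)

  gauss-sym : ∀ X k → k ℕ.≤ X → gauss X k ≈ gauss X (X ∸ k)
  gauss-sym X k k≤X = ≡.subst (λ Y → gauss Y k ≈ gauss Y (X ∸ k)) (ℕ.m+[n∸m]≡n k≤X)
    (unit-cancel (IsUnit-· (poch<-unit k) (poch<-unit (X ∸ k))) (begin
      poch< k · poch< j · gauss (k ℕ.+ j) k ≈⟨ ·-comm _ _ ⟩
      gauss (k ℕ.+ j) k · (poch< k · poch< j) ≈⟨ gauss-poch k j ⟩
      poch< (k ℕ.+ j) ≡⟨ cong poch< (ℕ.+-comm k j) ⟩
      poch< (j ℕ.+ k) ≈⟨ gauss-poch j k ⟨
      gauss (j ℕ.+ k) j · (poch< j · poch< k) ≈⟨ ·-cong
        (≡⇒≈ (cong (λ X → gauss X j) (ℕ.+-comm j k))) (·-comm _ _) ⟩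
      gauss (k ℕ.+ j) j · (poch< k · poch< j) ≈⟨ ·-comm _ _ ⟩
      poch< k · poch< j · gauss (k ℕ.+ j) j ∎))
    where
    open ≈-Reasoning
    j : ℕ
    j = X ∸ k

  -- The induction step of the q-binomial theorem
  binomial-step : ∀ (τ : ℕ → Series) y X →
    (∀ k → k ℕ.≤ X → y · τ k ≈ q↑ ((X ∸ k) ℕ.* m) · τ (suc k)) →
    Σ< (suc X) (λ k → τ k · gauss X k) · (𝟙 ⊕ y) ≈ Σ< (suc (suc X)) (λ k → τ k · gauss (suc X) k)
  binomial-step τ y X e = ≈-sym (begin
    Σ< (2 ℕ.+ X) (λ k → τ k · gauss (suc X) k)
      ≈⟨ Σ<-first (suc X) (λ k → τ k · gauss (suc X) k) ⟩
    τ 0 · 𝟙 ⊕ Σ< (suc X) (λ k → τ (suc k) · (gauss X (suc k) ⊕ q↑ ((X ∸ k) ℕ.* m) · gauss X k))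
      ≈⟨ ⊕-cong ≈-refl (≈-trans (Σ<-cong (suc X) (λ k k<X → expand k (ℕ.≤-pred k<X)))
        (Σ<-⊕ (suc X) (λ k → τ (suc k) · gauss X (suc k)) (λ k → y · (τ k · gauss X k)))) ⟩
    τ 0 · 𝟙 ⊕ (Σ< (suc X) (λ k → τ (suc k) · gauss X (suc k)) ⊕ Σ< (suc X)
      (λ k → y · (τ k · gauss X k)))
      ≈⟨ ⊕-assoc _ _ _ ⟨
    τ 0 · 𝟙 ⊕ Σ< (suc X) (λ k → τ (suc k) · gauss X (suc k)) ⊕ Σ< (suc X)
      (λ k → y · (τ k · gauss X k))
      ≈⟨ ⊕-cong (≈-sym (Σ<-first (suc X) (λ k → τ k · gauss X k)))
        (≈-sym (Σ<-·ˡ (suc X) y (λ k → τ k · gauss X k))) ⟩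
    S ⊕ τ (suc X) · gauss X (suc X) ⊕ y · S
      ≈⟨ ⊕-cong (⊕-cong ≈-refl (≈-trans (·-congˡ (gauss-zero (ℕ.n<1+n X))) (·-zeroʳ _))) ≈-refl ⟩
    S ⊕ 𝟘 ⊕ y · S
      ≈⟨ solve 2 (λ s y → s :+ con 0ℤ :+ y :* s := s :* (con 1ℤ :+ y)) ≈-refl S y ⟩
    S · (𝟙 ⊕ y) ∎)
    where
    open ≈-Reasoning
    S : Series
    S = Σ< (suc X) (λ k → τ k · gauss X k)
    expand : ∀ k → k ℕ.≤ X → τ (suc k) · (gauss X (suc k) ⊕ q↑ ((X ∸ k) ℕ.* m) · gauss X k)
      ≈ τ (suc k) · gauss X (suc k) ⊕ y · (τ k · gauss X k)
    expand k k≤X = ≈-trans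
      (solve 4 (λ t g p h → t :* (g :+ p :* h) := t :* g :+ (p :* t) :* h) ≈-refl _ _ _ _)
      (⊕-cong ≈-refl (≈-trans (·-congʳ (≈-sym (e k k≤X))) (·-assoc _ _ _)))

  -- By `gauss-poch` the coefficient is a quotient of three finite Pochhammer symbols, one above and
  -- two below, and each of them agrees with P modulo q^K.
  gauss-below : ∀ {K i j} → K ℕ.≤ i → K ℕ.≤ j → poch -1ℤ m m · gauss (i ℕ.+ j) i ≈[ K ] 𝟙
  gauss-below {K} {i} {j} K≤i K≤j = unit-cancelˡ P-unit (begin
    P · (P · gauss (i ℕ.+ j) i)
      ≈⟨ ≈⇒≈[] K (solve 3 (λ a b g → a :* (b :* g) := g :* (a :* b)) ≈-refl _ _ _) ⟩
    gauss (i ℕ.+ j) i · (P · P)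
      ≈⟨ ·-cong-below below-refl (·-cong-below (∏-below conv K≤i) (∏-below conv K≤j)) ⟩
    gauss (i ℕ.+ j) i · (poch< i · poch< j)
      ≈⟨ ≈⇒≈[] K (gauss-poch i j) ⟩
    poch< (i ℕ.+ j)
      ≈⟨ ∏-below conv (ℕ.≤-trans K≤i (ℕ.m≤m+n i j)) ⟨
    P
      ≈⟨ ≈⇒≈[] K (·-idʳ P) ⟨
    P · 𝟙 ∎)
    where
    open ≈[]-Reasoning K
    conv = poch-convergent -1ℤ m m
    P : Series
    P = poch -1ℤ m m
    P-unit : IsUnit P
    P-unit = ≡.trans (∏-below conv (ℕ.≤-refl {1}) .at< 0 (s≤s z≤n)) (poch<-unit 1)

-- The Jacobi triple product, as a limit of its finite form

sign-suc : ∀ {ε} → ε ℤ.* ε ≡ 1ℤ → ∀ n → ε ℤ.^ ∣ ℤ.suc n ∣ ≡ ε ℤ.* ε ℤ.^ ∣ n ∣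
sign-suc s (+ n) = ≡.refl
sign-suc {ε} s -[1+ n ] = ≡.sym (≡.trans (≡.sym (ℤ.*-assoc ε ε _))
  (≡.trans (cong (λ x → x ℤ.* ε ℤ.^ n) s) (≡.trans (ℤ.*-identityˡ _) (cong (ε ℤ.^_) (lemma n)))))
  where
  lemma : ∀ n → n ≡ ∣ ℤ.suc -[1+ n ] ∣
  lemma zero    = ≡.refl
  lemma (suc n) = ≡.refl

term-neg : ∀ ε i j n → term ε j i (ℤ.- n) ≈ term ε i j n
term-neg ε i j n = ·-cong (≡⇒≈ (cong (λ x → const (ε ℤ.^ x)) (ℤ.∣-i∣≡∣i∣ n)))
  (q↑-cong (≡.trans (cong (λ x → j ℕ.* tri (ℤ.- n) ℕ.+ i ℕ.* tri x) (ℤ.neg-involutive n))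
    (ℕ.+-comm (j ℕ.* tri (ℤ.- n)) _)))

term-zero : ∀ ε i j → term ε i j 0ℤ ≈ 𝟙
term-zero ε i j = ≈-trans (·-idˡ _)
  (≈-trans (q↑-cong (≡.cong₂ ℕ._+_ (ℕ.*-zeroʳ i) (ℕ.*-zeroʳ j))) q↑0)

expo-suc : ∀ i j n → + expo i j (ℤ.suc n) ≡ + expo i j n ℤ.+ (+ i ℤ.+ n ℤ.* (+ i ℤ.+ + j))
expo-suc i j n = double-injective (≡.trans (expo-double i j (ℤ.suc n))
  (≡.trans (lemma (+ i) (+ j) n)
    (≡.trans (cong (λ x → x ℤ.+ (d ℤ.+ d)) (≡.sym (expo-double i j n))) (lemma₂ (+ expo i j n) d))))
  where
  d : ℤ
  d = + i ℤ.+ n ℤ.* (+ i ℤ.+ + j)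
  lemma : ∀ i j n → i ℤ.* ((1ℤ ℤ.+ n) ℤ.* (1ℤ ℤ.+ (1ℤ ℤ.+ n))) ℤ.+ j ℤ.*
    ((1ℤ ℤ.+ n) ℤ.* ((1ℤ ℤ.+ n) ℤ.- 1ℤ))
    ≡ i ℤ.* (n ℤ.* (1ℤ ℤ.+ n)) ℤ.+ j ℤ.* (n ℤ.* (n ℤ.- 1ℤ)) ℤ.+
      (i ℤ.+ n ℤ.* (i ℤ.+ j) ℤ.+ (i ℤ.+ n ℤ.* (i ℤ.+ j)))
  lemma = ℤ-solve
  lemma₂ : ∀ x y → x ℤ.+ x ℤ.+ (y ℤ.+ y) ≡ x ℤ.+ y ℤ.+ (x ℤ.+ y)
  lemma₂ = ℤ-solve

const-q↑-· : ∀ c a d b → (const c · q↑ a) · (const d · q↑ b) ≈ const (c ℤ.* d) · q↑ (a ℕ.+ b)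
const-q↑-· c a d b = ≈-trans
  (solve 4 (λ c a d b → (c :* a) :* (d :* b) := (c :* d) :* (a :* b)) ≈-refl _ _ _ _)
  (·-cong (≈-sym (const-* c d)) (q↑-+ a b))

module FiniteTripleProduct (ε : ℤ) (ε² : ε ℤ.* ε ≡ 1ℤ) (m : ℕ) .{{_ : NonZero m}} where
  open GaussianBinomial m

  A : ℕ → ℕ → Series
  A i = prod (λ k → factor ε (i ℕ.+ k ℕ.* m))

  -- The sum side of the finite triple product. As M and N grow, k - N comes to range over ℤ and the
  -- Gaussian coefficient tends to 1/(q^m; q^m)_∞.
  S : ℕ → ℕ → ℕ → ℕ → Series
  S i j M N = Σ< (suc (M ℕ.+ N)) (λ k → term ε i j (k ℤ.⊖ N) · gauss (M ℕ.+ N) k)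

  suc-⊖ : ∀ k N → suc k ℤ.⊖ N ≡ ℤ.suc (k ℤ.⊖ N)
  suc-⊖ k N = ≡.sym (ℤ.distribʳ-⊖-+-pos 1 k N)

  -- The hypothesis of `binomial-step` for τ k = `term ε i j (k ℤ.⊖ N)`, where y belongs to the next
  -- factor of `A i`.
  term-step : ∀ i j M N → i ℕ.+ j ≡ m → ∀ k → k ℕ.≤ M ℕ.+ N →
    const ε · q↑ (i ℕ.+ M ℕ.* m) · term ε i j (k ℤ.⊖ N)
      ≈ q↑ ((M ℕ.+ N ∸ k) ℕ.* m) · term ε i j (suc k ℤ.⊖ N)
  term-step i j M N ≡.refl k k≤ = ≈-trans (const-q↑-· ε _ _ _) (≈-trans
    (·-cong (≡⇒≈ (cong const (≡.trans (≡.sym (sign-suc ε² n))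
      (cong (λ x → ε ℤ.^ ∣ x ∣) (≡.sym (suc-⊖ k N))))))
      (≈-trans (q↑-cong exponents) (≈-sym (q↑-+ _ _))))
    (solve 3 (λ a b c → a :* (b :* c) := b :* (a :* c)) ≈-refl _ _ _))
    where
    n : ℤ
    n = k ℤ.⊖ N
    rest : + (M ℕ.+ N ∸ k) ≡ + M ℤ.- n
    rest = ≡.trans (≡.sym (ℤ.⊖-≥ k≤)) (≡.trans (≡.sym (ℤ.m-n≡m⊖n (M ℕ.+ N) k))
      (≡.trans (cong (λ x → x ℤ.- + k) (ℤ.pos-+ M N))
        (≡.trans (lemma (+ M) (+ N) (+ k)) (cong (λ x → + M ℤ.- x) (ℤ.m-n≡m⊖n k N)))))
      where
      lemma : ∀ M N k → M ℤ.+ N ℤ.- k ≡ M ℤ.- (k ℤ.- N)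
      lemma = ℤ-solve
    exponents : i ℕ.+ M ℕ.* (i ℕ.+ j) ℕ.+ expo i j n ≡ (M ℕ.+ N ∸ k) ℕ.* (i ℕ.+ j) ℕ.+ expo i j
      (suc k ℤ.⊖ N)
    exponents = ℤ.+-injective (begin
      + (i ℕ.+ M ℕ.* (i ℕ.+ j) ℕ.+ expo i j n)
        ≡⟨ ≡.trans (ℤ.pos-+ (i ℕ.+ M ℕ.* (i ℕ.+ j)) _) (cong (λ x → x ℤ.+ + expo i j n)
             (≡.trans (ℤ.pos-+ i _) (cong (ℤ._+_ (+ i))
               (≡.trans (ℤ.pos-* M _) (cong (ℤ._*_ (+ M)) (ℤ.pos-+ i j)))))) ⟩
      + i ℤ.+ + M ℤ.* (+ i ℤ.+ + j) ℤ.+ + expo i j n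
        ≡⟨ lemma (+ i) (+ j) (+ M) n (+ expo i j n) ⟩
      (+ M ℤ.- n) ℤ.* (+ i ℤ.+ + j) ℤ.+ (+ expo i j n ℤ.+ (+ i ℤ.+ n ℤ.* (+ i ℤ.+ + j)))
        ≡⟨ cong₂ ℤ._+_ (≡.trans (cong₂ ℤ._*_ (≡.sym rest) (≡.sym (ℤ.pos-+ i j)))
          (≡.sym (ℤ.pos-* (M ℕ.+ N ∸ k) _)))
             (≡.trans (≡.sym (expo-suc i j n)) (cong (λ x → + expo i j x) (≡.sym (suc-⊖ k N)))) ⟩
      + ((M ℕ.+ N ∸ k) ℕ.* (i ℕ.+ j)) ℤ.+ + expo i j (suc k ℤ.⊖ N)
        ≡⟨ ℤ.pos-+ ((M ℕ.+ N ∸ k) ℕ.* (i ℕ.+ j)) _ ⟨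
      + ((M ℕ.+ N ∸ k) ℕ.* (i ℕ.+ j) ℕ.+ expo i j (suc k ℤ.⊖ N)) ∎)
      where
      open ≡-Reasoning
      lemma : ∀ i j M n e → i ℤ.+ M ℤ.* (i ℤ.+ j) ℤ.+ e ≡ (M ℤ.- n) ℤ.* (i ℤ.+ j) ℤ.+
        (e ℤ.+ (i ℤ.+ n ℤ.* (i ℤ.+ j)))
      lemma = ℤ-solve

  extend : ∀ i j N → i ℕ.+ j ≡ m → A j N ≈ S i j 0 N → ∀ M → A i M · A j N ≈ S i j M N
  extend i j N e base zero    = ≈-trans (·-idˡ _) base
  extend i j N e base (suc M) = ≈-trans
    (solve 3 (λ a b c → (a :* b) :* c := (a :* c) :* b) ≈-refl (A i M) _ (A j N))
    (≈-trans (·-congʳ (extend i j N e base M))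
      (binomial-step (λ k → term ε i j (k ℤ.⊖ N)) _ (M ℕ.+ N) (term-step i j M N e)))

  -- Again `extend`, with i and j exchanged and started from the empty product. Reversing the sum by
  -- k ↦ N - k and the symmetry of the Gaussian coefficients restore the roles of i and j.
  base : ∀ i j → i ℕ.+ j ≡ m → ∀ N → A j N ≈ S i j 0 N
  base i j e N = begin
    A j N
      ≈⟨ ·-idʳ _ ⟨
    A j N · 𝟙
      ≈⟨ extend j i 0 (≡.trans (ℕ.+-comm j i) e)
        (≈-sym (≈-trans (⊕-identityˡ _) (≈-trans (·-congʳ (term-zero ε j i)) (·-idˡ 𝟙)))) N ⟩
    Σ< (suc (N ℕ.+ 0)) (λ k → term ε j i (k ℤ.⊖ 0) · gauss (N ℕ.+ 0) k)
      ≡⟨ cong (λ X → Σ< (suc X) (λ k → term ε j i (k ℤ.⊖ 0) · gauss X k)) (ℕ.+-identityʳ N) ⟩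
    Σ< (suc N) (λ k → term ε j i (k ℤ.⊖ 0) · gauss N k)
      ≈⟨ Σ<-reverse N _ ⟩
    Σ< (suc N) (λ k → term ε j i ((N ∸ k) ℤ.⊖ 0) · gauss N (N ∸ k))
      ≈⟨ Σ<-cong (suc N) (λ k k<N → ·-cong
           (≈-trans (≡⇒≈ (cong (term ε j i) (flip k (ℕ.≤-pred k<N)))) (term-neg ε i j (k ℤ.⊖ N)))
           (≈-sym (gauss-sym N k (ℕ.≤-pred k<N)))) ⟩
    S i j 0 N ∎
    where
    open ≈-Reasoning
    flip : ∀ k → k ℕ.≤ N → (N ∸ k) ℤ.⊖ 0 ≡ ℤ.- (k ℤ.⊖ N)
    flip k k≤N = ≡.trans (ℤ.⊖-≥ z≤n) (≡.trans (≡.sym (ℤ.⊖-≥ k≤N)) (ℤ.⊖-swap N k))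

  finite : ∀ i j → i ℕ.+ j ≡ m → ∀ M N → A i M · A j N ≈ S i j M N
  finite i j e M N = extend i j N e (base i j e N) M

triple-product : ∀ ε i j .{{_ : NonZero (i ℕ.+ j)}} → ε ℤ.* ε ≡ 1ℤ →
  θ ε i j ≈ poch ε i (i ℕ.+ j) · poch ε j (i ℕ.+ j) · poch -1ℤ (i ℕ.+ j) (i ℕ.+ j)
triple-product ε i j ε² = ≈[]⇒≈ go
  where
  m : ℕ
  m = i ℕ.+ j
  open FiniteTripleProduct ε ε² m
  open GaussianBinomial m
  P : Series
  P = poch -1ℤ m m
  go : ∀ K → θ ε i j ≈[ K ] poch ε i m · poch ε j m · P
  go K = below-sym (begin
    poch ε i m · poch ε j m · P
      ≈⟨ ·-cong-below (·-cong-below (∏-below (poch-convergent ε i m) K≤N)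
        (∏-below (poch-convergent ε j m) K≤N)) below-refl ⟩
    A i N · A j N · P
      ≈⟨ ≈⇒≈[] K (≈-trans (·-congʳ (finite i j ≡.refl N N))
        (≈-trans (·-comm _ P) (Σ<-·ˡ (suc (N ℕ.+ N)) P _))) ⟩
    Σ< (suc (N ℕ.+ N)) (λ k → P · (term ε i j (k ℤ.⊖ N) · gauss (N ℕ.+ N) k))
      ≈⟨ Σ<-cong-below (suc (N ℕ.+ N)) (λ k k≤2N → limit k (ℕ.≤-pred k≤2N)) ⟩
    Σ< (N ℕ.+ N) (λ k → term ε i j (k ℤ.⊖ N)) ⊕ term ε i j ((N ℕ.+ N) ℤ.⊖ N)
      -- The finite identity has 2N + 1 terms, one more than `bisum N`; the extra one, at n = N,
      -- vanishes modulo q^K.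
      ≈⟨ ⊕-cong-below (≈⇒≈[] K (Σ<-bisum N (term ε i j)))
           (below-trans (≈⇒≈[] K (≡⇒≈ (cong (term ε i j) top))) (term-high ε i j (+ N) K<N)) ⟩
    bisum N (term ε i j) ⊕ 𝟘
      ≈⟨ ≈⇒≈[] K (⊕-idʳ _) ⟩
    bisum N (term ε i j)
      ≈⟨ θ-below ε i j K<N ⟨
    θ ε i j ∎)
    where
    open ≈[]-Reasoning K
    -- Terms with |k - N| > K vanish modulo q^K. For all others k and 2N - k are at least N - K, and
    -- N = 2K + 1 makes this at least K, so that `gauss-below` applies.
    N : ℕ
    N = suc (K ℕ.+ K)
    K<N : K ℕ.< N
    K<N = s≤s (ℕ.m≤m+n K K)
    K≤N : K ℕ.≤ N
    K≤N = ℕ.<⇒≤ K<N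
    top : (N ℕ.+ N) ℤ.⊖ N ≡ + N
    top = ≡.trans (ℤ.⊖-≥ (ℕ.m≤m+n N N)) (cong +_ (ℕ.m+n∸m≡n N N))
    limit : ∀ k → k ℕ.≤ N ℕ.+ N → P · (term ε i j (k ℤ.⊖ N) · gauss (N ℕ.+ N) k) ≈[ K ] term ε i j
      (k ℤ.⊖ N)
    limit k k≤2N with K ℕ.<? ∣ k ℤ.⊖ N ∣
    ... | yes far = below-trans
      (·-cong-below below-refl (·-cong-below (term-high ε i j (k ℤ.⊖ N) far) below-refl))
      (below-trans (≈⇒≈[] K (solve 2 (λ p g → p :* (con 0ℤ :* g) := con 0ℤ) ≈-refl P _))
        (below-sym (term-high ε i j (k ℤ.⊖ N) far)))
    ... | no near = below-trans
      (≈⇒≈[] K (solve 3 (λ p t g → p :* (t :* g) := t :* (p :* g)) ≈-refl P _ _))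
      (below-trans (·-cong-below below-refl
        (≡.subst (λ X → P · gauss X k ≈[ K ] 𝟙) (ℕ.m+[n∸m]≡n k≤2N)
          (gauss-below K≤k K≤2N∸k)))
        (≈⇒≈[] K (·-idʳ _)))
      where
      N∸k≤K : N ∸ k ℕ.≤ K
      N∸k≤K with ℕ.≤-total k N
      ... | inj₁ k≤N = ≡.subst (ℕ._≤ K) (ℤ.∣⊖∣-≤ k≤N) (ℕ.≮⇒≥ near)
      ... | inj₂ N≤k = ≡.subst (ℕ._≤ K) (≡.sym (ℕ.m≤n⇒m∸n≡0 N≤k)) z≤n
      k∸N≤K : k ∸ N ℕ.≤ K
      k∸N≤K with ℕ.≤-total k N
      ... | inj₁ k≤N = ≡.subst (ℕ._≤ K) (≡.sym (ℕ.m≤n⇒m∸n≡0 k≤N)) z≤n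
      ... | inj₂ N≤k = ≡.subst (ℕ._≤ K) (cong ∣_∣ (ℤ.⊖-≥ N≤k)) (ℕ.≮⇒≥ near)
      K≤k : K ℕ.≤ k
      K≤k = ℕ.+-cancelˡ-≤ K K k (ℕ.≤-trans (ℕ.n≤1+n _) (ℕ.≤-trans (ℕ.m≤n+m∸n N k)
        (ℕ.≤-trans (ℕ.+-monoʳ-≤ k N∸k≤K) (ℕ.≤-reflexive (ℕ.+-comm k K)))))
      K≤2N∸k : K ℕ.≤ N ℕ.+ N ∸ k
      K≤2N∸k = ℕ.m+n≤o⇒m≤o∸n K (ℕ.≤-trans
        (ℕ.+-monoʳ-≤ K (ℕ.≤-trans (ℕ.m≤n+m∸n k N) (ℕ.+-monoʳ-≤ N k∸N≤K)))
        (ℕ.≤-trans (ℕ.≤-reflexive (lemma K N)) (ℕ.+-monoʳ-≤ N (ℕ.n≤1+n _))))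
        where
        lemma : ∀ K N → K ℕ.+ (N ℕ.+ K) ≡ N ℕ.+ (K ℕ.+ K)
        lemma = ℕ-solve

-- The addition formula for theta functions, by rotating the lattice

bisum-cong-below : ∀ {K} L {F G} → (∀ n → ∣ n ∣ ℕ.≤ L → F n ≈[ K ] G n) → bisum L F ≈[ K ] bisum L G
bisum-cong-below zero    e = below-refl
bisum-cong-below (suc L) e = ⊕-cong-below (bisum-cong-below L λ n n≤L → e n (ℕ.m≤n⇒m≤1+n n≤L))
  (⊕-cong-below (e (+ L) (ℕ.n≤1+n L)) (e -[1+ L ] ℕ.≤-refl))

bisum-cong : ∀ L {F G} → (∀ n → F n ≈ G n) → bisum L F ≈ bisum L G
bisum-cong L e = ≈[]⇒≈ λ K → bisum-cong-below L λ n _ → ≈⇒≈[] K (e n)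

bisum-⊕ : ∀ L F G → bisum L (λ n → F n ⊕ G n) ≈ bisum L F ⊕ bisum L G
bisum-⊕ zero    F G = ≈-sym (⊕-idʳ 𝟘)
bisum-⊕ (suc L) F G = ≈-trans (⊕-cong (bisum-⊕ L F G) ≈-refl)
  (solve 6 (λ a b c d e f → (a :+ b) :+ ((c :+ d) :+ (e :+ f)) := (a :+ (c :+ e)) :+
    (b :+ (d :+ f))) ≈-refl
    (bisum L F) (bisum L G) _ _ _ _)

bisum-·ˡ : ∀ L c F → c · bisum L F ≈ bisum L (λ n → c · F n)
bisum-·ˡ zero    c F = ·-zeroʳ c
bisum-·ˡ (suc L) c F = ≈-trans
  (solve 4 (λ c a x y → c :* (a :+ (x :+ y)) := c :* a :+ (c :* x :+ c :* y)) ≈-refl c (bisum L F)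
    (F (+ L)) (F -[1+ L ]))
  (⊕-cong (bisum-·ˡ L c F) ≈-refl)

bisum-swap : ∀ L L′ (c : ℤ → ℤ → Series) →
  bisum L (λ m → bisum L′ (λ n → c m n)) ≈ bisum L′ (λ n → bisum L (λ m → c m n))
bisum-swap zero    L′ c = ≈-sym (zeros L′)
  where
  zeros : ∀ L → bisum L (λ _ → 𝟘) ≈ 𝟘
  zeros zero    = ≈-refl
  zeros (suc L) = ≈-trans (⊕-cong (zeros L) (⊕-idʳ 𝟘)) (⊕-idʳ 𝟘)
bisum-swap (suc L) L′ c = ≈-sym (≈-trans
  (bisum-⊕ L′ (λ n → bisum L (λ m → c m n)) (λ n → c (+ L) n ⊕ c -[1+ L ] n))
  (⊕-cong (≈-sym (bisum-swap L L′ c)) (bisum-⊕ L′ (c (+ L)) (c -[1+ L ]))))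

bisum-· : ∀ L L′ F G → bisum L F · bisum L′ G ≈ bisum L (λ m → bisum L′ (λ n → F m · G n))
bisum-· L L′ F G = ≈-trans (·-comm _ _) (≈-trans (bisum-·ˡ L (bisum L′ G) F)
  (bisum-cong L λ m → ≈-trans (·-comm _ _) (bisum-·ˡ L′ (F m) G)))

bisum-parity : ∀ L F → bisum (L ℕ.+ L) F ≈ bisum L (λ s → F (s ℤ.+ s)) ⊕ bisum L
  (λ s → F (ℤ.suc (s ℤ.+ s)))
bisum-parity zero    F = ≈-sym (⊕-idʳ 𝟘)
bisum-parity (suc L) F rewrite ℕ.+-suc L L = ≈-trans
  (⊕-cong (⊕-cong (bisum-parity L F) ≈-refl) ≈-refl)
  (solve 6 (λ a b c d e f → (a :+ b) :+ (c :+ d) :+ (e :+ f) := (a :+ (c :+ f)) :+ (b :+ (e :+ d)))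
    ≈-refl _ _ _ _ _ _)

Supported : ℕ → ℕ → (ℤ → Series) → Set
Supported K B F = ∀ n → B ℕ.< ∣ n ∣ → F n ≈[ K ] 𝟘

bisum-suc : ∀ L F → bisum L (λ n → F (ℤ.suc n)) ⊕ F (ℤ.- + L) ≈ bisum L F ⊕ F (+ L)
bisum-suc zero    F = ≈-refl
bisum-suc (suc L) F = ≈-trans
  (⊕-cong (⊕-cong ≈-refl (⊕-cong ≈-refl (≡⇒≈ (cong F (lemma L))))) ≈-refl)
  (≈-trans (solve 4 (λ a b c d → a :+ (b :+ c) :+ d := (a :+ c) :+ (b :+ d)) ≈-refl
      (bisum L (λ n → F (ℤ.suc n))) (F (+ suc L)) (F (ℤ.- + L)) (F -[1+ L ]))
    (≈-trans (⊕-cong (bisum-suc L F) ≈-refl)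
      (solve 4 (λ a b c d → (a :+ b) :+ (c :+ d) := a :+ (b :+ d) :+ c) ≈-refl
        (bisum L F) (F (+ L)) (F (+ suc L)) (F -[1+ L ]))))
  where
  lemma : ∀ L → ℤ.suc -[1+ L ] ≡ ℤ.- + L
  lemma zero    = ≡.refl
  lemma (suc L) = ≡.refl

bisum-suc-below : ∀ {K B L F} → Supported K B F → B ℕ.< L → bisum L (λ n → F (ℤ.suc n)) ≈[ K ] bisum
  L F
bisum-suc-below {K} {B} {L} {F} supp B<L = below-trans
  (below-sym (vanish (ℤ.- + L) (≡.sym (ℤ.∣-i∣≡∣i∣ (+ L)))))
  (below-trans (≈⇒≈[] K (bisum-suc L F)) (vanish (+ L) ≡.refl))
  where
  vanish : ∀ {S} n → L ≡ ∣ n ∣ → S ⊕ F n ≈[ K ] S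
  vanish n e = below-trans (⊕-cong-below below-refl (supp n (≡.subst (B ℕ.<_) e B<L)))
    (≈⇒≈[] K (⊕-idʳ _))

supported-shift : ∀ {K B F} a → Supported K B F → Supported K (B ℕ.+ ∣ a ∣) (λ n → F (a ℤ.+ n))
supported-shift {K} {B} {F} a supp n large = supp (a ℤ.+ n)
  (ℕ.+-cancelʳ-< ∣ a ∣ B _ (ℕ.<-≤-trans large
  (ℕ.≤-trans (ℕ.≤-reflexive (≡.trans (cong ∣_∣ (lemma a n)) (cong ∣_∣ (ℤ.+-comm _ (ℤ.- a)))))
    (ℕ.≤-trans (ℤ.∣i+j∣≤∣i∣+∣j∣ (ℤ.- a) (a ℤ.+ n)) (ℕ.≤-reflexive
      (≡.trans (ℕ.+-comm ∣ ℤ.- a ∣ _) (cong (∣ a ℤ.+ n ∣ ℕ.+_) (ℤ.∣-i∣≡∣i∣ a))))))))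
  where
  lemma : ∀ a n → n ≡ (a ℤ.+ n) ℤ.+ ℤ.- a
  lemma = ℤ-solve

-- A translation changes the sum only at the ends of the window, where the terms vanish modulo q^K
-- as long as the translated support stays inside.
bisum-shift : ∀ {K B L F} a → Supported K B F → B ℕ.+ ∣ a ∣ ℕ.< L → bisum L (λ n → F (a ℤ.+ n)) ≈[ K
  ] bisum L F
bisum-shift {K} {B} {L} {F} (+ zero) supp B<L = ≈⇒≈[] K
  (bisum-cong L λ n → ≡⇒≈ (cong F (ℤ.+-identityˡ n)))
bisum-shift {K} {B} {L} {F} (+ suc k) supp B<L = below-trans
  (≈⇒≈[] K (bisum-cong L λ n → ≡⇒≈ (cong F (lemma (+ k) n))))
  (below-trans (bisum-suc-below (supported-shift (+ k) supp) smaller)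
    (bisum-shift (+ k) supp smaller))
  where
  smaller : B ℕ.+ k ℕ.< L
  smaller = ℕ.≤-trans (s≤s (ℕ.+-monoʳ-≤ B (ℕ.n≤1+n k))) B<L
  lemma : ∀ k n → 1ℤ ℤ.+ k ℤ.+ n ≡ k ℤ.+ (1ℤ ℤ.+ n)
  lemma = ℤ-solve
bisum-shift {K} {B} {L} {F} -[1+ k ] supp B<L = below-trans
  (below-sym (bisum-suc-below (supported-shift -[1+ k ] supp) B<L)) (rec k B<L)
  where
  lemma : ∀ k n → k ℤ.+ (1ℤ ℤ.+ n) ≡ 1ℤ ℤ.+ k ℤ.+ n
  lemma = ℤ-solve
  rec : ∀ k → B ℕ.+ suc k ℕ.< L → bisum L (λ n → F (-[1+ k ] ℤ.+ ℤ.suc n)) ≈[ K ] bisum L F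
  rec zero    B<L = ≈⇒≈[] K (bisum-cong L λ n → ≡⇒≈
    (cong F (≡.trans (lemma -[1+ 0 ] n) (ℤ.+-identityˡ n))))
  rec (suc k) B<L = below-trans (≈⇒≈[] K (bisum-cong L λ n → ≡⇒≈ (cong F (lemma -[1+ suc k ] n))))
    (bisum-shift -[1+ k ] supp (ℕ.≤-trans (s≤s (ℕ.+-monoʳ-≤ B (ℕ.n≤1+n (suc k)))) B<L))

-- Splitting ℤ² according to the parity of m - n:  m = r + s or r + s + 1, n = r - s
bisum-rotate : ∀ {K} F G → Supported K K F → Supported K K G →
  let M = 2 ℕ.+ (K ℕ.+ K) ; L = suc (K ℕ.+ M) in
  bisum (M ℕ.+ M) F · bisum L G ≈[ K ]
    bisum M (λ s → bisum L (λ r → F (r ℤ.+ s) · G (r ℤ.- s)))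
    ⊕ bisum M (λ s → bisum L (λ r → F (ℤ.suc (r ℤ.+ s)) · G (r ℤ.- s)))
bisum-rotate {K} F G suppF suppG = begin
  bisum (M ℕ.+ M) F · bisum L G
    ≈⟨ ≈⇒≈[] K (≈-trans (·-comm _ _) (bisum-·ˡ-swap)) ⟩
  bisum L (λ n → bisum (M ℕ.+ M) F · G n)
    ≈⟨ bisum-cong-below L (λ n n≤L → ·-cong-below (below-sym (bisum-shift n suppF (bound n n≤L)))
      below-refl) ⟩
  bisum L (λ n → bisum (M ℕ.+ M) (λ t → F (n ℤ.+ t)) · G n)
    ≈⟨ ≈⇒≈[] K (bisum-cong L λ n → split n) ⟩
  bisum L (λ n → bisum M (λ s → F (n ℤ.+ (s ℤ.+ s)) · G n) ⊕ bisum M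
    (λ s → F (n ℤ.+ ℤ.suc (s ℤ.+ s)) · G n))
    ≈⟨ ≈⇒≈[] K (≈-trans (bisum-⊕ L _ _) (⊕-cong (bisum-swap L M _) (bisum-swap L M _))) ⟩
  bisum M (λ s → bisum L (λ n → F (n ℤ.+ (s ℤ.+ s)) · G n))
    ⊕ bisum M (λ s → bisum L (λ n → F (n ℤ.+ ℤ.suc (s ℤ.+ s)) · G n))
    ≈⟨ ⊕-cong-below
        (bisum-cong-below M λ s s≤M → recentre s s≤M (λ n → n ℤ.+ (s ℤ.+ s)) (λ r → r ℤ.+ s)
          (λ r → lemma₀ r s))
        (bisum-cong-below M λ s s≤M → recentre s s≤M (λ n → n ℤ.+ ℤ.suc (s ℤ.+ s))
          (λ r → ℤ.suc (r ℤ.+ s)) (λ r → lemma₁ r s)) ⟩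
  bisum M (λ s → bisum L (λ r → F (r ℤ.+ s) · G (r ℤ.- s)))
    ⊕ bisum M (λ s → bisum L (λ r → F (ℤ.suc (r ℤ.+ s)) · G (r ℤ.- s))) ∎
  where
  open ≈[]-Reasoning K
  -- Two translations constrain the windows: moving the sum of F by n with |n| ≤ L needs K + L < 2M,
  -- and moving the sum over n by s with |s| ≤ M needs K + M < L. These are the least such M and L.
  M L : ℕ
  M = 2 ℕ.+ (K ℕ.+ K)
  L = suc (K ℕ.+ M)
  bisum-·ˡ-swap : bisum L G · bisum (M ℕ.+ M) F ≈ bisum L (λ n → bisum (M ℕ.+ M) F · G n)
  bisum-·ˡ-swap = ≈-trans (·-comm _ _) (bisum-·ˡ L _ G)
  bound : ∀ n → ∣ n ∣ ℕ.≤ L → K ℕ.+ ∣ n ∣ ℕ.< M ℕ.+ M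
  bound n n≤L = ℕ.≤-trans (s≤s (ℕ.+-monoʳ-≤ K n≤L)) (ℕ.≤-reflexive (lemma K))
    where
    lemma : ∀ K → suc (K ℕ.+ suc (K ℕ.+ (2 ℕ.+ (K ℕ.+ K)))) ≡ 2 ℕ.+ (K ℕ.+ K) ℕ.+ (2 ℕ.+ (K ℕ.+ K))
    lemma = ℕ-solve
  split : ∀ n → bisum (M ℕ.+ M) (λ t → F (n ℤ.+ t)) · G n
    ≈ bisum M (λ s → F (n ℤ.+ (s ℤ.+ s)) · G n) ⊕ bisum M (λ s → F (n ℤ.+ ℤ.suc (s ℤ.+ s)) · G n)
  split n = ≈-trans (·-congʳ (bisum-parity M (λ t → F (n ℤ.+ t))))
    (≈-trans (·-distribʳ (G n) _ _) (⊕-cong (right _) (right _)))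
    where
    right : ∀ H → bisum M H · G n ≈ bisum M (λ s → H s · G n)
    right H = ≈-trans (·-comm _ _) (≈-trans (bisum-·ˡ M (G n) H) (bisum-cong M λ s → ·-comm _ _))
  recentre : ∀ s → ∣ s ∣ ℕ.≤ M → ∀ (h h′ : ℤ → ℤ) → (∀ r → h (ℤ.- s ℤ.+ r) ≡ h′ r) →
    bisum L (λ n → F (h n) · G n) ≈[ K ] bisum L (λ r → F (h′ r) · G (r ℤ.- s))
  recentre s s≤M h h′ e = below-trans
    (below-sym (bisum-shift (ℤ.- s) supp
      (s≤s (ℕ.+-monoʳ-≤ K (≡.subst (ℕ._≤ M) (≡.sym (ℤ.∣-i∣≡∣i∣ s)) s≤M)))))
    (≈⇒≈[] K (bisum-cong L λ r → ≡⇒≈ (cong₂ (λ x y → F x · G y) (e r) (ℤ.+-comm (ℤ.- s) r))))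
    where
    supp : Supported K K (λ n → F (h n) · G n)
    supp n K<n = below-trans (·-cong-below below-refl (suppG n K<n)) (≈⇒≈[] K (·-zeroʳ _))
  lemma₀ : ∀ r s → ℤ.- s ℤ.+ r ℤ.+ (s ℤ.+ s) ≡ r ℤ.+ s
  lemma₀ = ℤ-solve
  lemma₁ : ∀ r s → ℤ.- s ℤ.+ r ℤ.+ (1ℤ ℤ.+ (s ℤ.+ s)) ≡ 1ℤ ℤ.+ (r ℤ.+ s)
  lemma₁ = ℤ-solve

-- As ε is its own inverse, ε^|n| is the integer power ε^n and inherits its exponent law.
sign-+ : ∀ {ε} → ε ℤ.* ε ≡ 1ℤ → ∀ m n → ε ℤ.^ ∣ m ℤ.+ n ∣ ≡ ε ℤ.^ ∣ m ∣ ℤ.* ε ℤ.^ ∣ n ∣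
sign-+ {ε} ε² m n = ℤ-induction (λ m → ε ℤ.^ ∣ m ℤ.+ n ∣ ≡ ε ℤ.^ ∣ m ∣ ℤ.* ε ℤ.^ ∣ n ∣)
  (≡.trans (cong (λ x → ε ℤ.^ ∣ x ∣) (ℤ.+-identityˡ n)) (≡.sym (ℤ.*-identityˡ _)))
  (λ m e → ≡.trans (up m) (≡.trans (cong (ℤ._*_ ε) e) (≡.sym (up′ m))))
  (λ m e → cancel (≡.trans (≡.sym (up m)) (≡.trans e (up′ m))))
  m
  where
  cancel : ∀ {x y} → ε ℤ.* x ≡ ε ℤ.* y → x ≡ y
  cancel {x} {y} e = ≡.trans (≡.sym (simplify x)) (≡.trans (cong (ℤ._*_ ε) e) (simplify y))
    where
    simplify : ∀ x → ε ℤ.* (ε ℤ.* x) ≡ x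
    simplify x = ≡.trans (≡.sym (ℤ.*-assoc ε ε x)) (≡.trans (cong (ℤ._* x) ε²) (ℤ.*-identityˡ x))
  up : ∀ m → ε ℤ.^ ∣ ℤ.suc m ℤ.+ n ∣ ≡ ε ℤ.* ε ℤ.^ ∣ m ℤ.+ n ∣
  up m = ≡.trans (cong (λ x → ε ℤ.^ ∣ x ∣) (ℤ.+-assoc 1ℤ m n)) (sign-suc ε² (m ℤ.+ n))
  up′ : ∀ m → ε ℤ.^ ∣ ℤ.suc m ∣ ℤ.* ε ℤ.^ ∣ n ∣ ≡ ε ℤ.* (ε ℤ.^ ∣ m ∣ ℤ.* ε ℤ.^ ∣ n ∣)
  up′ m = ≡.trans (cong (λ x → x ℤ.* ε ℤ.^ ∣ n ∣) (sign-suc ε² m)) (ℤ.*-assoc ε _ _)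

^-distrib-* : ∀ c d n → (c ℤ.* d) ℤ.^ n ≡ c ℤ.^ n ℤ.* d ℤ.^ n
^-distrib-* c d zero    = ≡.refl
^-distrib-* c d (suc n) = ≡.trans (cong (ℤ._*_ (c ℤ.* d)) (^-distrib-* c d n))
  (lemma c d (c ℤ.^ n) (d ℤ.^ n))
  where
  lemma : ∀ a b x y → a ℤ.* b ℤ.* (x ℤ.* y) ≡ a ℤ.* x ℤ.* (b ℤ.* y)
  lemma = ℤ-solve

module _ {ε δ : ℤ} (ε² : ε ℤ.* ε ≡ 1ℤ) (δ² : δ ℤ.* δ ≡ 1ℤ) where

  rotate-sign : ∀ r s → ε ℤ.^ ∣ r ℤ.+ s ∣ ℤ.* δ ℤ.^ ∣ r ℤ.- s ∣ ≡ (ε ℤ.* δ) ℤ.^ ∣ r ∣ ℤ.* (ε ℤ.* δ)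
    ℤ.^ ∣ s ∣
  rotate-sign r s = ≡.trans (cong₂ ℤ._*_ (sign-+ ε² r s)
      (≡.trans (sign-+ δ² r (ℤ.- s)) (cong (λ x → δ ℤ.^ ∣ r ∣ ℤ.* δ ℤ.^ x) (ℤ.∣-i∣≡∣i∣ s))))
    (≡.trans (lemma (ε ℤ.^ ∣ r ∣) (ε ℤ.^ ∣ s ∣) (δ ℤ.^ ∣ r ∣) (δ ℤ.^ ∣ s ∣))
      (≡.sym (cong₂ ℤ._*_ (^-distrib-* ε δ ∣ r ∣) (^-distrib-* ε δ ∣ s ∣))))
    where
    lemma : ∀ a b c d → a ℤ.* b ℤ.* (c ℤ.* d) ≡ a ℤ.* c ℤ.* (b ℤ.* d)
    lemma = ℤ-solve

  module _ (i e g : ℕ) where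

    -- The parameters stand for a = q^i, b = q^(i+e+g), c = q^(i+g) and d = q^(i+e), up to signs.
    -- The condition ab = cd is thus built in, and b/c = q^e, b/d = q^g involve no subtraction. The
    -- rotated exponent is a quadratic form without an rs term, so r and s separate.
    rotate-even : ∀ r s → term ε i (i ℕ.+ e ℕ.+ g) (r ℤ.+ s) · term δ (i ℕ.+ g) (i ℕ.+ e) (r ℤ.- s)
      ≈ term (ε ℤ.* δ) (i ℕ.+ i ℕ.+ e) (i ℕ.+ i ℕ.+ e ℕ.+ g ℕ.+ g) s
        · term (ε ℤ.* δ) (i ℕ.+ i ℕ.+ g) (i ℕ.+ i ℕ.+ e ℕ.+ e ℕ.+ g) r
    rotate-even r s = ≈-trans (const-q↑-· _ _ _ _) (≈-trans
      (·-cong (≡⇒≈ (cong const (≡.trans (rotate-sign r s) (ℤ.*-comm ((ε ℤ.* δ) ℤ.^ ∣ r ∣) _))))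
        (q↑-cong (ℤ.+-injective (double-injective exponents))))
      (≈-sym (const-q↑-· _ _ _ _)))
      where
      E₁ E₂ E₃ E₄ : ℕ
      E₁ = expo i (i ℕ.+ e ℕ.+ g) (r ℤ.+ s)
      E₂ = expo (i ℕ.+ g) (i ℕ.+ e) (r ℤ.- s)
      E₃ = expo (i ℕ.+ i ℕ.+ e) (i ℕ.+ i ℕ.+ e ℕ.+ g ℕ.+ g) s
      E₄ = expo (i ℕ.+ i ℕ.+ g) (i ℕ.+ i ℕ.+ e ℕ.+ e ℕ.+ g) r
      exponents : + (E₁ ℕ.+ E₂) ℤ.+ + (E₁ ℕ.+ E₂) ≡ + (E₃ ℕ.+ E₄) ℤ.+ + (E₃ ℕ.+ E₄)
      exponents = ≡.trans (medial (+ E₁) (+ E₂)) (≡.trans (cong₂ ℤ._+_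
          (expo-double i (i ℕ.+ e ℕ.+ g) (r ℤ.+ s)) (expo-double (i ℕ.+ g) (i ℕ.+ e) (r ℤ.- s)))
        (≡.trans (quadratic (+ i) (+ e) (+ g) r s) (≡.trans (≡.sym (cong₂ ℤ._+_
          (expo-double (i ℕ.+ i ℕ.+ e) (i ℕ.+ i ℕ.+ e ℕ.+ g ℕ.+ g) s)
            (expo-double (i ℕ.+ i ℕ.+ g) (i ℕ.+ i ℕ.+ e ℕ.+ e ℕ.+ g) r)))
          (≡.sym (medial (+ E₃) (+ E₄))))))
        where
        medial : ∀ a b → a ℤ.+ b ℤ.+ (a ℤ.+ b) ≡ a ℤ.+ a ℤ.+ (b ℤ.+ b)
        medial = ℤ-solve
        quadratic : ∀ i e g r s →
          i ℤ.* ((r ℤ.+ s) ℤ.* (1ℤ ℤ.+ (r ℤ.+ s))) ℤ.+ (i ℤ.+ e ℤ.+ g) ℤ.*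
            ((r ℤ.+ s) ℤ.* ((r ℤ.+ s) ℤ.- 1ℤ))
            ℤ.+ ((i ℤ.+ g) ℤ.* ((r ℤ.- s) ℤ.* (1ℤ ℤ.+ (r ℤ.- s))) ℤ.+ (i ℤ.+ e) ℤ.*
              ((r ℤ.- s) ℤ.* ((r ℤ.- s) ℤ.- 1ℤ)))
          ≡ (i ℤ.+ i ℤ.+ e) ℤ.* (s ℤ.* (1ℤ ℤ.+ s)) ℤ.+ (i ℤ.+ i ℤ.+ e ℤ.+ g ℤ.+ g) ℤ.*
            (s ℤ.* (s ℤ.- 1ℤ))
            ℤ.+ ((i ℤ.+ i ℤ.+ g) ℤ.* (r ℤ.* (1ℤ ℤ.+ r)) ℤ.+ (i ℤ.+ i ℤ.+ e ℤ.+ e ℤ.+ g) ℤ.*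
              (r ℤ.* (r ℤ.- 1ℤ)))
        quadratic = ℤ-solve

    rotate-odd : ∀ r s → term ε i (i ℕ.+ e ℕ.+ g) (ℤ.suc (r ℤ.+ s)) · term δ (i ℕ.+ g) (i ℕ.+ e)
      (r ℤ.- s)
      ≈ const ε · q↑ i · (term (ε ℤ.* δ) (i ℕ.+ i ℕ.+ i ℕ.+ i ℕ.+ e ℕ.+ e ℕ.+ g) g s
        · term (ε ℤ.* δ) (i ℕ.+ i ℕ.+ i ℕ.+ i ℕ.+ e ℕ.+ g ℕ.+ g) e r)
    rotate-odd r s = ≈-trans (const-q↑-· _ _ _ _) (≈-trans
      (·-cong (≡⇒≈ (cong const (≡.trans (cong (ℤ._* δ ℤ.^ ∣ r ℤ.- s ∣) (sign-suc ε² (r ℤ.+ s)))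
          (≡.trans (ℤ.*-assoc ε _ _)
            (cong (ℤ._*_ ε) (≡.trans (rotate-sign r s) (ℤ.*-comm ((ε ℤ.* δ) ℤ.^ ∣ r ∣) _)))))))
        (q↑-cong (ℤ.+-injective (double-injective exponents))))
      (≈-trans (≈-sym (const-q↑-· _ _ _ _)) (·-congˡ (≈-sym (const-q↑-· _ _ _ _)))))
      where
      E₁ E₂ E₃ E₄ : ℕ
      E₁ = expo i (i ℕ.+ e ℕ.+ g) (ℤ.suc (r ℤ.+ s))
      E₂ = expo (i ℕ.+ g) (i ℕ.+ e) (r ℤ.- s)
      E₃ = expo (i ℕ.+ i ℕ.+ i ℕ.+ i ℕ.+ e ℕ.+ e ℕ.+ g) g s
      E₄ = expo (i ℕ.+ i ℕ.+ i ℕ.+ i ℕ.+ e ℕ.+ g ℕ.+ g) e r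
      exponents : + (E₁ ℕ.+ E₂) ℤ.+ + (E₁ ℕ.+ E₂) ≡ + (i ℕ.+ (E₃ ℕ.+ E₄)) ℤ.+ + (i ℕ.+ (E₃ ℕ.+ E₄))
      exponents = ≡.trans (medial (+ E₁) (+ E₂)) (≡.trans (cong₂ ℤ._+_
          (expo-double i (i ℕ.+ e ℕ.+ g) (ℤ.suc (r ℤ.+ s)))
            (expo-double (i ℕ.+ g) (i ℕ.+ e) (r ℤ.- s)))
        (≡.trans (quadratic (+ i) (+ e) (+ g) r s)
          (≡.trans (≡.sym (cong (ℤ._+_ (+ i ℤ.+ + i)) (cong₂ ℤ._+_
          (expo-double (i ℕ.+ i ℕ.+ i ℕ.+ i ℕ.+ e ℕ.+ e ℕ.+ g) g s)
            (expo-double (i ℕ.+ i ℕ.+ i ℕ.+ i ℕ.+ e ℕ.+ g ℕ.+ g) e r))))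
          (≡.sym (medial₃ (+ i) (+ E₃) (+ E₄))))))
        where
        medial : ∀ a b → a ℤ.+ b ℤ.+ (a ℤ.+ b) ≡ a ℤ.+ a ℤ.+ (b ℤ.+ b)
        medial = ℤ-solve
        medial₃ : ∀ i a b → i ℤ.+ (a ℤ.+ b) ℤ.+ (i ℤ.+ (a ℤ.+ b)) ≡ i ℤ.+ i ℤ.+
          (a ℤ.+ a ℤ.+ (b ℤ.+ b))
        medial₃ = ℤ-solve
        quadratic : ∀ i e g r s →
          i ℤ.* ((1ℤ ℤ.+ (r ℤ.+ s)) ℤ.* (1ℤ ℤ.+ (1ℤ ℤ.+ (r ℤ.+ s)))) ℤ.+ (i ℤ.+ e ℤ.+ g) ℤ.*
            ((1ℤ ℤ.+ (r ℤ.+ s)) ℤ.* ((1ℤ ℤ.+ (r ℤ.+ s)) ℤ.- 1ℤ))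
            ℤ.+ ((i ℤ.+ g) ℤ.* ((r ℤ.- s) ℤ.* (1ℤ ℤ.+ (r ℤ.- s))) ℤ.+ (i ℤ.+ e) ℤ.*
              ((r ℤ.- s) ℤ.* ((r ℤ.- s) ℤ.- 1ℤ)))
          ≡ i ℤ.+ i ℤ.+ ((i ℤ.+ i ℤ.+ i ℤ.+ i ℤ.+ e ℤ.+ e ℤ.+ g) ℤ.* (s ℤ.* (1ℤ ℤ.+ s)) ℤ.+ g ℤ.*
            (s ℤ.* (s ℤ.- 1ℤ))
            ℤ.+ ((i ℤ.+ i ℤ.+ i ℤ.+ i ℤ.+ e ℤ.+ g ℤ.+ g) ℤ.* (r ℤ.* (1ℤ ℤ.+ r)) ℤ.+ e ℤ.*
              (r ℤ.* (r ℤ.- 1ℤ))))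
        quadratic = ℤ-solve

-- f(a,b) f(c,d) = f(ac,bd) f(ad,bc) + a f(b/c, ac²d) f(b/d, acd²) for ab = cd
θ-addition : ∀ {ε δ} → ε ℤ.* ε ≡ 1ℤ → δ ℤ.* δ ≡ 1ℤ → ∀ i e g .{{_ : NonZero i}} →
  θ ε i (i ℕ.+ e ℕ.+ g) · θ δ (i ℕ.+ g) (i ℕ.+ e)
    ≈ θ (ε ℤ.* δ) (i ℕ.+ i ℕ.+ e) (i ℕ.+ i ℕ.+ e ℕ.+ g ℕ.+ g)
        · θ (ε ℤ.* δ) (i ℕ.+ i ℕ.+ g) (i ℕ.+ i ℕ.+ e ℕ.+ e ℕ.+ g)
      ⊕ const ε · q↑ i · (θ (ε ℤ.* δ) (i ℕ.+ i ℕ.+ i ℕ.+ i ℕ.+ e ℕ.+ e ℕ.+ g) g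
        · θ (ε ℤ.* δ) (i ℕ.+ i ℕ.+ i ℕ.+ i ℕ.+ e ℕ.+ g ℕ.+ g) e)
θ-addition {ε} {δ} ε² δ² i@(suc _) e g = ≈[]⇒≈ λ K → let
    open ≈[]-Reasoning K
    M = 2 ℕ.+ (K ℕ.+ K)
    L = suc (K ℕ.+ M)
    K<M : K ℕ.< M
    K<M = s≤s (ℕ.m≤n⇒m≤1+n (ℕ.m≤m+n K K))
    K<2M : K ℕ.< M ℕ.+ M
    K<2M = ℕ.≤-trans K<M (ℕ.m≤m+n M M)
    K<L : K ℕ.< L
    K<L = s≤s (ℕ.m≤m+n K M)
    in begin
  θ ε i (i ℕ.+ e ℕ.+ g) · θ δ (i ℕ.+ g) (i ℕ.+ e)
    ≈⟨ ·-cong-below (θ-below ε i (i ℕ.+ e ℕ.+ g) K<2M) (θ-below δ (i ℕ.+ g) (i ℕ.+ e) K<L) ⟩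
  bisum (M ℕ.+ M) (term ε i (i ℕ.+ e ℕ.+ g)) · bisum L (term δ (i ℕ.+ g) (i ℕ.+ e))
    ≈⟨ bisum-rotate _ _ (term-high ε i (i ℕ.+ e ℕ.+ g)) (term-high δ (i ℕ.+ g) (i ℕ.+ e)) ⟩
  bisum M (λ s → bisum L (λ r → term ε i (i ℕ.+ e ℕ.+ g) (r ℤ.+ s) · term δ (i ℕ.+ g) (i ℕ.+ e)
    (r ℤ.- s)))
    ⊕ bisum M (λ s → bisum L (λ r → term ε i (i ℕ.+ e ℕ.+ g) (ℤ.suc (r ℤ.+ s)) · term δ (i ℕ.+ g)
      (i ℕ.+ e) (r ℤ.- s)))
    ≈⟨ ≈⇒≈[] K (⊕-cong
        (≈-trans (bisum-cong M λ s → bisum-cong L λ r → rotate-even ε² δ² i e g r s)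
          (≈-sym (bisum-· M L _ _)))
        (≈-trans (bisum-cong M λ s → ≈-trans (bisum-cong L λ r → rotate-odd ε² δ² i e g r s)
          (≈-sym (bisum-·ˡ L _ _)))
          (≈-trans (≈-sym (bisum-·ˡ M _ _)) (·-congˡ (≈-sym (bisum-· M L _ _)))))) ⟩
  bisum M (term (ε ℤ.* δ) (i ℕ.+ i ℕ.+ e) (i ℕ.+ i ℕ.+ e ℕ.+ g ℕ.+ g))
      · bisum L (term (ε ℤ.* δ) (i ℕ.+ i ℕ.+ g) (i ℕ.+ i ℕ.+ e ℕ.+ e ℕ.+ g))
    ⊕ const ε · q↑ i · (bisum M (term (ε ℤ.* δ) (i ℕ.+ i ℕ.+ i ℕ.+ i ℕ.+ e ℕ.+ e ℕ.+ g) g)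
      · bisum L (term (ε ℤ.* δ) (i ℕ.+ i ℕ.+ i ℕ.+ i ℕ.+ e ℕ.+ g ℕ.+ g) e))
    ≈⟨ ⊕-cong-below
        (·-cong-below (θ-below (ε ℤ.* δ) (i ℕ.+ i ℕ.+ e) _ K<M)
          (θ-below (ε ℤ.* δ) (i ℕ.+ i ℕ.+ g) _ K<L))
        (·-cong-below below-refl (·-cong-below
          (θ-below (ε ℤ.* δ) (i ℕ.+ i ℕ.+ i ℕ.+ i ℕ.+ e ℕ.+ e ℕ.+ g) g K<M)
          (θ-below (ε ℤ.* δ) (i ℕ.+ i ℕ.+ i ℕ.+ i ℕ.+ e ℕ.+ g ℕ.+ g) e K<L))) ⟨
  θ (ε ℤ.* δ) (i ℕ.+ i ℕ.+ e) (i ℕ.+ i ℕ.+ e ℕ.+ g ℕ.+ g)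
      · θ (ε ℤ.* δ) (i ℕ.+ i ℕ.+ g) (i ℕ.+ i ℕ.+ e ℕ.+ e ℕ.+ g)
    ⊕ const ε · q↑ i · (θ (ε ℤ.* δ) (i ℕ.+ i ℕ.+ i ℕ.+ i ℕ.+ e ℕ.+ e ℕ.+ g) g
      · θ (ε ℤ.* δ) (i ℕ.+ i ℕ.+ i ℕ.+ i ℕ.+ e ℕ.+ g ℕ.+ g) e) ∎

-- Theta functions as eta products

∏-first : ∀ {F} → Convergent F → Convergent (λ k → F (suc k)) → ∏ F ≈ F 0 · ∏ (λ k → F (suc k))
∏-first {F} c c′ = ≈[]⇒≈ λ K → below-trans (∏-below c (ℕ.n≤1+n K))
  (below-trans (≈⇒≈[] K (≈-trans (prod-+ F 1 K) (·-congʳ (·-idˡ _))))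
    (·-cong-below below-refl (below-sym (∏-below c′ (ℕ.≤-refl {K})))))

-- The factor of index 0 is 1 + q^0 = 2. Squared, it becomes the 4 in the dissection of f₁⁴/f₂².
poch-0 : ∀ m .{{_ : NonZero m}} → poch 1ℤ 0 m ≈ const (+ 2) · poch 1ℤ m m
poch-0 m = ≈-trans (∏-first (poch-convergent 1ℤ 0 m) (poch-convergent 1ℤ m m))
  (·-congʳ (≈-trans (⊕-cong ≈-refl (·-congˡ q↑0))
    (solve 0 (con 1ℤ :+ con 1ℤ :* con 1ℤ := con (+ 2)) ≈-refl)))

plus-η₁ : poch 1ℤ 1 1 ≈ η (f₂ ÷ f₁)
plus-η₁ = η-quotient f₁ (f₂ ÷ f₁)
  (≈-trans (·-congˡ (≈-sym (η-single 0F))) (≈-trans (E-plus 1) (η-single 1F)))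

plus-η₂ : poch 1ℤ 2 2 ≈ η (f₄ ÷ f₂)
plus-η₂ = η-quotient f₂ (f₄ ÷ f₂)
  (≈-trans (·-congˡ (≈-sym (η-single 1F))) (≈-trans (E-plus 2) (η-single 3F)))

plus-η₃ : poch 1ℤ 3 3 ≈ η (f₆ ÷ f₃)
plus-η₃ = η-quotient f₃ (f₆ ÷ f₃)
  (≈-trans (·-congˡ (≈-sym (η-single 2F))) (≈-trans (E-plus 3) (η-single 4F)))

plus-η₆ : poch 1ℤ 6 6 ≈ η (f₁₂ ÷ f₆)
plus-η₆ = η-quotient f₆ (f₁₂ ÷ f₆)
  (≈-trans (·-congˡ (≈-sym (η-single 4F))) (≈-trans (E-plus 6) (η-single 6F)))

η-·₃ : ∀ {f g h} u v w → f ≈ η u → g ≈ η v → h ≈ η w → f · g · h ≈ η (u ∙ v ∙ w)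
η-·₃ u v w e e′ e″ = ≈-trans (·-cong (≈-trans (·-cong e e′) (η-· u v)) e″) (η-· (u ∙ v) w)

θ₋-1-1 : θ -1ℤ 1 1 ≈ η (f₁ ^^ 2 ÷ f₂)
θ₋-1-1 = ≈-trans (triple-product -1ℤ 1 1 ≡.refl)
  (η-·₃ (f₁ ÷ f₂) (f₁ ÷ f₂) f₂ O₋-η₁ O₋-η₁ (η-single 1F))

θ₊-1-1 : θ 1ℤ 1 1 ≈ η (f₂ ^^ 5 ÷ (f₁ ^^ 2 ∙ f₄ ^^ 2))
θ₊-1-1 = ≈-trans (triple-product 1ℤ 1 1 ≡.refl)
  (η-·₃ (f₂ ^^ 2 ÷ (f₁ ∙ f₄)) (f₂ ^^ 2 ÷ (f₁ ∙ f₄)) f₂ O₊-η₁ O₊-η₁ (η-single 1F))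

θ₊-2-0 : θ 1ℤ 2 0 ≈ const (+ 2) · η (f₄ ^^ 2 ÷ f₂)
θ₊-2-0 = ≈-trans (triple-product 1ℤ 2 0 ≡.refl) (≈-trans (·-congʳ (·-congˡ (poch-0 2)))
  (≈-trans (solve 3 (λ a b c → a :* (c :* a) :* b := c :* (a :* a :* b)) ≈-refl _ _ _)
    (·-congˡ (η-·₃ (f₄ ÷ f₂) (f₄ ÷ f₂) f₂ plus-η₂ plus-η₂ (η-single 1F)))))

-- The residues 1 and 5 modulo 6 become all odd exponents once the residue 3 is added.
θ-mod-6 : ∀ ε → poch ε 1 6 · poch ε 5 6 · E 6 · O ε 3 ≈ O ε 1 · E 6
θ-mod-6 ε = ≈-trans (solve 4 (λ a b c d → a :* b :* c :* d := a :* d :* b :* c) ≈-refl _ _ _ _)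
  (·-congʳ (≈-sym (poch-split₃ ε 1 2)))

θ₋-1-5 : θ -1ℤ 1 5 ≈ η (f₁ ∙ f₆ ^^ 2 ÷ (f₂ ∙ f₃))
θ₋-1-5 = ≈-trans (triple-product -1ℤ 1 5 ≡.refl) (η-quotient (f₃ ÷ f₆) (f₁ ∙ f₆ ^^ 2 ÷ (f₂ ∙ f₃))
  (≈-trans (·-congˡ (≈-sym O₋-η₃)) (≈-trans (θ-mod-6 -1ℤ)
    (≈-trans (·-cong O₋-η₁ (η-single 4F)) (η-· (f₁ ÷ f₂) f₆)))))

θ₊-1-5 : θ 1ℤ 1 5 ≈ η (f₂ ^^ 2 ∙ f₃ ∙ f₁₂ ÷ (f₁ ∙ f₄ ∙ f₆))
θ₊-1-5 = ≈-trans (triple-product 1ℤ 1 5 ≡.refl)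
  (η-quotient (f₆ ^^ 2 ÷ (f₃ ∙ f₁₂)) (f₂ ^^ 2 ∙ f₃ ∙ f₁₂ ÷ (f₁ ∙ f₄ ∙ f₆))
  (≈-trans (·-congˡ (≈-sym O₊-η₃)) (≈-trans (θ-mod-6 1ℤ)
    (≈-trans (·-cong O₊-η₁ (η-single 4F)) (η-· (f₂ ^^ 2 ÷ (f₁ ∙ f₄)) f₆)))))

θ-5-1 : ∀ ε → ε ℤ.* ε ≡ 1ℤ → θ ε 5 1 ≈ θ ε 1 5
θ-5-1 ε ε² = ≈-trans (triple-product ε 5 1 ε²)
  (≈-trans (·-congʳ (·-comm _ _)) (≈-sym (triple-product ε 1 5 ε²)))

θ₋-3-3 : θ -1ℤ 3 3 ≈ η (f₃ ^^ 2 ÷ f₆)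
θ₋-3-3 = ≈-trans (triple-product -1ℤ 3 3 ≡.refl)
  (η-·₃ (f₃ ÷ f₆) (f₃ ÷ f₆) f₆ O₋-η₃ O₋-η₃ (η-single 4F))

θ₊-1-2 : θ 1ℤ 1 2 ≈ η (f₂ ∙ f₃ ^^ 2 ÷ (f₁ ∙ f₆))
θ₊-1-2 = ≈-trans (triple-product 1ℤ 1 2 ≡.refl) (η-quotient (f₆ ÷ f₃) (f₂ ∙ f₃ ^^ 2 ÷ (f₁ ∙ f₆))
  (≈-trans (·-congˡ (≈-sym plus-η₃))
    (≈-trans (solve 4 (λ a b c d → a :* b :* c :* d := a :* b :* d :* c) ≈-refl _ _ _ _)
      (≈-trans (·-cong (≈-trans (≈-sym (poch-split₃ 1ℤ 1 1)) plus-η₁) (η-single 2F))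
        (η-· (f₂ ÷ f₁) f₃)))))

-- Euler's pentagonal number theorem with q² for q: the residues 2, 4 and 0 modulo 6 make up all
-- even exponents.
θ₋-2-4 : θ -1ℤ 2 4 ≈ η f₂
θ₋-2-4 = ≈-trans (triple-product -1ℤ 2 4 ≡.refl)
  (≈-trans (≈-sym (poch-split₃ -1ℤ 2 2)) (η-single 1F))

-- Proved on the product side, where q ↦ q² merely doubles the parameters of each Pochhammer symbol.
θ-²q : ∀ ε i j .{{_ : NonZero (i ℕ.+ j)}} .{{_ : NonZero (i ℕ.+ i ℕ.+ (j ℕ.+ j))}} → ε ℤ.* ε ≡ 1ℤ →
  θ ε (i ℕ.+ i) (j ℕ.+ j) ≈ (θ ε i j) ²q
θ-²q ε i j ε² = ≈-sym (≈-trans (²q-cong (triple-product ε i j ε²)) (≈-trans (²q-· _ _)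
  (≈-trans (·-congʳ (²q-· _ _))
  (≈-trans (·-cong (·-cong (poch-²q ε i (i ℕ.+ j)) (poch-²q ε j (i ℕ.+ j)))
    (poch-²q -1ℤ (i ℕ.+ j) (i ℕ.+ j)))
  (≈-trans (≡⇒≈ (cong (λ m → poch ε (i ℕ.+ i) m · poch ε (j ℕ.+ j) m · poch -1ℤ m m) (lemma i j)))
    (≈-sym (triple-product ε (i ℕ.+ i) (j ℕ.+ j) ε²)))))))
  where
  lemma : ∀ i j → i ℕ.+ j ℕ.+ (i ℕ.+ j) ≡ i ℕ.+ i ℕ.+ (j ℕ.+ j)
  lemma = ℕ-solve

θ₊-2-4 : θ 1ℤ 2 4 ≈ η (f₄ ∙ f₆ ^^ 2 ÷ (f₂ ∙ f₁₂)) 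
θ₊-2-4 = ≈-trans (θ-²q 1ℤ 1 2 ≡.refl) (≈-trans (²q-cong θ₊-1-2) η-²q)

-- 2-dissections f(q) = α(q²) + q β(q²)

record Dissects (f α β : Series) : Set where
  constructor dissection
  field eq : f ≈ α ²q ⊕ q↑ 1 · β ²q
open Dissects

suc-q↑1 : ∀ f n → (q↑ 1 · f) (suc n) ≡ f n
suc-q↑1 f n = ≡.trans (q↑-·-suc 0 f n) (≈-trans (·-congʳ q↑0) (·-idˡ f) .at n)

dissects-even : ∀ {f α β} → Dissects f α β → ∀ n → f (2 ℕ.* n) ≡ α n
dissects-even {f} {α} {β} d n = ≡.trans (d .eq .at (2 ℕ.* n)) (≡.trans (⊕-def _ _ (2 ℕ.* n))
  (≡.trans (cong₂ ℤ._+_ (²q-even α n) (vanish n)) (ℤ.+-identityʳ (α n))))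
  where
  vanish : ∀ n → (q↑ 1 · β ²q) (2 ℕ.* n) ≡ 0ℤ
  vanish zero    = q↑-·-zero 0 _
  vanish (suc n) = ≡.trans (suc-q↑1 (β ²q) _)
    (≡.trans (cong (β ²q) (ℕ.+-suc n (n ℕ.+ 0))) (²q-odd β n))

dissects-odd : ∀ {f α β} → Dissects f α β → ∀ n → f (suc (2 ℕ.* n)) ≡ β n
dissects-odd {f} {α} {β} d n = ≡.trans (d .eq .at (suc (2 ℕ.* n)))
  (≡.trans (⊕-def _ _ (suc (2 ℕ.* n)))
  (≡.trans (cong₂ ℤ._+_ (²q-odd α n) (≡.trans (suc-q↑1 (β ²q) (2 ℕ.* n)) (²q-even β n)))
    (ℤ.+-identityˡ (β n))))

dissects-cong : ∀ {f f′ α α′ β β′} → f ≈ f′ → α ≈ α′ → β ≈ β′ → Dissects f α β → Dissects f′ α′ β′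
dissects-cong e e′ e″ d = dissection
  (≈-trans (≈-sym e) (≈-trans (d .eq) (⊕-cong (²q-cong e′) (·-congˡ (²q-cong e″)))))

dissects-unique-odd : ∀ {f α α′ β β′} → Dissects f α β → Dissects f α′ β′ → β ≈ β′
dissects-unique-odd d d′ = pointwise λ n → ≡.trans (≡.sym (dissects-odd d n)) (dissects-odd d′ n)

dissects-scale : ∀ {f α β} → Dissects f α β → ∀ γ → Dissects (f · γ ²q) (α · γ) (β · γ)
dissects-scale {f} {α} {β} d γ = dissection (≈-trans (·-congʳ (d .eq)) (≈-trans
  (solve 4 (λ a q b c → (a :+ q :* b) :* c := a :* c :+ q :* (b :* c)) ≈-refl _ _ _ _)
  (⊕-cong (≈-sym (²q-· α γ)) (·-congˡ (≈-sym (²q-· β γ))))))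

dissects-· : ∀ {f α β g α′ β′} → Dissects f α β → Dissects g α′ β′ →
  Dissects (f · g) (α · α′ ⊕ q↑ 1 · (β · β′)) (α · β′ ⊕ β · α′)
dissects-· {f} {α} {β} {g} {α′} {β′} d d′ = dissection (begin
  f · g
    ≈⟨ ·-cong (d .eq) (d′ .eq) ⟩
  (α ²q ⊕ q↑ 1 · β ²q) · (α′ ²q ⊕ q↑ 1 · β′ ²q)
    ≈⟨ solve 5 (λ q a b c d → (a :+ q :* b) :* (c :+ q :* d) := (a :* c :+ (q :* q) :* (b :* d)) :+
      q :* (a :* d :+ b :* c))
        ≈-refl (q↑ 1) _ _ _ _ ⟩
  (α ²q · α′ ²q ⊕ (q↑ 1 · q↑ 1) · (β ²q · β′ ²q)) ⊕ q↑ 1 · (α ²q · β′ ²q ⊕ β ²q · α′ ²q)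
    ≈⟨ ⊕-cong
        (⊕-cong (²q-· α α′) (≈-trans (²q-· (q↑ 1) (β · β′))
          (·-cong (≈-trans (²q-q↑ 1) (≈-sym (q↑-+ 1 1))) (²q-· β β′))))
        (·-congˡ (≈-trans (²q-⊕ (α · β′) (β · α′)) (⊕-cong (²q-· α β′) (²q-· β α′)))) ⟨
  (α · α′) ²q ⊕ (q↑ 1 · (β · β′)) ²q ⊕ q↑ 1 · (α · β′ ⊕ β · α′) ²q
    ≈⟨ ⊕-cong (≈-sym (²q-⊕ _ _)) ≈-refl ⟩
  (α · α′ ⊕ q↑ 1 · (β · β′)) ²q ⊕ q↑ 1 · (α · β′ ⊕ β · α′) ²q ∎)
  where open ≈-Reasoning

η-cong-· : ∀ {f g} u v → f ≈ η u → g ≈ η v → f · g ≈ η (u ∙ v)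
η-cong-· u v e e′ = ≈-trans (·-cong e e′) (η-· u v)

²q-product : ∀ {f g α β} → f ≈ α ²q → g ≈ β ²q → f · g ≈ (α · β) ²q
²q-product e e′ = ≈-trans (·-cong e e′) (≈-sym (²q-· _ _))

-- For i = 1 the two summands of the addition formula are the even and the odd part, provided that
-- the four theta functions on its right side are series in q².
addition-dissects : ∀ {f a b c d α₁ α₂ β₁ β₂} ε → f ≈ a · b ⊕ const ε · q↑ 1 · (c · d) →
  a ≈ α₁ ²q → b ≈ α₂ ²q → c ≈ β₁ ²q → d ≈ β₂ ²q → Dissects f (α₁ · α₂) (const ε · (β₁ · β₂))
addition-dissects ε e ea eb ec ed = dissection (≈-trans e (⊕-cong (²q-product ea eb)
  (≈-trans (solve 3 (λ s q a → s :* q :* a := q :* (s :* a)) ≈-refl _ _ _)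
    (·-congˡ (²q-product (≈-sym (²q-const ε)) (²q-product ec ed))))))

-- The addition formula with all four arguments equal to -q; in Ramanujan's notation φ(-q)² = φ(q²)²
-- - 4q ψ(q⁴)².
dissection-f₁⁴ : Dissects (η (f₁ ^^ 4 ÷ f₂ ^^ 2))
  (η (f₂ ^^ 10 ÷ (f₁ ^^ 4 ∙ f₄ ^^ 4))) (const (ℤ.- + 4) · η (f₄ ^^ 4 ÷ f₂ ^^ 2))
dissection-f₁⁴ = dissects-cong
  (η-cong-· (f₁ ^^ 2 ÷ f₂) (f₁ ^^ 2 ÷ f₂) θ₋-1-1 θ₋-1-1)
  (η-cong-· (f₂ ^^ 5 ÷ (f₁ ^^ 2 ∙ f₄ ^^ 2)) (f₂ ^^ 5 ÷ (f₁ ^^ 2 ∙ f₄ ^^ 2)) θ₊-1-1 θ₊-1-1)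
  (≈-trans (·-congˡ (≈-trans (·-cong θ₊-2-0 θ₊-2-0)
      (≈-trans (solve 2 (λ a b → con (+ 2) :* a :* (con (+ 2) :* b) := con (+ 4) :* (a :* b)) ≈-refl
        _ _)
        (·-congˡ (η-· (f₄ ^^ 2 ÷ f₂) (f₄ ^^ 2 ÷ f₂))))))
    (solve 1 (λ a → con -1ℤ :* (con (+ 4) :* a) := con (ℤ.- + 4) :* a) ≈-refl _))
  (addition-dissects -1ℤ (θ-addition ≡.refl ≡.refl 1 0 0)
    (θ-²q 1ℤ 1 1 ≡.refl) (θ-²q 1ℤ 1 1 ≡.refl) (θ-²q 1ℤ 2 0 ≡.refl) (θ-²q 1ℤ 2 0 ≡.refl))

θ-10-2 : ∀ ε → ε ℤ.* ε ≡ 1ℤ → θ ε 10 2 ≈ (θ ε 1 5) ²q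
θ-10-2 ε ε² = ≈-trans (θ-²q ε 5 1 ε²) (²q-cong (θ-5-1 ε ε²))

θ-8-4 : θ 1ℤ 8 4 ≈ (θ 1ℤ 2 4) ²q
θ-8-4 = ≈-trans (θ-²q 1ℤ 4 2 ≡.refl) (²q-cong (≈-trans (triple-product 1ℤ 4 2 ≡.refl)
  (≈-trans (·-congʳ (·-comm _ _)) (≈-sym (triple-product 1ℤ 2 4 ≡.refl)))))

P Q R Φ Ψ U V : Series
P = θ 1ℤ 1 5
Q = θ 1ℤ 2 4
R = θ 1ℤ 1 2
Φ = θ 1ℤ 3 3
Ψ = θ 1ℤ 6 0
U = θ -1ℤ 1 5
V = θ -1ℤ 3 3

dissection-UV : Dissects (U · V) (Q · Q) (const -1ℤ · (P · P))
dissection-UV = addition-dissects -1ℤ (θ-addition ≡.refl ≡.refl 1 2 2)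
  (θ-²q 1ℤ 2 4 ≡.refl) (θ-²q 1ℤ 2 4 ≡.refl) (θ-10-2 1ℤ ≡.refl) (θ-10-2 1ℤ ≡.refl)

dissection-UU : Dissects (U · U) (Φ · P) (const -1ℤ · (Ψ · Q))
dissection-UU = addition-dissects -1ℤ (θ-addition ≡.refl ≡.refl 1 4 0)
  (θ-²q 1ℤ 3 3 ≡.refl) (θ-²q 1ℤ 1 5 ≡.refl) (θ-²q 1ℤ 6 0 ≡.refl) θ-8-4

dissection-PV : Dissects (P · V) (θ -1ℤ 2 4 · θ -1ℤ 2 4) (const 1ℤ · (U · U))
dissection-PV = addition-dissects 1ℤ (θ-addition ≡.refl ≡.refl 1 2 2)
  (θ-²q -1ℤ 2 4 ≡.refl) (θ-²q -1ℤ 2 4 ≡.refl) (θ-10-2 -1ℤ ≡.refl) (θ-10-2 -1ℤ ≡.refl)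

-- Read from right to left, this turns PQ(ΦQ + qΨP), the even part of U³V, into the single product
-- PQR².
R² : R · R ≈ Φ · Q ⊕ const 1ℤ · q↑ 1 · (Ψ · P)
R² = ≈-trans (θ-addition ≡.refl ≡.refl 1 1 0) (⊕-cong ≈-refl (·-congˡ (·-congˡ (θ-5-1 1ℤ ≡.refl))))

PQ-η : P · Q ≈ η (f₂ ∙ f₃ ∙ f₆ ÷ f₁)
PQ-η = η-cong-· (f₂ ^^ 2 ∙ f₃ ∙ f₁₂ ÷ (f₁ ∙ f₄ ∙ f₆)) (f₄ ∙ f₆ ^^ 2 ÷ (f₂ ∙ f₁₂)) θ₊-1-5 θ₊-2-4

UV-η : U · V ≈ η (f₁ ∙ f₃ ∙ f₆ ÷ f₂)
UV-η = η-cong-· (f₁ ∙ f₆ ^^ 2 ÷ (f₂ ∙ f₃)) (f₃ ^^ 2 ÷ f₆) θ₋-1-5 θ₋-3-3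

UU-η : U · U ≈ η (f₁ ^^ 2 ∙ f₆ ^^ 4 ÷ (f₂ ^^ 2 ∙ f₃ ^^ 2))
UU-η = η-cong-· (f₁ ∙ f₆ ^^ 2 ÷ (f₂ ∙ f₃)) (f₁ ∙ f₆ ^^ 2 ÷ (f₂ ∙ f₃)) θ₋-1-5 θ₋-1-5

-- For the time being, the odd part is only known as a theta expression.
X : Series
X = (Φ · P · (const -1ℤ · (P · P)) ⊕ const -1ℤ · (Ψ · Q) · (Q · Q)) · η (f₁ ^^ 3 ÷ f₃ ^^ 5)

-- U³V equals f₁³/f₃ times f₆⁵/f₂³, and the latter is a series in q². Hence the dissections of U²
-- and UV are multiplied and then rescaled.
dissection-f₁³/f₃-even : Dissects (η (f₁ ^^ 3 ÷ f₃)) (η (f₂ ^^ 3 ÷ f₆)) X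
dissection-f₁³/f₃-even = dissects-cong
  (≈-trans (·-cong (η-cong-· (f₁ ^^ 2 ∙ f₆ ^^ 4 ÷ (f₂ ^^ 2 ∙ f₃ ^^ 2)) (f₁ ∙ f₃ ∙ f₆ ÷ f₂) UU-η
    UV-η) η-²q)
    (η-· (f₁ ^^ 3 ∙ f₆ ^^ 5 ÷ (f₂ ^^ 3 ∙ f₃)) (f₂ ^^ 3 ÷ f₆ ^^ 5)))
  (≈-trans (·-congʳ even-part)
    (≈-trans (η-cong-· (f₂ ^^ 3 ∙ f₃ ^^ 5 ÷ (f₁ ^^ 3 ∙ f₆)) (f₁ ^^ 3 ÷ f₃ ^^ 5)
      (η-cong-· (f₂ ∙ f₃ ∙ f₆ ÷ f₁) (f₂ ^^ 2 ∙ f₃ ^^ 4 ÷ (f₁ ^^ 2 ∙ f₆ ^^ 2)) PQ-η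
        (η-cong-· (f₂ ∙ f₃ ^^ 2 ÷ (f₁ ∙ f₆)) (f₂ ∙ f₃ ^^ 2 ÷ (f₁ ∙ f₆)) θ₊-1-2 θ₊-1-2)) ≈-refl)
          ≈-refl))
  ≈-refl
  (dissects-scale (dissects-· dissection-UU dissection-UV) (η (f₁ ^^ 3 ÷ f₃ ^^ 5)))
  where
  even-part : Φ · P · (Q · Q) ⊕ q↑ 1 · (const -1ℤ · (Ψ · Q) · (const -1ℤ · (P · P))) ≈ P · Q ·
    (R · R)
  even-part = ≈-trans
    (solve 5 (λ φ ψ p x q → φ :* p :* (x :* x) :+ q :*
      (con -1ℤ :* (ψ :* x) :* (con -1ℤ :* (p :* p)))
      := p :* x :* (φ :* x :+ con 1ℤ :* q :* (ψ :* p))) ≈-refl Φ Ψ P Q (q↑ 1))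
    (·-congˡ (≈-sym R²))

-- PV is f₃³/f₁ times a series in q². Both of its parts are single products, f₂² and U².
dissection-f₃³/f₁ : Dissects (η (f₃ ^^ 3 ÷ f₁)) (η (f₂ ^^ 3 ∙ f₃ ^^ 2 ÷ (f₁ ^^ 2 ∙ f₆)))
  (η (f₆ ^^ 3 ÷ f₂))
dissection-f₃³/f₁ = dissects-cong
  (≈-trans (·-cong (η-cong-· (f₂ ^^ 2 ∙ f₃ ∙ f₁₂ ÷ (f₁ ∙ f₄ ∙ f₆)) (f₃ ^^ 2 ÷ f₆) θ₊-1-5 θ₋-3-3)
    η-²q)
    (η-· (f₂ ^^ 2 ∙ f₃ ^^ 3 ∙ f₁₂ ÷ (f₁ ∙ f₄ ∙ f₆ ^^ 2)) (f₄ ∙ f₆ ^^ 2 ÷ (f₂ ^^ 2 ∙ f₁₂))))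
  (η-cong-· (f₂ ^^ 2) (f₂ ∙ f₃ ^^ 2 ÷ (f₁ ^^ 2 ∙ f₆)) (η-cong-· f₂ f₂ θ₋-2-4 θ₋-2-4) ≈-refl)
  (≈-trans (·-congʳ (·-idˡ _))
    (η-cong-· (f₁ ^^ 2 ∙ f₆ ^^ 4 ÷ (f₂ ^^ 2 ∙ f₃ ^^ 2)) (f₂ ∙ f₃ ^^ 2 ÷ (f₁ ^^ 2 ∙ f₆)) UU-η
      ≈-refl))
  (dissects-scale dissection-PV (η (f₂ ∙ f₃ ^^ 2 ÷ (f₁ ^^ 2 ∙ f₆))))

-- Both f₁³/f₃ · f₃³/f₁ and (UV)² f₂²/f₆² equal f₁² f₃²; compare their odd parts.
X-η : X ≈ const (ℤ.- + 3) · η (f₁ ^^ 2 ∙ f₆ ^^ 3 ÷ (f₂ ∙ f₃ ^^ 2))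
X-η = unit-cancel (η-unit e) (≈-trans (≈-sym (·-comm X (η e))) (≈-trans
  -- With a = f₂²f₆², comparison of the odd parts gives a + X · η e = -2a; this is the origin of the
  -- coefficient -3.
  (solve 2 (λ a b → b := (a :+ b) :+ con -1ℤ :* a) ≈-refl (η (f₂ ^^ 2 ∙ f₆ ^^ 2)) (X · η e))
  (≈-trans (⊕-cong odd-part ≈-refl)
  (≈-trans (solve 1 (λ a → con (ℤ.- + 2) :* a :+ con -1ℤ :* a := con (ℤ.- + 3) :* a) ≈-refl
    (η (f₂ ^^ 2 ∙ f₆ ^^ 2)))
  (≈-trans (·-congˡ (≈-sym (η-· e (f₁ ^^ 2 ∙ f₆ ^^ 3 ÷ (f₂ ∙ f₃ ^^ 2)))))
    (solve 3 (λ c a b → c :* (a :* b) := a :* (c :* b)) ≈-refl _ _ _))))))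
  where
  -- The even part of f₃³/f₁, the cofactor of X in the odd part of the product.
  e : Exponents
  e = f₂ ^^ 3 ∙ f₃ ^^ 2 ÷ (f₁ ^^ 2 ∙ f₆)
  product : Dissects (η (f₁ ^^ 2 ∙ f₃ ^^ 2)) _ (η (f₂ ^^ 3 ÷ f₆) · η (f₆ ^^ 3 ÷ f₂) ⊕ X · η e)
  product = dissects-cong (η-· (f₁ ^^ 3 ÷ f₃) (f₃ ^^ 3 ÷ f₁)) ≈-refl ≈-refl
    (dissects-· dissection-f₁³/f₃-even dissection-f₃³/f₁)
  square : Dissects (η (f₁ ^^ 2 ∙ f₃ ^^ 2)) _ (const (ℤ.- + 2) · η (f₂ ^^ 2 ∙ f₆ ^^ 2))
  square = dissects-cong
    (≈-trans (·-cong (η-cong-· (f₁ ∙ f₃ ∙ f₆ ÷ f₂) (f₁ ∙ f₃ ∙ f₆ ÷ f₂) UV-η UV-η) η-²q)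
      (η-· (f₁ ^^ 2 ∙ f₃ ^^ 2 ∙ f₆ ^^ 2 ÷ f₂ ^^ 2) (f₂ ^^ 2 ÷ f₆ ^^ 2)))
    ≈-refl
    (≈-trans (solve 3 (λ p x c →
      (x :* x :* (con -1ℤ :* (p :* p)) :+ con -1ℤ :* (p :* p) :* (x :* x)) :* c
        := con (ℤ.- + 2) :* (p :* x :* (p :* x) :* c)) ≈-refl P Q (η (f₁ ^^ 2 ÷ f₃ ^^ 2)))
      (·-congˡ (η-cong-· (f₂ ^^ 2 ∙ f₃ ^^ 2 ∙ f₆ ^^ 2 ÷ f₁ ^^ 2) (f₁ ^^ 2 ÷ f₃ ^^ 2)
        (η-cong-· (f₂ ∙ f₃ ∙ f₆ ÷ f₁) (f₂ ∙ f₃ ∙ f₆ ÷ f₁) PQ-η PQ-η) ≈-refl)))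
    (dissects-scale (dissects-· dissection-UV dissection-UV) (η (f₁ ^^ 2 ÷ f₃ ^^ 2)))
  odd-part : η (f₂ ^^ 2 ∙ f₆ ^^ 2) ⊕ X · η e ≈ const (ℤ.- + 2) · η (f₂ ^^ 2 ∙ f₆ ^^ 2)
  odd-part = ≈-trans (⊕-cong (≈-sym (η-· (f₂ ^^ 3 ÷ f₆) (f₆ ^^ 3 ÷ f₂))) ≈-refl)
    (dissects-unique-odd product square)

dissection-f₁³/f₃ : Dissects (η (f₁ ^^ 3 ÷ f₃)) (η (f₂ ^^ 3 ÷ f₆))
  (const (ℤ.- + 3) · η (f₁ ^^ 2 ∙ f₆ ^^ 3 ÷ (f₂ ∙ f₃ ^^ 2)))
dissection-f₁³/f₃ = dissects-cong ≈-refl ≈-refl X-η dissection-f₁³/f₃-even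

-- The substitution q ↦ -q on eta quotients

η-neg-even : ∀ {b d e g} → (η (0ℤ ∷ b ∷ 0ℤ ∷ d ∷ e ∷ 0ℤ ∷ g ∷ 0ℤ ∷ [])) -q ≈ η
  (0ℤ ∷ b ∷ 0ℤ ∷ d ∷ e ∷ 0ℤ ∷ g ∷ 0ℤ ∷ [])
η-neg-even {b} {d} {e} {g} = ≈-trans (-q-cong (η-def _)) (≈-trans
  (skip (step 1 b (skip (step 2 d (step 3 e (skip (step 6 g (skip (-q-const 1ℤ)))))))))
  (≈-sym (η-def _)))
  where
  power : ∀ m .{{_ : NonZero m}} .{{_ : NonZero (m ℕ.+ m)}} t → (E (m ℕ.+ m) ** t) -q ≈ E (m ℕ.+ m)
    ** t
  power m t = ≈-trans (**-hom _-q -q-cong -q-· (-q-const 1ℤ) u v t) (**-cong v even t)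
    where
    u = E-unit (m ℕ.+ m)
    v = ≡.trans (-q-zero (E (m ℕ.+ m))) u
    even : (E (m ℕ.+ m)) -q ≈ E (m ℕ.+ m)
    even = ≈-trans (poch-neg -1ℤ (m ℕ.+ m) m)
      (≡⇒≈ (cong (λ ε → poch (-1ℤ ℤ.* ε) (m ℕ.+ m) (m ℕ.+ m)) (-1^-even m)))
  step : ∀ m .{{_ : NonZero m}} .{{_ : NonZero (m ℕ.+ m)}} t {X} → X -q ≈ X → (E (m ℕ.+ m) ** t · X)
    -q ≈ E (m ℕ.+ m) ** t · X
  step m t e = ≈-trans (-q-· _ _) (·-cong (power m t) e)
  skip : ∀ {f X} → X -q ≈ X → (f ** 0ℤ · X) -q ≈ f ** 0ℤ · X
  skip {f} e = ≈-trans (-q-· _ _)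
    (·-cong (≈-trans (-q-cong (**-zero f)) (≈-trans (-q-const 1ℤ) (≈-sym (**-zero f)))) e)

η-neg-· : ∀ {v v′ w w′} → (η v) -q ≈ η v′ → (η w) -q ≈ η w′ → (η (v ∙ w)) -q ≈ η (v′ ∙ w′)
η-neg-· {v} {v′} {w} {w′} e e′ = ≈-trans (-q-cong (≈-sym (η-· v w)))
  (≈-trans (-q-· _ _) (η-cong-· v′ w′ e e′))

η-neg₁ : (η f₁) -q ≈ η (f₂ ^^ 3 ÷ (f₁ ∙ f₄))
η-neg₁ = ≈-trans (-q-cong (≈-sym (η-single 0F))) E-neg₁

1ᵉ : Exponents
1ᵉ = replicate 8 0ℤ

-- Obtained from the image of f₃ by applying the substitution to (1/f₃) · f₃ = 1.
η-neg₃⁻¹ : (η (1ᵉ ÷ f₃)) -q ≈ η (f₃ ∙ f₁₂ ÷ f₆ ^^ 3)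
η-neg₃⁻¹ = η-quotient (f₆ ^^ 3 ÷ (f₃ ∙ f₁₂)) (f₃ ∙ f₁₂ ÷ f₆ ^^ 3) (≈-trans
  (·-congˡ (≈-trans (≈-sym E-neg₃) (-q-cong (η-single 2F))))
  (≈-trans (≈-sym (-q-· _ _))
    (≈-trans (-q-cong (≈-trans (η-· (1ᵉ ÷ f₃) f₃) (≈-sym 𝟙-η))) (≈-trans (-q-const 1ℤ) 𝟙-η))))

-- Positivity

NonNeg Pos : Series → Set
NonNeg f = ∀ n → 0ℤ ℤ.≤ f n
Pos f = ∀ n → 0ℤ ℤ.< f n

*-nonneg : ∀ {a b} → 0ℤ ℤ.≤ a → 0ℤ ℤ.≤ b → 0ℤ ℤ.≤ a ℤ.* b
*-nonneg (ℤ.+≤+ {n = m} _) (ℤ.+≤+ {n = n} _) = ≡.subst (0ℤ ℤ.≤_) (ℤ.pos-* m n) (ℤ.+≤+ z≤n)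

*-pos : ∀ {a b} → 0ℤ ℤ.< a → 0ℤ ℤ.< b → 0ℤ ℤ.< a ℤ.* b
*-pos (ℤ.+<+ {n = suc m} _) (ℤ.+<+ {n = suc n} _) = ℤ.+<+ (s≤s z≤n)

-- The hypotheses stop at n because `inv-factor-nonneg`, a recursion on the exponent, knows only the
-- earlier coefficients.
·-nonneg-at : ∀ n {f g} → (∀ k → k ℕ.≤ n → 0ℤ ℤ.≤ f k) → (∀ k → k ℕ.≤ n → 0ℤ ℤ.≤ g k) → 0ℤ ℤ.≤
  (f · g) n
·-nonneg-at zero    {f} {g} p p′ = ≡.subst (0ℤ ℤ.≤_) (≡.sym (·-zero f g))
  (*-nonneg (p 0 z≤n) (p′ 0 z≤n))
·-nonneg-at (suc n) {f} {g} p p′ = ≡.subst (0ℤ ℤ.≤_) (≡.sym (·-suc f g n)) (ℤ.+-mono-≤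
  (*-nonneg (p 0 z≤n) (p′ (suc n) ℕ.≤-refl))
  (·-nonneg-at n (λ k k≤n → p (suc k) (s≤s k≤n)) (λ k k≤n → p′ k (ℕ.m≤n⇒m≤1+n k≤n))))

·-nonneg : ∀ {f g} → NonNeg f → NonNeg g → NonNeg (f · g)
·-nonneg p p′ n = ·-nonneg-at n (λ k _ → p k) (λ k _ → p′ k)

nonneg-≈ : ∀ {f g} → f ≈ g → NonNeg f → NonNeg g
nonneg-≈ e p n = ≡.subst (0ℤ ℤ.≤_) (e .at n) (p n)

pos-≈ : ∀ {f g} → f ≈ g → Pos f → Pos g
pos-≈ e p n = ≡.subst (0ℤ ℤ.<_) (e .at n) (p n)

·-term : ∀ {f g} → NonNeg f → NonNeg g → ∀ i j → f i ℤ.* g j ℤ.≤ (f · g) (i ℕ.+ j)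
·-term {f} {g} p p′ zero zero = ℤ.≤-reflexive (≡.sym (·-zero f g))
·-term {f} {g} p p′ zero (suc j) = ≡.subst₂ ℤ._≤_ (ℤ.+-identityʳ _) (≡.sym (·-suc f g j))
  (ℤ.+-monoʳ-≤ (f 0 ℤ.* g (suc j)) (·-nonneg (λ k → p (suc k)) p′ j))
·-term {f} {g} p p′ (suc i) j = ≡.subst₂ ℤ._≤_ (ℤ.+-identityˡ _) (≡.sym (·-suc f g (i ℕ.+ j)))
  (ℤ.+-mono-≤ (*-nonneg (p 0) (p′ (suc (i ℕ.+ j)))) (·-term (λ k → p (suc k)) p′ i j))

·-pos-at : ∀ {f g} → NonNeg f → NonNeg g → ∀ i j → 0ℤ ℤ.< f i → 0ℤ ℤ.< g j → 0ℤ ℤ.< (f · g)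
  (i ℕ.+ j)
·-pos-at p p′ i j fi gj = ℤ.<-≤-trans (*-pos fi gj) (·-term p p′ i j)

pos⇒nonneg : ∀ {f} → Pos f → NonNeg f
pos⇒nonneg p n = ℤ.<⇒≤ (p n)

unit-pos : ∀ f → IsUnit f → 0ℤ ℤ.< f 0
unit-pos f u = ≡.subst (0ℤ ℤ.<_) (≡.sym u) (ℤ.+<+ (s≤s z≤n))

·-pos : ∀ {f g} → Pos f → NonNeg g → 0ℤ ℤ.< g 0 → Pos (f · g)
·-pos {f} {g} p p′ g₀ n = ≡.subst (λ k → 0ℤ ℤ.< (f · g) k) (ℕ.+-identityʳ n)
  (·-pos-at (pos⇒nonneg p) p′ n 0 (p n) g₀)

𝟙-nonneg : NonNeg 𝟙
𝟙-nonneg zero    = ℤ.<⇒≤ (unit-pos 𝟙 IsUnit-𝟙)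
𝟙-nonneg (suc n) = ℤ.≤-reflexive (≡.sym (const-suc 1ℤ n))

opaque
  unfolding q↑_ q↦q²

  q↑-nonneg : ∀ e → NonNeg (q↑ e)
  q↑-nonneg zero    zero    = ℤ.+≤+ z≤n
  q↑-nonneg zero    (suc n) = ℤ.+≤+ z≤n
  q↑-nonneg (suc e) zero    = ℤ.+≤+ z≤n
  q↑-nonneg (suc e) (suc n) = q↑-nonneg e n

  ²q-nonneg : ∀ {f} → NonNeg f → NonNeg (f ²q)
  ²q-nonneg p zero          = p 0
  ²q-nonneg p (suc zero)    = ℤ.+≤+ z≤n
  ²q-nonneg p (suc (suc n)) = ²q-nonneg (λ k → p (suc k)) n

⊕-nonneg : ∀ {f g} → NonNeg f → NonNeg g → NonNeg (f ⊕ g)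
⊕-nonneg p p′ n = ≡.subst (0ℤ ℤ.≤_) (≡.sym (⊕-def _ _ n)) (ℤ.+-mono-≤ (p n) (p′ n))

factor-nonneg : ∀ e → NonNeg (factor 1ℤ e)
factor-nonneg e = ⊕-nonneg 𝟙-nonneg (nonneg-≈ (≈-sym (·-idˡ _)) (q↑-nonneg e))

prod-nonneg : ∀ {F} → (∀ k → NonNeg (F k)) → ∀ n → NonNeg (prod F n)
prod-nonneg p zero    = 𝟙-nonneg
prod-nonneg p (suc n) = ·-nonneg (prod-nonneg p n) (p n)

poch-nonneg : ∀ i m .{{_ : NonZero m}} → NonNeg (poch 1ℤ i m)
poch-nonneg i m n = ≡.subst (0ℤ ℤ.≤_)
  (≡.sym (∏-below (poch-convergent 1ℤ i m) (ℕ.≤-refl {suc n}) .at< n (ℕ.n<1+n n)))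
  (prod-nonneg (λ k → factor-nonneg (i ℕ.+ k ℕ.* m)) (suc n) n)

q↑-diagonal : ∀ e → (q↑ e) e ≡ 1ℤ
q↑-diagonal zero    = ≡.trans (q↑0 .at 0) IsUnit-𝟙
q↑-diagonal (suc e) = ≡.trans (q↑-suc-suc e e) (q↑-diagonal e)

prod-unit : ∀ {F} → (∀ k → IsUnit (F k)) → ∀ n → IsUnit (prod F n)
prod-unit u zero    = IsUnit-𝟙
prod-unit u (suc n) = IsUnit-· (prod-unit u n) (u n)

factor-unit : ∀ ε e → IsUnit (factor ε (suc e))
factor-unit ε e = ≡.trans (factor-below ε {1} (s≤s z≤n) .at< 0 (s≤s z≤n)) IsUnit-𝟙

-- n is itself a partition of n into distinct parts
distinct-pos : Pos (poch 1ℤ 1 1)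
distinct-pos n = ≡.subst (0ℤ ℤ.<_) (≡.sym (≡.trans
    (∏-below (poch-convergent 1ℤ 1 1) (ℕ.≤-refl {suc n}) .at< n (ℕ.n<1+n n))
    (below-trans (·-cong-below below-refl
      (factor-below 1ℤ (s≤s (ℕ.≤-reflexive (≡.sym (ℕ.*-identityʳ n))))))
      (≈⇒≈[] (suc n) (·-idʳ _)) .at< n (ℕ.n<1+n n))))
  (go n)
  where
  F : ℕ → Series
  F k = factor 1ℤ (1 ℕ.+ k ℕ.* 1)
  nonneg : ∀ n → NonNeg (prod F n)
  nonneg = prod-nonneg (λ k → factor-nonneg (1 ℕ.+ k ℕ.* 1))
  go : ∀ n → 0ℤ ℤ.< prod F n n
  go zero    = unit-pos 𝟙 IsUnit-𝟙
  go (suc n) = ·-pos-at (nonneg n) (factor-nonneg (1 ℕ.+ n ℕ.* 1)) 0 (suc n)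
    (unit-pos (prod F n) (prod-unit {F} (λ k → factor-unit 1ℤ (k ℕ.* 1)) n))
    (≡.subst (0ℤ ℤ.<_) (≡.sym (⊕-def 𝟙 _ (suc n))) (ℤ.+-mono-≤-< (𝟙-nonneg (suc n))
      (≡.subst (0ℤ ℤ.<_) (≡.sym (≡.trans (·-idˡ _ .at (suc n))
        (≡.trans (cong (λ e → (q↑ e) (suc n)) (cong suc (ℕ.*-identityʳ n))) (q↑-diagonal (suc n)))))
        (ℤ.+<+ (s≤s z≤n)))))

inv-unique : ∀ {K f g} → IsUnit f → f · g ≈[ K ] 𝟙 → g ≈[ K ] inv f
inv-unique {K} u e = unit-cancelˡ u (below-trans e (≈⇒≈[] K (≈-sym (·-inv u))))

q↑-·-nonneg : ∀ e f n → (∀ k → k ℕ.< n → 0ℤ ℤ.≤ f k) → 0ℤ ℤ.≤ (q↑ suc e · f) n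
q↑-·-nonneg e f zero    p = ℤ.≤-reflexive (≡.sym (q↑-·-zero e f))
q↑-·-nonneg e f (suc n) p = ≡.subst (0ℤ ℤ.≤_) (≡.sym (q↑-·-suc e f n))
  (·-nonneg-at n (λ k _ → q↑-nonneg e k) (λ k k≤n → p k (s≤s k≤n)))

-- The geometric series, through its equation g = 1 + q^(e+1) g, which expresses each coefficient by
-- earlier ones.
inv-factor-nonneg : ∀ e → NonNeg (inv (factor -1ℤ (suc e)))
inv-factor-nonneg e = <-rec _ λ n rec → ≡.subst (0ℤ ℤ.≤_)
  (≡.sym (≡.trans (recursion .at n) (⊕-def 𝟙 _ n)))
  (ℤ.+-mono-≤ (𝟙-nonneg n) (q↑-·-nonneg e g n (λ k k<n → rec k<n)))
  where
  g : Series
  g = inv (factor -1ℤ (suc e))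
  recursion : g ≈ 𝟙 ⊕ q↑ suc e · g
  recursion = ≈-trans
    (solve 2 (λ g q → g := (con 1ℤ :+ con -1ℤ :* q) :* g :+ q :* g) ≈-refl g (q↑ suc e))
    (⊕-cong (·-inv (factor-unit -1ℤ e)) ≈-refl)

inv-prod-nonneg : ∀ {F} → (∀ k → IsUnit (F k)) → (∀ k → NonNeg (inv (F k))) → ∀ n → NonNeg
  (inv (prod F n))
inv-prod-nonneg {F} u p zero    = nonneg-≈ (≈[]⇒≈ λ K → inv-unique IsUnit-𝟙 (≈⇒≈[] K (·-idˡ 𝟙)))
  𝟙-nonneg
inv-prod-nonneg {F} u p (suc n) = nonneg-≈
  (≈[]⇒≈ λ K → inv-unique (prod-unit u (suc n)) (≈⇒≈[] K (≈-trans
    (solve 4 (λ a b c d → (a :* b) :* (c :* d) := (a :* c) :* (b :* d)) ≈-refl (prod F n) (F n)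
      (inv (prod F n)) (inv (F n)))
    (≈-trans (·-cong (·-inv (prod-unit u n)) (·-inv (u n))) (·-idˡ 𝟙)))))
  (·-nonneg (inv-prod-nonneg u p n) (p n))

inv-E-nonneg : ∀ d .{{_ : NonZero d}} → NonNeg (inv (E d))
inv-E-nonneg d@(suc d′) n = ≡.subst (0ℤ ℤ.≤_)
  (inv-unique (E-unit d) (below-trans
    (·-cong-below (∏-below (poch-convergent -1ℤ d d) ℕ.≤-refl) below-refl)
    (≈⇒≈[] (suc n) (·-inv (prod-unit u (suc n))))) .at< n (ℕ.n<1+n n))
  (inv-prod-nonneg u (λ k → inv-factor-nonneg (d′ ℕ.+ k ℕ.* d)) (suc n) n)
  where
  u : ∀ k → IsUnit (factor -1ℤ (d ℕ.+ k ℕ.* d))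
  u k = factor-unit -1ℤ (d′ ℕ.+ k ℕ.* d)

η-inv-nonneg : ∀ d .{{_ : NonZero d}} v w → E d ≈ η v → v ∙ w ≡ 1ᵉ → NonNeg (η w)
η-inv-nonneg d v w e zero-sum = nonneg-≈ (≈-sym (≈[]⇒≈ λ K → inv-unique (E-unit d) (≈⇒≈[] K
  (≈-trans (·-congʳ e) (≈-trans (η-· v w) (≈-trans (≡⇒≈ (cong η zero-sum)) (≈-sym 𝟙-η)))))))
  (inv-E-nonneg d)

η-nonneg-· : ∀ {v w} → NonNeg (η v) → NonNeg (η w) → NonNeg (η (v ∙ w))
η-nonneg-· {v} {w} p p′ = nonneg-≈ (η-· v w) (·-nonneg p p′)

η-pos-· : ∀ {v w} → Pos (η v) → NonNeg (η w) → Pos (η (v ∙ w))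
η-pos-· {v} {w} p p′ = pos-≈ (η-· v w) (·-pos p p′ (unit-pos (η w) (η-unit w)))

1/f₁-nonneg : NonNeg (η (1ᵉ ÷ f₁))
1/f₁-nonneg = η-inv-nonneg 1 f₁ (1ᵉ ÷ f₁) (η-single 0F) ≡.refl

1/f₂-nonneg : NonNeg (η (1ᵉ ÷ f₂))
1/f₂-nonneg = η-inv-nonneg 2 f₂ (1ᵉ ÷ f₂) (η-single 1F) ≡.refl

1/f₄-nonneg : NonNeg (η (1ᵉ ÷ f₄))
1/f₄-nonneg = η-inv-nonneg 4 f₄ (1ᵉ ÷ f₄) (η-single 3F) ≡.refl

1/f₆-nonneg : NonNeg (η (1ᵉ ÷ f₆))
1/f₆-nonneg = η-inv-nonneg 6 f₆ (1ᵉ ÷ f₆) (η-single 4F) ≡.refl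

f₂/f₁-pos : Pos (η (f₂ ÷ f₁))
f₂/f₁-pos = pos-≈ plus-η₁ distinct-pos

f₄/f₂-nonneg : NonNeg (η (f₄ ÷ f₂))
f₄/f₂-nonneg = nonneg-≈ plus-η₂ (poch-nonneg 2 2)

f₁₂/f₆-nonneg : NonNeg (η (f₁₂ ÷ f₆))
f₁₂/f₆-nonneg = nonneg-≈ plus-η₆ (poch-nonneg 6 6)

-- 1/f₁ is (-q; q)_∞ times 1/f₂, and the first factor is already positive everywhere.
1/f₁-pos : Pos (η (1ᵉ ÷ f₁))
1/f₁-pos = η-pos-· {f₂ ÷ f₁} f₂/f₁-pos 1/f₂-nonneg

opaque
  unfolding θ

  θ-nonneg : ∀ i j → NonNeg (θ 1ℤ i j)
  θ-nonneg i j n = bisum-nonneg (suc (suc n)) n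
    where
    term-nonneg : ∀ k → NonNeg (term 1ℤ i j k)
    term-nonneg k = nonneg-≈ (≈-sym
      (≈-trans (·-congʳ (≡⇒≈ (cong const (ℤ.^-zeroˡ ℤ.∣ k ∣)))) (·-idˡ _)))
      (q↑-nonneg (expo i j k))
    bisum-nonneg : ∀ L → NonNeg (bisum L (term 1ℤ i j))
    bisum-nonneg zero    n = ℤ.≤-reflexive (≡.sym (𝟘-coeff n))
    bisum-nonneg (suc L) = ⊕-nonneg (bisum-nonneg L)
      (⊕-nonneg (term-nonneg (+ L)) (term-nonneg -[1+ L ]))

opaque
  unfolding _·_ _⊕_ const q↑_ θ ∏

  -- The low coefficients needed for positivity are evaluated from the definitions, which are
  -- unfolded for this purpose.
  θ-1-1-coeff₁ : θ 1ℤ 1 1 1 ≡ + 2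
  θ-1-1-coeff₁ = ≡.refl

  θ-1-2-coeff₁ : θ 1ℤ 1 2 1 ≡ 1ℤ
  θ-1-2-coeff₁ = ≡.refl

  O-1-coeff₁ : O 1ℤ 1 1 ≡ 1ℤ
  O-1-coeff₁ = ≡.refl

  O-1-coeff₃ : O 1ℤ 1 3 ≡ 1ℤ
  O-1-coeff₃ = ≡.refl

data Parity : ℕ → Set where
  even : ∀ k → Parity (2 ℕ.* k)
  odd  : ∀ k → Parity (suc (2 ℕ.* k))

parity : ∀ n → Parity n
parity zero = even 0
parity (suc n) with parity n
... | even k = odd k
... | odd k  = ≡.subst Parity (cong suc (ℕ.+-suc k (k ℕ.+ 0))) (even (suc k))

²q-pos-even : ∀ {g} → Pos g → ∀ k → 0ℤ ℤ.< (g ²q) (2 ℕ.* k)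
²q-pos-even {g} p k = ≡.subst (0ℤ ℤ.<_) (≡.sym (²q-even g k)) (p k)

-- All even exponents carry a positive coefficient of g(q²); the coefficient of q^0 in h serves even
-- n, that of q^1 serves odd n.
·-²q-pos : ∀ {h g} → NonNeg h → 0ℤ ℤ.< h 0 → 0ℤ ℤ.< h 1 → Pos g → Pos (h · g ²q)
·-²q-pos {h} {g} p h₀ h₁ g⁺ n with parity n
... | even k = ·-pos-at p (²q-nonneg (pos⇒nonneg g⁺)) 0 (2 ℕ.* k) h₀ (²q-pos-even g⁺ k)
... | odd k  = ·-pos-at p (²q-nonneg (pos⇒nonneg g⁺)) 1 (2 ℕ.* k) h₁ (²q-pos-even g⁺ k)

1/f₂-²q : (η (1ᵉ ÷ f₁)) ²q ≈ η (1ᵉ ÷ f₂)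
1/f₂-²q = η-²q

-- The series is φ(q) (-q; q²)_∞ / f₄, where 1/f₄ is positive at the multiples of
-- 4 and the rest is positive at 0, 1, 2 and 3.
f₂⁷/f₁³f₄⁴-pos : Pos (η (f₂ ^^ 7 ÷ (f₁ ^^ 3 ∙ f₄ ^^ 4)))
f₂⁷/f₁³f₄⁴-pos = pos-≈ (η-cong-· (f₂ ^^ 7 ÷ (f₁ ^^ 3 ∙ f₄ ^^ 3)) (1ᵉ ÷ f₄)
    (η-cong-· (f₂ ^^ 5 ÷ (f₁ ^^ 2 ∙ f₄ ^^ 2)) (f₂ ^^ 2 ÷ (f₁ ∙ f₄)) θ₊-1-1 O₊-η₁) ≈-refl)
  λ n → go n (parity n)
  where
  H : Series
  H = θ 1ℤ 1 1 · O 1ℤ 1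
  θ⁺ : NonNeg (θ 1ℤ 1 1)
  θ⁺ = θ-nonneg 1 1
  O⁺ : NonNeg (O 1ℤ 1)
  O⁺ = poch-nonneg 1 2
  positive : ∀ {x} n → x ≡ + suc n → 0ℤ ℤ.< x
  positive n ≡.refl = ℤ.+<+ (s≤s z≤n)
  θ₀ : 0ℤ ℤ.< θ 1ℤ 1 1 0
  θ₀ = unit-pos (θ 1ℤ 1 1) (IsUnit-≈ (≈-sym θ₊-1-1) (η-unit _))
  O₀ : 0ℤ ℤ.< O 1ℤ 1 0
  O₀ = unit-pos (O 1ℤ 1) (IsUnit-≈ (≈-sym O₊-η₁) (η-unit _))
  -- 1/f₄ arises from 1/f₁ by q ↦ q² applied twice.
  G⁺ : ∀ l → 0ℤ ℤ.< η (1ᵉ ÷ f₄) (2 ℕ.* (2 ℕ.* l))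
  G⁺ l = ≡.subst (0ℤ ℤ.<_) (≡.trans (≡.sym (²q-even _ (2 ℕ.* l))) (η-²q .at (2 ℕ.* (2 ℕ.* l))))
    (≡.subst (0ℤ ℤ.<_) (1/f₂-²q .at (2 ℕ.* l)) (²q-pos-even 1/f₁-pos l))
  at-residue : ∀ r l → 0ℤ ℤ.< H r → 0ℤ ℤ.< (H · η (1ᵉ ÷ f₄)) (r ℕ.+ 2 ℕ.* (2 ℕ.* l))
  at-residue r l h = ·-pos-at (·-nonneg θ⁺ O⁺) 1/f₄-nonneg r (2 ℕ.* (2 ℕ.* l)) h (G⁺ l)
  double-suc : ∀ l → 2 ℕ.+ 2 ℕ.* (2 ℕ.* l) ≡ 2 ℕ.* suc (2 ℕ.* l)
  double-suc = ℕ-solve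
  -- The residues 0, 1, 2, 3 are reached in φ(q) (-q; q²)_∞ as 0 + 0, 1 + 0, 1 + 1 and 0 + 3.
  go : ∀ n → Parity n → 0ℤ ℤ.< (H · η (1ᵉ ÷ f₄)) n
  go _ (even k) with parity k
  ... | even l = at-residue 0 l (·-pos-at θ⁺ O⁺ 0 0 θ₀ O₀)
  ... | odd l  = ≡.subst (λ n → 0ℤ ℤ.< (H · η (1ᵉ ÷ f₄)) n) (double-suc l)
    (at-residue 2 l (·-pos-at θ⁺ O⁺ 1 1 (positive 1 θ-1-1-coeff₁) (positive 0 O-1-coeff₁)))
  go _ (odd k) with parity k
  ... | even l = at-residue 1 l (·-pos-at θ⁺ O⁺ 1 0 (positive 1 θ-1-1-coeff₁) O₀)
  ... | odd l  = ≡.subst (λ n → 0ℤ ℤ.< (H · η (1ᵉ ÷ f₄)) n) (cong suc (double-suc l))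
    (at-residue 3 l (·-pos-at θ⁺ O⁺ 0 3 θ₀ (positive 0 O-1-coeff₃)))

-- The series is φ(q)/(f₂f₄²). Already φ(q)/f₂ is positive, because φ(q) starts with 1 + 2q.
f₂⁴/f₁²f₄⁴-pos : Pos (η (f₂ ^^ 4 ÷ (f₁ ^^ 2 ∙ f₄ ^^ 4)))
f₂⁴/f₁²f₄⁴-pos = η-pos-· {f₂ ^^ 4 ÷ (f₁ ^^ 2 ∙ f₄ ^^ 3)}
  (η-pos-· {f₂ ^^ 4 ÷ (f₁ ^^ 2 ∙ f₄ ^^ 2)}
    (pos-≈ (≈-trans (·-cong θ₊-1-1 1/f₂-²q) (η-· (f₂ ^^ 5 ÷ (f₁ ^^ 2 ∙ f₄ ^^ 2)) (1ᵉ ÷ f₂)))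
      (·-²q-pos (θ-nonneg 1 1) (unit-pos (θ 1ℤ 1 1) (IsUnit-≈ (≈-sym θ₊-1-1) (η-unit _)))
        (≡.subst (0ℤ ℤ.<_) (≡.sym θ-1-1-coeff₁) (ℤ.+<+ (s≤s z≤n))) 1/f₁-pos))
    1/f₄-nonneg)
  1/f₄-nonneg

f₂/f₁f₄⁴-pos : Pos (η (f₂ ÷ (f₁ ∙ f₄ ^^ 4)))
f₂/f₁f₄⁴-pos = η-pos-· {f₂ ÷ f₁} {1ᵉ ÷ f₄ ^^ 4} f₂/f₁-pos
  (η-nonneg-· {1ᵉ ÷ f₄ ^^ 2} {1ᵉ ÷ f₄ ^^ 2} 1/f₄²-nonneg 1/f₄²-nonneg)
  where
  1/f₄²-nonneg : NonNeg (η (1ᵉ ÷ f₄ ^^ 2))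
  1/f₄²-nonneg = η-nonneg-· {1ᵉ ÷ f₄} {1ᵉ ÷ f₄} 1/f₄-nonneg 1/f₄-nonneg

f₂/f₁f₆-pos : Pos (η (f₂ ÷ (f₁ ∙ f₆)))
f₂/f₁f₆-pos = η-pos-· {f₂ ÷ f₁} {1ᵉ ÷ f₆} f₂/f₁-pos 1/f₆-nonneg

-- The series is (-q; q)_∞ (-q²; q²)_∞³.
f₄³/f₁f₂²-pos : Pos (η (f₄ ^^ 3 ÷ (f₁ ∙ f₂ ^^ 2)))
f₄³/f₁f₂²-pos = η-pos-· {f₄ ^^ 2 ÷ (f₁ ∙ f₂)} {f₄ ÷ f₂}
  (η-pos-· {f₄ ÷ f₁} {f₄ ÷ f₂} (η-pos-· {f₂ ÷ f₁} {f₄ ÷ f₂} f₂/f₁-pos f₄/f₂-nonneg) f₄/f₂-nonneg)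
    f₄/f₂-nonneg

f₄²/f₁²f₂²-pos : Pos (η (f₄ ^^ 2 ÷ (f₁ ^^ 2 ∙ f₂ ^^ 2)))
f₄²/f₁²f₂²-pos = η-pos-· {f₄ ^^ 2 ÷ (f₁ ^^ 2 ∙ f₂)} {1ᵉ ÷ f₂}
  (η-pos-· {f₄ ^^ 2 ÷ (f₁ ∙ f₂)} {1ᵉ ÷ f₁}
    (η-pos-· {f₄ ÷ f₁} {f₄ ÷ f₂} (η-pos-· {f₂ ÷ f₁} {f₄ ÷ f₂} f₂/f₁-pos f₄/f₂-nonneg) f₄/f₂-nonneg)
    1/f₁-nonneg) 1/f₂-nonneg

f₄/f₁³f₂²-pos : Pos (η (f₄ ÷ (f₁ ^^ 3 ∙ f₂ ^^ 2)))
f₄/f₁³f₂²-pos = η-pos-· {f₄ ÷ f₁} {1ᵉ ÷ (f₁ ^^ 2 ∙ f₂ ^^ 2)}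
  (η-pos-· {f₂ ÷ f₁} {f₄ ÷ f₂} f₂/f₁-pos f₄/f₂-nonneg)
  (η-nonneg-· {1ᵉ ÷ (f₁ ∙ f₂)} {1ᵉ ÷ (f₁ ∙ f₂)} 1/f₁f₂-nonneg 1/f₁f₂-nonneg)
  where
  1/f₁f₂-nonneg : NonNeg (η (1ᵉ ÷ (f₁ ∙ f₂)))
  1/f₁f₂-nonneg = η-nonneg-· {1ᵉ ÷ f₁} {1ᵉ ÷ f₂} 1/f₁-nonneg 1/f₂-nonneg

-- The series is f(q, q²)/f₂ times (-q⁶; q⁶)_∞²/f₄, and f(q, q²) starts with 1 + q.
f₃²f₁₂²/f₁f₄f₆³-pos : Pos (η (f₃ ^^ 2 ∙ f₁₂ ^^ 2 ÷ (f₁ ∙ f₄ ∙ f₆ ^^ 3)))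
f₃²f₁₂²/f₁f₄f₆³-pos = η-pos-· {f₃ ^^ 2 ∙ f₁₂ ÷ (f₁ ∙ f₄ ∙ f₆ ^^ 2)} {f₁₂ ÷ f₆}
  (η-pos-· {f₃ ^^ 2 ÷ (f₁ ∙ f₄ ∙ f₆)} {f₁₂ ÷ f₆}
    (η-pos-· {f₃ ^^ 2 ÷ (f₁ ∙ f₆)} {1ᵉ ÷ f₄}
      (pos-≈ (≈-trans (·-cong θ₊-1-2 1/f₂-²q) (η-· (f₂ ∙ f₃ ^^ 2 ÷ (f₁ ∙ f₆)) (1ᵉ ÷ f₂)))
        (·-²q-pos (θ-nonneg 1 2) (unit-pos (θ 1ℤ 1 2) (IsUnit-≈ (≈-sym θ₊-1-2) (η-unit _)))
          (≡.subst (0ℤ ℤ.<_) (≡.sym θ-1-2-coeff₁) (ℤ.+<+ (s≤s z≤n))) 1/f₁-pos))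
      1/f₄-nonneg)
    f₁₂/f₆-nonneg)
  f₁₂/f₆-nonneg

-- From dissections to signs

SignPattern : (ℕ → ℤ) → Set
SignPattern f = ∀ n → (f (2 ℕ.* n) ℤ.> 0ℤ) × (f (4 ℕ.* n ℕ.+ 1) ℤ.< 0ℤ) × (f (4 ℕ.* n ℕ.+ 3) ℤ.> 0ℤ)

-- As v′ belongs to β(-q), the coefficient of q^k in β has the sign (-1)^k. The odd indices 4n + 1
-- and 4n + 3 correspond to k = 2n and k = 2n + 1, and the negative factor `-[1+ c ]` reverses both
-- signs.
sign-pattern : ∀ {f} c u v v′ → Dissects f (η u) (const -[1+ c ] · η v) → (η v) -q ≈ η v′ →
  Pos (η u) → Pos (η v′) → SignPattern f
sign-pattern {f} c u v v′ d e u⁺ v⁺ n =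
  ≡.subst (0ℤ ℤ.<_) (≡.sym (dissects-even d n)) (u⁺ n) ,
  ≡.subst (ℤ._< 0ℤ) (≡.sym (≡.trans (cong f (index₁ n)) (odd-coeff (2 ℕ.* n)))) negative ,
  ≡.subst (0ℤ ℤ.<_) (≡.sym (≡.trans (cong f (index₃ n)) (odd-coeff (suc (2 ℕ.* n))))) positive
  where
  index₁ : ∀ n → 4 ℕ.* n ℕ.+ 1 ≡ suc (2 ℕ.* (2 ℕ.* n))
  index₁ = ℕ-solve
  index₃ : ∀ n → 4 ℕ.* n ℕ.+ 3 ≡ suc (2 ℕ.* suc (2 ℕ.* n))
  index₃ = ℕ-solve
  odd-coeff : ∀ k → f (suc (2 ℕ.* k)) ≡ -[1+ c ] ℤ.* η v k
  odd-coeff k = ≡.trans (dissects-odd d k) (const-· -[1+ c ] (η v) k)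
  scaled : ∀ {x} → 0ℤ ℤ.< x → -[1+ c ] ℤ.* x ℤ.< 0ℤ
  scaled (ℤ.+<+ {n = suc m} _) = ℤ.-<+
  negative : -[1+ c ] ℤ.* η v (2 ℕ.* n) ℤ.< 0ℤ
  negative = scaled (≡.subst (0ℤ ℤ.<_) (≡.trans (≡.sym (e .at (2 ℕ.* n))) (-q-even (η v) n))
    (v⁺ (2 ℕ.* n)))
  positive : 0ℤ ℤ.< -[1+ c ] ℤ.* η v (suc (2 ℕ.* n))
  positive = ≡.subst (0ℤ ℤ.<_)
    (≡.trans (ℤ.neg-distribʳ-* -[1+ c ] _) (cong (ℤ._*_ -[1+ c ])
      (≡.trans (cong ℤ.-_ (≡.trans (≡.sym (e .at (suc (2 ℕ.* n)))) (-q-odd (η v) n)))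
        (ℤ.neg-involutive _))))
    (ℤ.neg-mono-< (scaled (v⁺ (suc (2 ℕ.* n)))))

η-dissects-scale : ∀ {w u v c} γ γ² → Dissects (η w) (η u) (const c · η v) → (η γ) ²q ≈ η γ² →
  Dissects (η (w ∙ γ²)) (η (u ∙ γ)) (const c · η (v ∙ γ))
η-dissects-scale {w} {u} {v} γ γ² d e = dissects-cong (≈-trans (·-congˡ e) (η-· w γ²)) (η-· u γ)
  (≈-trans (·-assoc _ _ _) (·-congˡ (η-· v γ))) (dissects-scale d (η γ))

a-sign-pattern : ∀ t₁ t₂ t₃ t₄ → let ts = t₁ ∷ t₂ ∷ t₃ ∷ t₄ ∷ [] in
  SignPattern (η (t₁ ∷ t₂ ∷ t₃ ∷ t₄ ∷ 0ℤ ∷ 0ℤ ∷ 0ℤ ∷ 0ℤ ∷ [])) → SignPattern (a ts)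
a-sign-pattern t₁ t₂ t₃ t₄ p n with p n
... | p₀ , p₁ , p₃ = ≡.subst (0ℤ ℤ.<_) (e (2 ℕ.* n)) p₀ , ≡.subst (ℤ._< 0ℤ) (e (4 ℕ.* n ℕ.+ 1)) p₁
  , ≡.subst (0ℤ ℤ.<_) (e (4 ℕ.* n ℕ.+ 3)) p₃
  where
  e : ∀ k → η (t₁ ∷ t₂ ∷ t₃ ∷ t₄ ∷ 0ℤ ∷ 0ℤ ∷ 0ℤ ∷ 0ℤ ∷ []) k ≡ a (t₁ ∷ t₂ ∷ t₃ ∷ t₄ ∷ []) k
  e k = ≡.sym (a-η .at k)

theorem4p8 : (t₁ t₂ t₃ t₄ : ℤ) → (t₁ ∷ t₂ ∷ t₃ ∷ t₄ ∷ []) ∈ S₇ → (n : ℕ) →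
    (a (t₁ ∷ t₂ ∷ t₃ ∷ t₄ ∷ []) (2 ℕ.* n) > 0ℤ) ×
    (a (t₁ ∷ t₂ ∷ t₃ ∷ t₄ ∷ []) (4 ℕ.* n ℕ.+ 1) < 0ℤ) ×
    (a (t₁ ∷ t₂ ∷ t₃ ∷ t₄ ∷ []) (4 ℕ.* n ℕ.+ 3) > 0ℤ)
-- The eta product is f₁³/f₃ times 1/(f₂f₄²), and the argument 2 encodes the factor -3.
theorem4p8 t₁ t₂ t₃ t₄ (here ≡.refl) = a-sign-pattern t₁ t₂ t₃ t₄ (sign-pattern 2
  (f₂ ÷ (f₁ ∙ f₆)) (f₁ ∙ f₆ ^^ 3 ÷ (f₂ ^^ 3 ∙ f₃ ^^ 2)) (f₃ ^^ 2 ∙ f₁₂ ^^ 2 ÷ (f₁ ∙ f₄ ∙ f₆ ^^ 3))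
  (η-dissects-scale (1ᵉ ÷ (f₁ ∙ f₂ ^^ 2)) (1ᵉ ÷ (f₂ ∙ f₄ ^^ 2)) dissection-f₁³/f₃ η-²q)
  (η-neg-· {f₁ ÷ f₃ ^^ 2} {w = f₆ ^^ 3 ÷ f₂ ^^ 3} {f₆ ^^ 3 ÷ f₂ ^^ 3}
    (η-neg-· {f₁} {w = 1ᵉ ÷ f₃ ^^ 2} η-neg₁ (η-neg-· {1ᵉ ÷ f₃} {w = 1ᵉ ÷ f₃} η-neg₃⁻¹ η-neg₃⁻¹))
      η-neg-even)
  f₂/f₁f₆-pos f₃²f₁₂²/f₁f₄f₆³-pos)
-- The remaining three eta products are f₁⁴/f₂² times the first, second and third power of f₂/f₄³;
-- the argument 3 encodes the factor -4.
theorem4p8 t₁ t₂ t₃ t₄ (there (here ≡.refl)) = a-sign-pattern t₁ t₂ t₃ t₄ (sign-pattern 3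
  (f₂ ^^ 7 ÷ (f₁ ^^ 3 ∙ f₄ ^^ 4)) (f₁ ∙ f₄ ^^ 4 ÷ f₂ ^^ 5) (f₄ ^^ 3 ÷ (f₁ ∙ f₂ ^^ 2))
  (η-dissects-scale (f₁ ÷ f₂ ^^ 3) (f₂ ÷ f₄ ^^ 3) dissection-f₁⁴ η-²q)
  (η-neg-· {f₁} {w = f₄ ^^ 4 ÷ f₂ ^^ 5} {f₄ ^^ 4 ÷ f₂ ^^ 5} η-neg₁ η-neg-even)
  f₂⁷/f₁³f₄⁴-pos f₄³/f₁f₂²-pos)
theorem4p8 t₁ t₂ t₃ t₄ (there (there (here ≡.refl))) = a-sign-pattern t₁ t₂ t₃ t₄ (sign-pattern 3
  (f₂ ^^ 4 ÷ (f₁ ^^ 2 ∙ f₄ ^^ 4)) (f₁ ^^ 2 ∙ f₄ ^^ 4 ÷ f₂ ^^ 8) (f₄ ^^ 2 ÷ (f₁ ^^ 2 ∙ f₂ ^^ 2))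
  (η-dissects-scale (f₁ ^^ 2 ÷ f₂ ^^ 6) (f₂ ^^ 2 ÷ f₄ ^^ 6) dissection-f₁⁴ η-²q)
  (η-neg-· {f₁ ^^ 2} {w = f₄ ^^ 4 ÷ f₂ ^^ 8} {f₄ ^^ 4 ÷ f₂ ^^ 8}
    (η-neg-· {f₁} {w = f₁} η-neg₁ η-neg₁) η-neg-even)
  f₂⁴/f₁²f₄⁴-pos f₄²/f₁²f₂²-pos)
theorem4p8 t₁ t₂ t₃ t₄ (there (there (there (here ≡.refl)))) = a-sign-pattern t₁ t₂ t₃ t₄
  (sign-pattern 3
  (f₂ ÷ (f₁ ∙ f₄ ^^ 4)) (f₁ ^^ 3 ∙ f₄ ^^ 4 ÷ f₂ ^^ 11) (f₄ ÷ (f₁ ^^ 3 ∙ f₂ ^^ 2))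
  (η-dissects-scale (f₁ ^^ 3 ÷ f₂ ^^ 9) (f₂ ^^ 3 ÷ f₄ ^^ 9) dissection-f₁⁴ η-²q)
  (η-neg-· {f₁ ^^ 3} {w = f₄ ^^ 4 ÷ f₂ ^^ 11} {f₄ ^^ 4 ÷ f₂ ^^ 11}
    (η-neg-· {f₁ ^^ 2} {w = f₁} (η-neg-· {f₁} {w = f₁} η-neg₁ η-neg₁) η-neg₁) η-neg-even)
  f₂/f₁f₄⁴-pos f₄/f₁³f₂²-pos)
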